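{- Let $\mathcal{Q}$ be a thin forest poset (with its standard labeling). Then the map $\phi:\mathsf{As}(\mathcal{Q}^\perp)\to\mathsf{As}(\mathcal{Q})^!$ defined for every $b\in\mathcal{Q}^\perp$ by $$\phi(\star_b):=\bar{\mathtt{A}}_b:=\sum_{\substack{a\in\mathcal{Q}^\perp\\ a\preccurlyeq_{\mathcal{Q}^\perp} b}}\ \sum_{\substack{c\in\mathcal{Q}\\ a\preccurlyeq_\mathcal{Q} c}}\bar\star_c$$ extends in a unique way to an isomorphism of operads.
   Context: Operads are nonsymmetric over a field $\mathbb{K}$ of characteristic zero. For a finite poset $\mathcal{Q}$ and comparable $a,b$, $a\uparrow_\mathcal{Q} b:=\min(a,b)$. $\mathsf{As}(\mathcal{Q})$ is the operad with presentation $(\mathfrak{G},\mathfrak{R})$ where $\mathfrak{G}=\{\star_a:a\in\mathcal{Q}\}$ are binary generators and $\mathfrak{R}$ is spanned by $\star_a\circ_1\star_b-\star_{a\uparrow b}\circ_2\star_{a\uparrow b}$ and $\star_{a\uparrow b}\circ_1\star_{a\uparrow b}-\star_a\circ_2\star_b$ for all comparable $a,b$ (including $a=b$). Koszul dual: for a binary quadratic operad with presentation $(\mathfrak{G},\mathfrak{R})$, $\mathfrak{G}$ finite, its Koszul dual has presentation $(\bar{\mathfrak{G}},\mathfrak{R}^\perp)$, where $\bar\star_a$ denotes the generator corresponding to $\star_a$ and $\mathfrak{R}^\perp$ is the annihilator of $\mathfrak{R}$ in the arity-$3$ part of the free operad for the bilinear form with $\langle x\circ_i y,x'\circ_{i'}y'\rangle=1$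 if $x=x',y=y',i=i'=1$, $=-1$ if $x=x',y=y',i=i'=2$, and $0$ otherwise. A forest poset is a poset with no element lying strictly above two incomparable elements; its Hasse diagram is a forest of rooted trees with minimal elements as roots. A thin forest poset is a forest poset containing no four elements $a\prec b$, $c\prec d$ with each of $a,b$ incomparable to each of $c,d$; equivalently, adding a new common root to the Hasse diagram yields a rooted tree in which every node has at most one child whose subtree has two or more nodes. The standard labeling of a thin forest poset labels its elements $1,\dots,\#\mathcal{Q}$ in the order of a depth-first (preorder) traversal of this forest in which, among siblings, the one with the largest subtree is visited last; elements are identified with their labels. The dual $\mathcal{Q}^\perp$ is the poset on the same set $\{1,\dots,\#\mathcal{Q}\}$ with $a\preccurlyeq_{\mathcal{Q}^\perp}b$ iff $a=b$, or $a,b$ are incomparable in $\mathcal{Q}$ and $a<b$ as integers; it is again a thin forest poset. -}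

module Defs where

open import Level using (Level; _⊔_; Lift) renaming (suc to lsuc)
open import Data.Nat using (ℕ; zero; suc; _+_; _∸_; _≤_; _<_; _<?_; _<ᵇ_; _≤ᵇ_; _≡ᵇ_)
open import Data.Fin using (Fin; toℕ) renaming (_≟_ to _≟F_)
open import Data.Bool using (Bool; true; false; if_then_else_; _∧_; _∨_; not)
open import Data.List using (List; []; _∷_; _++_; map; concatMap; allFin)
open import Data.List.Relation.Unary.All using (All)
open import Data.Product using (Σ; _×_; _,_; ∃; proj₁; proj₂)
open import Data.Sum using (_⊎_)
open import Data.Unit using (⊤)
open import Data.Empty using (⊥)
open import Relation.Nullary using (¬_; Dec; yes; no; does)
open import Relation.Binary.PropositionalEquality using (_≡_; _≢_; refl; cong; cong₂)
open import Algebra.Bundles using (CommutativeRing)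

natEmb : ∀ {c ℓ} (R : CommutativeRing c ℓ) → ℕ → CommutativeRing.Carrier R
natEmb R zero = CommutativeRing.0# R
natEmb R (suc n) = CommutativeRing._+_ R (CommutativeRing.1# R) (natEmb R n)

record CharZeroField (c ℓ : Level) : Set (lsuc (c ⊔ ℓ)) where
  field
    cring : CommutativeRing c ℓ
  open CommutativeRing cring
  field
    nontrivial : ¬ (1# ≈ 0#)
    inverse    : ∀ x → ¬ (x ≈ 0#) → ∃ λ y → (x * y) ≈ 1#
    charZero   : ∀ n → natEmb cring n ≈ 0# → n ≡ 0

-- Binary trees (tree monomials of the free nonsymmetric operad on
-- binary generators indexed by Fin g); leaves are inputs, numbered
-- 0,1,2,... from left to right.

data BT (g : ℕ) : Set where
  leaf : BT g
  node : Fin g → BT g → BT g → BT g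

arity : ∀ {g} → BT g → ℕ
arity leaf = 1
arity (node _ l r) = arity l + arity r

-- partial composition s ∘_(i+1) t (0-based leaf index i)
graft : ∀ {g} → BT g → ℕ → BT g → BT g
graft leaf zero t = t
graft leaf (suc i) t = leaf
graft (node x l r) i t with i <? arity l
... | yes _ = node x (graft l i t) r
... | no _ = node x l (graft r (i ∸ arity l) t)

node-inj₁ : ∀ {g} {x y : Fin g} {l l' r r' : BT g} → node x l r ≡ node y l' r' → x ≡ y
node-inj₁ refl = refl
node-inj₂ : ∀ {g} {x y : Fin g} {l l' r r' : BT g} → node x l r ≡ node y l' r' → l ≡ l'
node-inj₂ refl = refl
node-inj₃ : ∀ {g} {x y : Fin g} {l l' r r' : BT g} → node x l r ≡ node y l' r' → r ≡ r'
node-inj₃ refl = refl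

_≟T_ : ∀ {g} (s t : BT g) → Dec (s ≡ t)
leaf ≟T leaf = yes refl
leaf ≟T node _ _ _ = no λ ()
node _ _ _ ≟T leaf = no λ ()
node x l r ≟T node y l' r' with x ≟F y | l ≟T l' | r ≟T r'
... | yes refl | yes refl | yes refl = yes refl
... | no p | _ | _ = no λ e → p (node-inj₁ e)
... | yes _ | no p | _ = no λ e → p (node-inj₂ e)
... | yes _ | yes _ | no p = no λ e → p (node-inj₃ e)

c1 c2 : ∀ {g} → Fin g → Fin g → BT g
c1 x y = node x (node y leaf leaf) leaf
c2 x y = node x leaf (node y leaf leaf)

gen : ∀ {g} → Fin g → BT g
gen x = node x leaf leaf

Rel : ℕ → Set
Rel n = Fin n → Fin n → Bool

comp : ∀ {n} → Rel n → Fin n → Fin n → Bool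
comp le a b = le a b ∨ le b a

up : ∀ {n} → Rel n → Fin n → Fin n → Fin n
up le a b = if le a b then a else b

Strict : ∀ {n} → Rel n → Fin n → Fin n → Set
Strict le a b = (le a b ≡ true) × (a ≢ b)

Inc : ∀ {n} → Rel n → Fin n → Fin n → Set
Inc le a b = comp le a b ≡ false

Thin : ∀ {n} → Rel n → Set
Thin le = ∀ a b c d → Strict le a b → Strict le c d →
          Inc le a c → Inc le a d → Inc le b c → Inc le b d → ⊥

-- Plane forests; the forest poset of a forest with its preorder
-- (depth-first) labeling 0,1,...,size-1

data RTree : Set where
  rnode : List RTree → RTree

Forest : Set
Forest = List RTree

mutual
  sizeT : RTree → ℕ
  sizeT (rnode ts) = suc (sizeF ts)

  sizeF : Forest → ℕ
  sizeF [] = 0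
  sizeF (t ∷ ts) = sizeT t + sizeF ts

-- strict ancestor relation between preorder labels
mutual
  ancT : RTree → ℕ → ℕ → Bool
  ancT (rnode ts) zero j = (0 <ᵇ j) ∧ (j <ᵇ suc (sizeF ts))
  ancT (rnode ts) (suc i) zero = false
  ancT (rnode ts) (suc i) (suc j) = ancF ts i j

  ancF : Forest → ℕ → ℕ → Bool
  ancF [] i j = false
  ancF (t ∷ ts) i j =
    if (i <ᵇ sizeT t) ∧ (j <ᵇ sizeT t) then ancT t i j
    else (if (sizeT t ≤ᵇ i) ∧ (sizeT t ≤ᵇ j)
          then ancF ts (i ∸ sizeT t) (j ∸ sizeT t) else false)

lastSize : Forest → ℕ
lastSize [] = 0
lastSize (t ∷ []) = sizeT t
lastSize (t ∷ u ∷ us) = lastSize (u ∷ us)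

LastMax : Forest → Set
LastMax ts = All (λ t → sizeT t ≤ lastSize ts) ts

mutual
  StdT : RTree → Set
  StdT (rnode ts) = StdL ts × LastMax ts

  StdL : Forest → Set
  StdL [] = ⊤
  StdL (t ∷ ts) = StdT t × StdL ts

-- the preorder labeling of F is a standard labeling: in every sibling
-- list (including the list of roots, i.e. children of the added
-- common root) the largest subtree comes last
Standard : Forest → Set
Standard F = StdT (rnode F)

leQ : (F : Forest) → Rel (sizeF F)
leQ F i j = (toℕ i ≡ᵇ toℕ j) ∨ ancF F (toℕ i) (toℕ j)

leD : (F : Forest) → Rel (sizeF F)
leD F i j = (toℕ i ≡ᵇ toℕ j) ∨ (not (comp (leQ F) i j) ∧ (toℕ i <ᵇ toℕ j))

module WithField {c ℓ : Level} (K : CharZeroField c ℓ) where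
  open CharZeroField K
  open CommutativeRing cring using (Carrier; _≈_; 0#; 1#; -_)
    renaming (_+_ to _+K_; _*_ to _*K_)

  -- formal linear combinations of tree monomials (elements of the
  -- free operad F(G), G = {generators indexed by Fin g})
  FS : ℕ → Set c
  FS g = List (Carrier × BT g)

  coeff : ∀ {g} → FS g → BT g → Carrier
  coeff [] t = 0#
  coeff ((a , s) ∷ v) t = if does (s ≟T t) then a +K coeff v t else coeff v t

  _≈FS_ : ∀ {g} → FS g → FS g → Set ℓ
  v ≈FS w = ∀ t → coeff v t ≈ coeff w t

  scale : ∀ {g} → Carrier → FS g → FS g
  scale k v = map (λ e → k *K proj₁ e , proj₂ e) v

  _-FS_ : ∀ {g} → FS g → FS g → FS g
  v -FS w = v ++ scale (- 1#) w

  composeFS : ∀ {g} → FS g → ℕ → FS g → FS g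
  composeFS v i w =
    concatMap (λ e → map (λ f → proj₁ e *K proj₁ f , graft (proj₂ e) i (proj₂ f)) w) v

  -- T ∘_i (r ∘ (u₀, u₁, u₂)) for r of arity 3
  fill : ∀ {g} → BT g → ℕ → FS g → BT g → BT g → BT g → FS g
  fill T i r u₀ u₁ u₂ =
    map (λ e → proj₁ e , graft T i (graft (graft (graft (proj₂ e) 2 u₂) 1 u₁) 0 u₀)) r

  -- relations of a presentation: a predicate on FS g (the space of
  -- relations, or a spanning set of it), consisting of arity-3 elements
  Relations : ℕ → Set (lsuc (c ⊔ ℓ))
  Relations g = FS g → Set (c ⊔ ℓ)

  record IdealTerm {g} (R : Relations g) : Set (c ⊔ ℓ) where
    field
      coef : Carrier
      ctx  : BT g
      pos  : ℕ
      pos< : pos < arity ctx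
      rel  : FS g
      relR : R rel
      u₀ u₁ u₂ : BT g

  evalTerm : ∀ {g} {R : Relations g} → IdealTerm R → FS g
  evalTerm τ = scale coef (fill ctx pos rel u₀ u₁ u₂)
    where open IdealTerm τ

  InIdeal : ∀ {g} → Relations g → FS g → Set (c ⊔ ℓ)
  InIdeal R v = Σ (List (IdealTerm R)) λ τs → v ≈FS concatMap evalTerm τs

  Eq : ∀ {g} → Relations g → FS g → FS g → Set (c ⊔ ℓ)
  Eq R v w = InIdeal R (v -FS w)

  rel₁ rel₂ : ∀ {g} → Rel g → Fin g → Fin g → FS g
  rel₁ le a b = (1# , c1 a b) ∷ (- 1# , c2 (up le a b) (up le a b)) ∷ []
  rel₂ le a b = (1# , c1 (up le a b) (up le a b)) ∷ (- 1# , c2 a b) ∷ []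

  AsRel : ∀ {g} → Rel g → Relations g
  AsRel le r = Lift ℓ (Σ (Fin _) λ a → Σ (Fin _) λ b →
    (comp le a b ≡ true) × ((r ≡ rel₁ le a b) ⊎ (r ≡ rel₂ le a b)))

  sign : ∀ {g} → BT g → Carrier
  sign (node x (node y leaf leaf) leaf) = 1#
  sign (node x leaf (node y leaf leaf)) = - 1#
  sign _ = 0#

  pairT : ∀ {g} → BT g → BT g → Carrier
  pairT s t = if does (s ≟T t) then sign s else 0#

  pairing : ∀ {g} → FS g → FS g → Carrier
  pairing [] w = 0#
  pairing ((a , s) ∷ v) w = go w +K pairing v w
    where
    go : FS _ → Carrier
    go [] = 0#
    go ((b , t) ∷ w') = ((a *K b) *K pairT s t) +K go w'

  -- the Koszul dual relations R^⊥: arity-3 elements annihilating R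
  -- (generators of the dual are again indexed by Fin g: x ↦ x̄)
  Dual : ∀ {g} → Relations g → Relations g
  Dual R v = All (λ e → arity (proj₂ e) ≡ 3) v × (∀ r → R r → pairing v r ≈ 0#)

  -- Morphisms F(G)/⟨R⟩ → F(G')/⟨R'⟩, given by the image of each tree
  -- monomial (a representative of the image in the target)

  ext : ∀ {g g'} → (BT g → FS g') → FS g → FS g'
  ext Φ v = concatMap (λ e → scale (proj₁ e) (Φ (proj₂ e))) v

  record IsMorphism {g g'} (R : Relations g) (R' : Relations g')
                    (Φ : BT g → FS g') : Set (c ⊔ ℓ) where
    field
      homogeneous : ∀ t → All (λ e → arity (proj₂ e) ≡ arity t) (Φ t)
      wellDefined : ∀ v → InIdeal R v → InIdeal R' (ext Φ v)
      unit        : Eq R' (Φ leaf) ((1# , leaf) ∷ [])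
      composition : ∀ s i t → i < arity s →
                    Eq R' (Φ (graft s i t)) (composeFS (Φ s) i (Φ t))

  record IsIsomorphism {g g'} (R : Relations g) (R' : Relations g')
                       (Φ : BT g → FS g') : Set (c ⊔ ℓ) where
    field
      morphism   : IsMorphism R R' Φ
      injective  : ∀ v → InIdeal R' (ext Φ v) → InIdeal R v
      surjective : ∀ w → Σ (FS g) λ v → Eq R' (ext Φ v) w

  Abar : (F : Forest) → Fin (sizeF F) → FS (sizeF F)
  Abar F b =
    concatMap (λ a → if leD F a b
                     then concatMap (λ c' → if leQ F a c'
                                            then (1# , gen c') ∷ [] else [])
                                    (allFin (sizeF F))
                     else [])
              (allFin (sizeF F))

  Extends : (F : Forest) → (BT (sizeF F) → FS (sizeF F)) → Set (c ⊔ ℓ)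
  Extends F Φ = ∀ b → Eq (Dual (AsRel (leQ F))) (Φ (gen b)) (Abar F b)

{-# OPTIONS --safe #-}
module Submission where

-- Write Z_P for the incidence matrix of a poset P. The change of generators is M = Z_{Q^⊥}ᵀ Z_Q, in
-- two steps: B_a = Σ_{a ≼_Q c} ⋆̄_c and Ā_b = Σ_{a ≼_{Q^⊥} b} B_a. Both incidence matrices are
-- unitriangular, so M is invertible over the integers and only the relations have to be compared.
-- In Q and in Q^⊥ two elements below comparable elements are comparable, and two elements are
-- comparable in exactly one of Q and Q^⊥ unless they are equal. Hence M_ac M_bd = M_{min(a,b) min(c,d)}
-- for a, b comparable in Q^⊥ and c, d comparable in Q, which says that the relations of As(Q^⊥) are
-- sent to R^⊥. Conversely an element of R^⊥ has coefficients z(min(c,d)) at ⋆̄_c ∘₁ ⋆̄_d and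
-- -z(min(c,d)) at ⋆̄_c ∘₂ ⋆̄_d for comparable c, d. Möbius inversion in Q makes these coefficients
-- diagonal on comparable pairs in the basis B, and Möbius inversion in Q^⊥ then shows that the
-- coefficients in the generators ⋆_b vanish at incomparable pairs and that, for each p, those at the
-- pairs with minimum p add up to zero; both properties together characterise the span of the
-- relations of As(Q^⊥).
-- Uniqueness holds because the ideal of relations is zero in arity 2.

open import Defs
open import Level using (Level; _⊔_; lift)
open import Data.Nat using (ℕ; zero; suc; z≤n; s≤s; _≤_; _<_)
import Data.Nat as ℕ
import Data.Nat.Properties as ℕ
open import Data.Fin using (Fin; zero; suc; toℕ; fromℕ<) renaming (_≟_ to _≟F_)
open import Data.Bool using (Bool; T; true; false; if_then_else_; _∧_; _∨_; not)
open import Data.Bool.Properties using (∨-comm)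
open import Data.Fin.Properties using (toℕ-injective; toℕ-fromℕ<; toℕ<n)
open import Relation.Binary.Definitions using (tri<; tri≈; tri>)
open import Data.List using (List; []; _∷_; _++_; map; concatMap; allFin; tabulate; length)
open import Data.List.Properties using (concatMap-++)
open import Data.List.Relation.Unary.All using (All; []; _∷_)
import Data.List.Relation.Unary.All as All
import Data.List.Relation.Unary.All.Properties as All
open import Data.Product using (Σ; _×_; _,_; ∃; proj₁; proj₂)
open import Data.Sum using (_⊎_; inj₁; inj₂)
open import Data.Empty using (⊥; ⊥-elim)
open import Data.Unit using (⊤; tt)
open import Relation.Nullary using (¬_; yes; no; does)
open import Relation.Binary.PropositionalEquality as ≡ using (_≡_; _≢_)
open import Algebra.Bundles using (CommutativeRing)

-- Formal sums are lists, and collecting their terms by hand would dominate every computation. They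
-- are therefore compared through all linear functionals: a linear operation on sums becomes an
-- operation on the functional, and multilinearity becomes the exchange law `⟪⟫-comm`. Substitution
-- of generators is strictly compatible with grafting in the free operad, so what remains is to
-- compare two spaces of arity-3 relations, that is, pairs of square matrices. The obstacle is that
-- the relations constrain coefficients at comparable pairs only; an element of the dual relations
-- is arbitrary at the other pairs. It is overcome by the support of the Möbius function: at a
-- comparable pair, an entry of the congruence `μᵀ x μ` depends only on entries of `x` at comparable
-- pairs, so the unknown entries may be filled in at will. `Standard` and `Thin` enter through one
-- property of Q^⊥: the elements below a given one form a chain.

module Matrices {c ℓ} (R : CommutativeRing c ℓ) where
  open CommutativeRing R hiding (zero)
  open import Algebra.Properties.Ring ring public
    using (-0#≈0#; -‿distribˡ-*; -‿distribʳ-*; -1*x≈-x; -‿+-comm; -‿involutive)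
  open import Algebra.Properties.Semiring.Sum semiring public
    using (sum; sum-syntax; ∑-comm; ∑-distrib-+; *-distribˡ-sum; *-distribʳ-sum)
  open import Algebra.Properties.Semiring.Sum semiring using (sum-replicate-zero; sum-cong-≋)
  open import Relation.Binary.Reasoning.Setoid setoid

  ∑-cong : ∀ {n} {f g : Fin n → Carrier} → (∀ i → f i ≈ g i) → sum f ≈ sum g
  ∑-cong e = sum-cong-≋ e

  ∑-zero : ∀ {n} {f : Fin n → Carrier} → (∀ i → f i ≈ 0#) → sum f ≈ 0#
  ∑-zero {n} e = trans (∑-cong e) (sum-replicate-zero n)

  ∑-neg : ∀ {n} (f : Fin n → Carrier) → (∑[ i < n ] (- f i)) ≈ - sum f
  ∑-neg {n} f = begin
    (∑[ i < n ] (- f i))          ≈⟨ ∑-cong (λ i → -1*x≈-x (f i)) ⟨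
    (∑[ i < n ] (- 1# * f i))   ≈⟨ *-distribˡ-sum (- 1#) f ⟨
    - 1# * sum f                ≈⟨ -1*x≈-x _ ⟩
    - sum f                     ∎

  ⟦_⟧ : Bool → Carrier
  ⟦ true ⟧ = 1#
  ⟦ false ⟧ = 0#

  δ : ∀ {n} → Fin n → Fin n → Carrier
  δ i j = ⟦ does (i ≟F j) ⟧

  ∑-δˡ : ∀ {n} (i : Fin n) (f : Fin n → Carrier) → (∑[ j < n ] (δ i j * f j)) ≈ f i
  ∑-δˡ zero f = trans (+-cong (*-identityˡ _) (∑-zero λ j → zeroˡ (f (suc j)))) (+-identityʳ _)
  ∑-δˡ (suc i) f = trans (+-cong (zeroˡ _) (∑-δˡ i (λ j → f (suc j)))) (+-identityˡ _)

  ∑-δʳ : ∀ {n} (i : Fin n) (f : Fin n → Carrier) → (∑[ j < n ] (f j * δ j i)) ≈ f i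
  ∑-δʳ zero f = trans (+-cong (*-identityʳ _) (∑-zero λ j → zeroʳ (f (suc j)))) (+-identityʳ _)
  ∑-δʳ (suc i) f = trans (+-cong (zeroʳ _) (∑-δʳ i (λ j → f (suc j)))) (+-identityˡ _)

  Matrix : ℕ → Set c
  Matrix n = Fin n → Fin n → Carrier

  infixl 7 _⊗_
  _⊗_ : ∀ {n} → Matrix n → Matrix n → Matrix n
  (A ⊗ B) i j = ∑[ k < _ ] (A i k * B k j)

  _ᵀ : ∀ {n} → Matrix n → Matrix n
  (A ᵀ) i j = A j i

  infix 4 _≈M_
  _≈M_ : ∀ {n} → Matrix n → Matrix n → Set ℓ
  A ≈M B = ∀ i j → A i j ≈ B i j

  ⊗-cong : ∀ {n} {A A' B B' : Matrix n} → A ≈M A' → B ≈M B' → A ⊗ B ≈M A' ⊗ B'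
  ⊗-cong p q i j = ∑-cong λ k → *-cong (p i k) (q k j)

  ⊗-assoc : ∀ {n} (A B C : Matrix n) → (A ⊗ B) ⊗ C ≈M A ⊗ (B ⊗ C)
  ⊗-assoc A B C i j = begin
    sum (λ k → sum (λ l → A i l * B l k) * C k j)
      ≈⟨ ∑-cong (λ k → *-distribʳ-sum (C k j) (λ l → A i l * B l k)) ⟩
    sum (λ k → sum (λ l → A i l * B l k * C k j))
      ≈⟨ ∑-comm (λ k l → A i l * B l k * C k j) ⟩
    sum (λ l → sum (λ k → A i l * B l k * C k j))
      ≈⟨ ∑-cong (λ l → ∑-cong λ k → *-assoc (A i l) (B l k) (C k j)) ⟩
    sum (λ l → sum (λ k → A i l * (B l k * C k j)))
      ≈⟨ ∑-cong (λ l → *-distribˡ-sum (A i l) (λ k → B l k * C k j)) ⟨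
    sum (λ l → A i l * sum (λ k → B l k * C k j)) ∎

  ⊗-ᵀ : ∀ {n} (A B : Matrix n) → (A ⊗ B) ᵀ ≈M B ᵀ ⊗ A ᵀ
  ⊗-ᵀ {n} A B i j = ∑-cong {n} λ k → *-comm (A j k) (B k i)

  ⊗-identityˡ : ∀ {n} (A : Matrix n) → δ ⊗ A ≈M A
  ⊗-identityˡ A i j = ∑-δˡ i (λ k → A k j)

  ⊗-identityʳ : ∀ {n} (A : Matrix n) → A ⊗ δ ≈M A
  ⊗-identityʳ A i j = ∑-δʳ j (A i)

  ≈M-sym : ∀ {n} {A B : Matrix n} → A ≈M B → B ≈M A
  ≈M-sym p i j = sym (p i j)

  ≈M-trans : ∀ {n} {A B C : Matrix n} → A ≈M B → B ≈M C → A ≈M C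
  ≈M-trans p q i j = trans (p i j) (q i j)

  δ-sym : ∀ {n} (i j : Fin n) → δ i j ≈ δ j i
  δ-sym zero zero = refl
  δ-sym zero (suc j) = refl
  δ-sym (suc i) zero = refl
  δ-sym (suc i) (suc j) = δ-sym i j

  ⊗-cancel : ∀ {n} {A B C D : Matrix n} → B ⊗ C ≈M δ → A ⊗ D ≈M δ → (A ⊗ B) ⊗ (C ⊗ D) ≈M δ
  ⊗-cancel {A = A} {B} {C} {D} p q i j = begin
    ((A ⊗ B) ⊗ (C ⊗ D)) i j   ≈⟨ ⊗-assoc A B (C ⊗ D) i j ⟩
    (A ⊗ (B ⊗ (C ⊗ D))) i j   ≈⟨ ⊗-cong {A = A} (λ _ _ → refl) (≈M-sym (⊗-assoc B C D)) i j ⟩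
    (A ⊗ ((B ⊗ C) ⊗ D)) i j
      ≈⟨ ⊗-cong {A = A} (λ _ _ → refl) (≈M-trans (⊗-cong {B = D} p (λ _ _ → refl)) (⊗-identityˡ D)) i j ⟩
    (A ⊗ D) i j               ≈⟨ q i j ⟩
    δ i j ∎

  -- Incidence matrices, their Möbius inverses and the Frobenius pairing.

  ζ : ∀ {n} → Rel n → Matrix n
  ζ P i j = ⟦ P i j ⟧

  -- `support` says that the inverse lies in the incidence algebra of `P`; it cuts sums against `μ`
  -- down to indices below a fixed element.
  record MöbiusInverse {n} (P : Rel n) : Set (c ⊔ ℓ) where
    field
      μ       : Matrix n
      ζμ≈δ    : ζ P ⊗ μ ≈M δ
      μζ≈δ    : μ ⊗ ζ P ≈M δ
      support : ∀ i j → P i j ≡ false → μ i j ≈ 0#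

  -- Induction on the number of elements. Labels increase along `P`, so nothing but 0 lies below 0
  -- and `ζ P` is block triangular with rows (1, r) and (0, ζ⁺). Its inverse has rows (1, -rμ) and
  -- (0, μ), with `μ` the inverse of ζ⁺.
  möbiusInverse : ∀ {n} (P : Rel n) → (∀ i → P i i ≡ true) →
    (∀ i j k → P i j ≡ true → P j k ≡ true → P i k ≡ true) →
    (∀ i j → P i j ≡ true → toℕ i ≤ toℕ j) → MöbiusInverse P
  möbiusInverse {zero} P P-refl P-trans P-mono =
    record { μ = λ () ; ζμ≈δ = λ () ; μζ≈δ = λ () ; support = λ () }
  möbiusInverse {suc n} P P-refl P-trans P-mono =
    record { μ = μ' ; ζμ≈δ = left ; μζ≈δ = right ; support = supp }
    where
    P⁺ : Rel n
    P⁺ i j = P (suc i) (suc j)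

    rec : MöbiusInverse P⁺
    rec = möbiusInverse P⁺ (λ i → P-refl (suc i)) (λ i j k → P-trans (suc i) (suc j) (suc k))
            (λ i j p → ℕ.≤-pred (P-mono (suc i) (suc j) p))
    open MöbiusInverse rec

    row : Fin n → Carrier
    row j = ∑[ k < n ] (ζ P zero (suc k) * μ k j)

    μ' : Matrix (suc n)
    μ' zero zero = 1#
    μ' zero (suc j) = - row j
    μ' (suc i) zero = 0#
    μ' (suc i) (suc j) = μ i j

    ζ₀₀ : ζ P zero zero ≈ 1#
    ζ₀₀ rewrite P-refl zero = refl

    ζ₊₀ : ∀ i → ζ P (suc i) zero ≈ 0#
    ζ₊₀ i with P (suc i) zero in eq
    ... | true with () ← P-mono (suc i) zero eq
    ... | false = refl

    left : ζ P ⊗ μ' ≈M δ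
    left zero zero =
      trans (+-cong (trans (*-identityʳ _) ζ₀₀) (∑-zero λ k → zeroʳ (ζ P zero (suc k)))) (+-identityʳ _)
    left zero (suc j) =
      trans (+-congʳ (trans (*-congʳ ζ₀₀) (*-identityˡ _))) (-‿inverseˡ (row j))
    left (suc i) zero =
      trans (+-cong (trans (*-identityʳ _) (ζ₊₀ i)) (∑-zero λ k → zeroʳ (ζ P (suc i) (suc k)))) (+-identityʳ _)
    left (suc i) (suc j) =
      trans (+-cong (trans (*-congʳ (ζ₊₀ i)) (zeroˡ _)) (ζμ≈δ i j)) (+-identityˡ _)

    right : μ' ⊗ ζ P ≈M δ
    right zero zero =
      trans (+-cong (trans (*-identityˡ _) ζ₀₀) (∑-zero λ k → trans (*-congˡ (ζ₊₀ k)) (zeroʳ _))) (+-identityʳ _)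
    right zero (suc j) = begin
      1# * z j + sum (λ k → - row k * ζ P⁺ k j)
        ≈⟨ +-cong (*-identityˡ _) (trans (∑-cong λ k → sym (-‿distribˡ-* (row k) (ζ P⁺ k j))) (∑-neg (λ k → row k * ζ P⁺ k j))) ⟩
      z j + - sum (λ k → row k * ζ P⁺ k j)
        ≈⟨ +-congˡ (-‿cong (≈r)) ⟩
      z j + - z j ≈⟨ -‿inverseʳ _ ⟩
      0# ∎
      where
      z : Fin n → Carrier
      z j = ζ P zero (suc j)
      -- A row vector is turned into a matrix with constant rows, so that associativity of square
      -- matrices applies to it.
      Z : Matrix n
      Z _ j = z j
      ≈r : sum (λ k → row k * ζ P⁺ k j) ≈ z j
      ≈r = trans (⊗-assoc Z μ (ζ P⁺) j j)
             (trans (⊗-cong {A = Z} (λ _ _ → refl) μζ≈δ j j) (⊗-identityʳ Z j j))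
    right (suc i) zero =
      trans (+-cong (zeroˡ _) (∑-zero λ k → trans (*-congˡ (ζ₊₀ k)) (zeroʳ _))) (+-identityʳ _)
    right (suc i) (suc j) = trans (+-cong (zeroˡ _) (μζ≈δ i j)) (+-identityˡ _)

    supp : ∀ i j → P i j ≡ false → μ' i j ≈ 0#
    supp zero zero p with () ← ≡.trans (≡.sym (P-refl zero)) p
    supp zero (suc j) p = trans (-‿cong (∑-zero term)) -0#≈0#
      where
      term : ∀ k → ζ P zero (suc k) * μ k j ≈ 0#
      term k with P zero (suc k) in q | P (suc k) (suc j) in r
      ... | false | _ = zeroˡ _
      ... | true | false = trans (*-congˡ (support k j r)) (zeroʳ _)
      ... | true | true with () ← ≡.trans (≡.sym (P-trans zero (suc k) (suc j) q r)) p
    supp (suc i) zero p = refl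
    supp (suc i) (suc j) p = support i j p

  -- The Frobenius pairing. Multiplication by a matrix, on either side, has multiplication by its
  -- transpose as adjoint.
  ⟨_,_⟩ : ∀ {n} → Matrix n → Matrix n → Carrier
  ⟨_,_⟩ {n} A B = ∑[ i < n ] (∑[ j < n ] (A i j * B i j))

  ⟨⟩-cong : ∀ {n} {A A' B B' : Matrix n} → A ≈M A' → B ≈M B' → ⟨ A , B ⟩ ≈ ⟨ A' , B' ⟩
  ⟨⟩-cong p q = ∑-cong λ i → ∑-cong λ j → *-cong (p i j) (q i j)

  ⟨⟩-ᵀ : ∀ {n} (A B : Matrix n) → ⟨ A ᵀ , B ᵀ ⟩ ≈ ⟨ A , B ⟩
  ⟨⟩-ᵀ A B = ∑-comm λ i j → A j i * B j i

  ⟨⟩-adjointʳ : ∀ {n} (A B C : Matrix n) → ⟨ A ⊗ B , C ⟩ ≈ ⟨ A , C ⊗ B ᵀ ⟩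
  ⟨⟩-adjointʳ {n} A B C = ∑-cong λ i → begin
    sum (λ j → sum (λ k → A i k * B k j) * C i j)
      ≈⟨ ∑-cong (λ j → *-distribʳ-sum (C i j) (λ k → A i k * B k j)) ⟩
    sum (λ j → sum (λ k → A i k * B k j * C i j))
      ≈⟨ ∑-comm (λ j k → A i k * B k j * C i j) ⟩
    sum (λ k → sum (λ j → A i k * B k j * C i j))
      ≈⟨ ∑-cong (λ k → ∑-cong λ j → trans (*-assoc (A i k) (B k j) (C i j)) (*-congˡ (*-comm (B k j) (C i j)))) ⟩
    sum (λ k → sum (λ j → A i k * (C i j * B k j)))
      ≈⟨ ∑-cong (λ k → *-distribˡ-sum (A i k) (λ j → C i j * B k j)) ⟨
    sum (λ k → A i k * sum (λ j → C i j * B k j)) ∎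

  ⟨⟩-adjointˡ : ∀ {n} (A B C : Matrix n) → ⟨ A ⊗ B , C ⟩ ≈ ⟨ B , A ᵀ ⊗ C ⟩
  ⟨⟩-adjointˡ A B C = begin
    ⟨ A ⊗ B , C ⟩               ≈⟨ ⟨⟩-ᵀ (A ⊗ B) C ⟨
    ⟨ (A ⊗ B) ᵀ , C ᵀ ⟩         ≈⟨ ⟨⟩-cong {B = C ᵀ} (⊗-ᵀ A B) (λ _ _ → refl) ⟩
    ⟨ B ᵀ ⊗ A ᵀ , C ᵀ ⟩         ≈⟨ ⟨⟩-adjointʳ (B ᵀ) (A ᵀ) (C ᵀ) ⟩
    ⟨ B ᵀ , C ᵀ ⊗ A ⟩           ≈⟨ ⟨⟩-cong {A = B ᵀ} (λ _ _ → refl) (⊗-ᵀ (A ᵀ) C) ⟨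
    ⟨ B ᵀ , (A ᵀ ⊗ C) ᵀ ⟩       ≈⟨ ⟨⟩-ᵀ B (A ᵀ ⊗ C) ⟩
    ⟨ B , A ᵀ ⊗ C ⟩             ∎

-- Formal sums of trees and linear functionals on them.

module Integration {c ℓ} (K : CharZeroField c ℓ) where
  open WithField K
  open CommutativeRing (CharZeroField.cring K) hiding (zero)
  open Matrices (CharZeroField.cring K)
  open import Algebra.Properties.CommutativeSemigroup +-commutativeSemigroup using ()
    renaming (interchange to +-interchange)
  open import Algebra.Properties.CommutativeSemigroup *-commutativeSemigroup using ()
    renaming (x∙yz≈y∙xz to *-x∙yz≈y∙xz)
  open import Relation.Binary.Reasoning.Setoid setoid

  private variable
    g g' n : ℕ

  -- The value at v of the linear functional that takes the value h t at the tree t.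
  ⟪_∣_⟫ : FS g → (BT g → Carrier) → Carrier
  ⟪ [] ∣ h ⟫ = 0#
  ⟪ (a , s) ∷ v ∣ h ⟫ = a * h s + ⟪ v ∣ h ⟫

  ⟪⟫-congAll : ∀ (v : FS g) {h h'} → All (λ e → h (proj₂ e) ≈ h' (proj₂ e)) v → ⟪ v ∣ h ⟫ ≈ ⟪ v ∣ h' ⟫
  ⟪⟫-congAll [] [] = refl
  ⟪⟫-congAll (_ ∷ v) (p ∷ ps) = +-cong (*-congˡ p) (⟪⟫-congAll v ps)

  ⟪⟫-cong : ∀ (v : FS g) {h h'} → (∀ s → h s ≈ h' s) → ⟪ v ∣ h ⟫ ≈ ⟪ v ∣ h' ⟫
  ⟪⟫-cong v p = ⟪⟫-congAll v (All.universal (λ e → p (proj₂ e)) v)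

  ⟪⟫-++ : ∀ (v w : FS g) h → ⟪ v ++ w ∣ h ⟫ ≈ ⟪ v ∣ h ⟫ + ⟪ w ∣ h ⟫
  ⟪⟫-++ [] w h = sym (+-identityˡ _)
  ⟪⟫-++ (_ ∷ v) w h = trans (+-congˡ (⟪⟫-++ v w h)) (sym (+-assoc _ _ _))

  ⟪⟫-scale : ∀ k (v : FS g) h → ⟪ scale k v ∣ h ⟫ ≈ k * ⟪ v ∣ h ⟫
  ⟪⟫-scale k [] h = sym (zeroʳ k)
  ⟪⟫-scale k ((a , s) ∷ v) h =
    trans (+-cong (*-assoc k a (h s)) (⟪⟫-scale k v h)) (sym (distribˡ k _ _))

  ⟪⟫--FS : ∀ (v w : FS g) h → ⟪ v -FS w ∣ h ⟫ ≈ ⟪ v ∣ h ⟫ - ⟪ w ∣ h ⟫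
  ⟪⟫--FS v w h =
    trans (⟪⟫-++ v (scale (- 1#) w) h) (+-congˡ (trans (⟪⟫-scale (- 1#) w h) (-1*x≈-x _)))

  ⟪⟫-0 : ∀ (v : FS g) → ⟪ v ∣ (λ _ → 0#) ⟫ ≈ 0#
  ⟪⟫-0 [] = refl
  ⟪⟫-0 (_ ∷ v) = trans (+-cong (zeroʳ _) (⟪⟫-0 v)) (+-identityˡ _)

  ⟪⟫-+ : ∀ (v : FS g) h h' → ⟪ v ∣ (λ s → h s + h' s) ⟫ ≈ ⟪ v ∣ h ⟫ + ⟪ v ∣ h' ⟫
  ⟪⟫-+ [] h h' = sym (+-identityˡ _)
  ⟪⟫-+ (_ ∷ v) h h' = trans (+-cong (distribˡ _ _ _) (⟪⟫-+ v h h')) (+-interchange _ _ _ _)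

  ⟪⟫-* : ∀ (v : FS g) k h → ⟪ v ∣ (λ s → k * h s) ⟫ ≈ k * ⟪ v ∣ h ⟫
  ⟪⟫-* [] k h = sym (zeroʳ k)
  ⟪⟫-* ((a , s) ∷ v) k h =
    trans (+-cong (*-x∙yz≈y∙xz a k (h s)) (⟪⟫-* v k h)) (sym (distribˡ _ _ _))

  ⟪⟫-sum : ∀ (v : FS g) (h : Fin n → BT g → Carrier) →
    ⟪ v ∣ (λ s → ∑[ i < n ] (h i s)) ⟫ ≈ ∑[ i < n ] (⟪ v ∣ h i ⟫)
  ⟪⟫-sum {n = zero} v h = ⟪⟫-0 v
  ⟪⟫-sum {n = suc n} v h =
    trans (⟪⟫-+ v (h zero) (λ s → ∑[ i < n ] (h (suc i) s))) (+-congˡ (⟪⟫-sum v (λ i → h (suc i))))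

  -- Fubini for finite sums; it takes the place of rearranging the terms of multilinear expansions.
  ⟪⟫-comm : ∀ (v : FS g) (w : FS g') (h : BT g → BT g' → Carrier) →
    ⟪ v ∣ (λ s → ⟪ w ∣ h s ⟫) ⟫ ≈ ⟪ w ∣ (λ t → ⟪ v ∣ (λ s → h s t) ⟫) ⟫
  ⟪⟫-comm [] w h = sym (⟪⟫-0 w)
  ⟪⟫-comm ((a , s) ∷ v) w h = sym (begin
    ⟪ w ∣ (λ t → a * h s t + ⟪ v ∣ (λ s → h s t) ⟫) ⟫
      ≈⟨ ⟪⟫-+ w (λ t → a * h s t) (λ t → ⟪ v ∣ (λ s → h s t) ⟫) ⟩
    ⟪ w ∣ (λ t → a * h s t) ⟫ + ⟪ w ∣ (λ t → ⟪ v ∣ (λ s → h s t) ⟫) ⟫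
      ≈⟨ +-cong (⟪⟫-* w a (h s)) (sym (⟪⟫-comm v w h)) ⟩
    a * ⟪ w ∣ h s ⟫ + ⟪ v ∣ (λ s → ⟪ w ∣ h s ⟫) ⟫ ∎)

  ⟪⟫-ext : ∀ (Θ : BT g → FS g') v h → ⟪ ext Θ v ∣ h ⟫ ≈ ⟪ v ∣ (λ s → ⟪ Θ s ∣ h ⟫) ⟫
  ⟪⟫-ext Θ [] h = refl
  ⟪⟫-ext Θ ((a , s) ∷ v) h =
    trans (⟪⟫-++ (scale a (Θ s)) (ext Θ v) h) (+-cong (⟪⟫-scale a (Θ s) h) (⟪⟫-ext Θ v h))

  -- Stated for an arbitrary operation `k` on trees, so that it serves partial composition as well
  -- as the joining of two trees at a new root.
  ⟪⟫-pair : ∀ (k : BT g → BT g' → BT n) v w h →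
    ⟪ concatMap (λ e → map (λ f → proj₁ e * proj₁ f , k (proj₂ e) (proj₂ f)) w) v ∣ h ⟫
      ≈ ⟪ v ∣ (λ s → ⟪ w ∣ (λ t → h (k s t)) ⟫) ⟫
  ⟪⟫-pair k [] w h = refl
  ⟪⟫-pair {g' = g'} {n = n} k (e@(a , s) ∷ v) w h =
    trans (⟪⟫-++ (row w) _ h) (+-cong (inner w) (⟪⟫-pair k v w h))
    where
    row : FS g' → FS n
    row = map (λ f → proj₁ e * proj₁ f , k (proj₂ e) (proj₂ f))
    inner : ∀ w → ⟪ row w ∣ h ⟫ ≈ a * ⟪ w ∣ (λ t → h (k s t)) ⟫
    inner [] = sym (zeroʳ a)
    inner ((b , t) ∷ w) = trans (+-cong (*-assoc a b _) (inner w)) (sym (distribˡ a _ _))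

  ⟪⟫-composeFS : ∀ (v : FS g) i w h →
    ⟪ composeFS v i w ∣ h ⟫ ≈ ⟪ v ∣ (λ s → ⟪ w ∣ (λ t → h (graft s i t)) ⟫) ⟫
  ⟪⟫-composeFS v i w h = ⟪⟫-pair (λ s t → graft s i t) v w h

  ⟪⟫-map : ∀ (k : BT g → BT g') v h →
    ⟪ map (λ e → proj₁ e , k (proj₂ e)) v ∣ h ⟫ ≡ ⟪ v ∣ (λ s → h (k s)) ⟫
  ⟪⟫-map k [] h = ≡.refl
  ⟪⟫-map k ((a , s) ∷ v) h = ≡.cong (a * h (k s) +_) (⟪⟫-map k v h)

  ⟪⟫-allFin : ∀ (f : Fin n → FS g) h →
    ⟪ concatMap f (allFin n) ∣ h ⟫ ≈ ∑[ i < n ] (⟪ f i ∣ h ⟫)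
  ⟪⟫-allFin f h = go f (λ i → i)
    where
    -- `allFin` is a tabulation whose tail is tabulated along `suc`; the induction therefore runs
    -- over an arbitrary `σ`.
    go : ∀ {n m} (f : Fin m → FS _) (σ : Fin n → Fin m) →
      ⟪ concatMap f (tabulate σ) ∣ h ⟫ ≈ ∑[ i < n ] (⟪ f (σ i) ∣ h ⟫)
    go {zero} f σ = refl
    go {suc n} f σ =
      trans (⟪⟫-++ (f (σ zero)) _ h) (+-congˡ (go f (λ i → σ (suc i))))

  infix 4 _≋_
  -- Equivalent to `_≈FS_`, by `≋⇒≈FS` and `≈FS⇒≋`, but immediately compatible with every linear
  -- operation, since `h` may be replaced by its composite with that operation.
  record _≋_ {g} (v w : FS g) : Set (c ⊔ ℓ) where
    constructor functionals
    field at : ∀ h → ⟪ v ∣ h ⟫ ≈ ⟪ w ∣ h ⟫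
  open _≋_ public

  [_] : BT g → BT g → Carrier
  [ t ] s = ⟦ does (s ≟T t) ⟧

  coeff-⟪⟫ : ∀ (v : FS g) t → coeff v t ≈ ⟪ v ∣ [ t ] ⟫
  coeff-⟪⟫ [] t = refl
  coeff-⟪⟫ ((a , s) ∷ v) t with does (s ≟T t)
  ... | true = +-cong (sym (*-identityʳ a)) (coeff-⟪⟫ v t)
  ... | false = trans (coeff-⟪⟫ v t) (trans (sym (+-identityˡ _)) (+-congʳ (sym (zeroʳ a))))

  ≋⇒≈FS : ∀ {v w : FS g} → v ≋ w → v ≈FS w
  ≋⇒≈FS {v = v} {w} p t = trans (coeff-⟪⟫ v t) (trans (at p [ t ]) (sym (coeff-⟪⟫ w t)))

  private
    drop : BT g → FS g → FS g
    drop s [] = []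
    drop s ((a , t) ∷ v) = if does (t ≟T s) then drop s v else (a , t) ∷ drop s v

    length-drop : ∀ s (v : FS g) → length (drop s v) ≤ length v
    length-drop s [] = z≤n
    length-drop s ((a , t) ∷ v) with does (t ≟T s)
    ... | true = ℕ.m≤n⇒m≤1+n (length-drop s v)
    ... | false = s≤s (length-drop s v)

    ⟪⟫-drop : ∀ s (v : FS g) h → ⟪ v ∣ h ⟫ ≈ coeff v s * h s + ⟪ drop s v ∣ h ⟫
    ⟪⟫-drop s [] h = sym (trans (+-identityʳ _) (zeroˡ _))
    ⟪⟫-drop s ((a , t) ∷ v) h with t ≟T s
    ... | yes ≡.refl =
      trans (+-congˡ (⟪⟫-drop s v h)) (trans (sym (+-assoc _ _ _)) (+-congʳ (sym (distribʳ _ _ _))))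
    ... | no _ = begin
      a * h t + ⟪ v ∣ h ⟫                                   ≈⟨ +-congˡ (⟪⟫-drop s v h) ⟩
      a * h t + (coeff v s * h s + ⟪ drop s v ∣ h ⟫)        ≈⟨ +-assoc _ _ _ ⟨
      a * h t + coeff v s * h s + ⟪ drop s v ∣ h ⟫          ≈⟨ +-congʳ (+-comm _ _) ⟩
      coeff v s * h s + a * h t + ⟪ drop s v ∣ h ⟫          ≈⟨ +-assoc _ _ _ ⟩
      coeff v s * h s + (a * h t + ⟪ drop s v ∣ h ⟫)        ∎

    coeff-drop : ∀ s (v : FS g) t → coeff v t ≈ 0# → coeff (drop s v) t ≈ 0#
    coeff-drop s v t p with s ≟T t
    ... | yes ≡.refl = here v
      where
      here : ∀ v → coeff (drop s v) s ≈ 0#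
      here [] = refl
      here ((a , r) ∷ v) with r ≟T s in eq
      ... | yes _ = here v
      ... | no _ rewrite eq = here v
    ... | no s≢t = trans (there v) p
      where
      there : ∀ v → coeff (drop s v) t ≈ coeff v t
      there [] = refl
      there ((a , r) ∷ v) with r ≟T s
      there ((a , r) ∷ v) | yes ≡.refl with r ≟T t
      ... | yes r≡t = ⊥-elim (s≢t r≡t)
      ... | no _ = there v
      there ((a , r) ∷ v) | no _ with does (r ≟T t)
      ... | true = +-congˡ (there v)
      ... | false = there v

    -- All occurrences of the head tree are removed at once: together they contribute their total
    -- coefficient, which is zero. The remaining list is shorter but not a sublist that structural
    -- recursion accepts, hence the bound `m`.
    vanish : ∀ m (v : FS g) → length v ≤ m → (∀ t → coeff v t ≈ 0#) → ∀ h → ⟪ v ∣ h ⟫ ≈ 0#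
    vanish m [] _ p h = refl
    vanish (suc m) v@((a , s) ∷ v') (s≤s l) p h = begin
      ⟪ v ∣ h ⟫                              ≈⟨ ⟪⟫-drop s v h ⟩
      coeff v s * h s + ⟪ drop s v ∣ h ⟫     ≈⟨ +-cong (trans (*-congʳ (p s)) (zeroˡ _)) (vanish m (drop s v) short (λ t → coeff-drop s v t (p t)) h) ⟩
      0# + 0#                                ≈⟨ +-identityˡ _ ⟩
      0#                                     ∎
      where
      short : length (drop s v) ≤ m
      short with s ≟T s
      ... | yes _ = ℕ.≤-trans (length-drop s v') l
      ... | no s≢s = ⊥-elim (s≢s ≡.refl)

  x-y≈0⇒x≈y : ∀ {x y} → x - y ≈ 0# → x ≈ y
  x-y≈0⇒x≈y {x} {y} p = begin
    x              ≈⟨ +-identityʳ x ⟨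
    x + 0#         ≈⟨ +-congˡ (-‿inverseˡ y) ⟨
    x + (- y + y)  ≈⟨ +-assoc _ _ _ ⟨
    x - y + y      ≈⟨ +-congʳ p ⟩
    0# + y         ≈⟨ +-identityˡ y ⟩
    y              ∎

  x≈y⇒x-y≈0 : ∀ {x y} → x ≈ y → x - y ≈ 0#
  x≈y⇒x-y≈0 p = trans (+-congʳ p) (-‿inverseʳ _)

  ≈FS⇒≋ : ∀ (v w : FS g) → v ≈FS w → v ≋ w
  ≈FS⇒≋ v w p = functionals λ h →
    x-y≈0⇒x≈y (trans (sym (⟪⟫--FS v w h)) (vanish _ (v -FS w) ℕ.≤-refl zero-coeff h))
    where
    zero-coeff : ∀ t → coeff (v -FS w) t ≈ 0#
    zero-coeff t = begin
      coeff (v -FS w) t                  ≈⟨ coeff-⟪⟫ (v -FS w) t ⟩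
      ⟪ v -FS w ∣ [ t ] ⟫                ≈⟨ ⟪⟫--FS v w [ t ] ⟩
      ⟪ v ∣ [ t ] ⟫ - ⟪ w ∣ [ t ] ⟫      ≈⟨ x≈y⇒x-y≈0 (trans (sym (coeff-⟪⟫ v t)) (trans (p t) (coeff-⟪⟫ w t))) ⟩
      0#                                 ∎

-- Grafting of binary trees: arities and the axioms of partial composition.

data Position (m : ℕ) : ℕ → Set where
  left  : ∀ {i} → i < m → Position m i
  right : ∀ i → Position m (m ℕ.+ i)

-- Matching on the result puts an index of the right subtree into the form `m + i`, so that no
-- truncated subtraction is left to reason about.
position : ∀ m i → Position m i
position m i with i ℕ.<? m
... | yes i<m = left i<m
... | no i≮m = ≡.subst (Position m) (ℕ.m+[n∸m]≡n (ℕ.≮⇒≥ i≮m)) (right (i ℕ.∸ m))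

module _ {g : ℕ} where
  arity>0 : ∀ (t : BT g) → 0 < arity t
  arity>0 leaf = s≤s z≤n
  arity>0 (node x l r) = ℕ.≤-trans (arity>0 l) (ℕ.m≤m+n _ _)

  graft-left : ∀ {x} (l : BT g) {r i} t → i < arity l → graft (node x l r) i t ≡ node x (graft l i t) r
  graft-left l {i = i} t i<l with i ℕ.<? arity l
  ... | yes _ = ≡.refl
  ... | no i≮l = ⊥-elim (i≮l i<l)

  graft-right : ∀ {x} (l : BT g) {r} i t → graft (node x l r) (arity l ℕ.+ i) t ≡ node x l (graft r i t)
  graft-right l i t with arity l ℕ.+ i ℕ.<? arity l
  ... | yes p = ⊥-elim (ℕ.<⇒≱ p (ℕ.m≤m+n _ i))
  ... | no _ rewrite ℕ.m+n∸m≡n (arity l) i = ≡.refl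

  -- Grafting uses up one leaf of `s`; the successor on the left accounts for it without a
  -- subtraction.
  arity-graft : ∀ (s : BT g) i t → i < arity s → suc (arity (graft s i t)) ≡ arity s ℕ.+ arity t
  arity-graft leaf zero t _ = ≡.refl
  arity-graft leaf (suc i) t (s≤s ())
  arity-graft (node x l r) i t p with position (arity l) i
  ... | left q rewrite graft-left {x} l {r} t q = begin
    suc (arity (graft l i t)) ℕ.+ arity r    ≡⟨ ≡.cong (ℕ._+ arity r) (arity-graft l i t q) ⟩
    arity l ℕ.+ arity t ℕ.+ arity r          ≡⟨ ℕ.+-assoc (arity l) _ _ ⟩
    arity l ℕ.+ (arity t ℕ.+ arity r)        ≡⟨ ≡.cong (arity l ℕ.+_) (ℕ.+-comm (arity t) _) ⟩
    arity l ℕ.+ (arity r ℕ.+ arity t)        ≡⟨ ℕ.+-assoc (arity l) _ _ ⟨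
    arity l ℕ.+ arity r ℕ.+ arity t          ∎
    where open ≡.≡-Reasoning
  ... | right j rewrite graft-right {x} l {r} j t = begin
    suc (arity l ℕ.+ arity (graft r j t))    ≡⟨ ℕ.+-suc (arity l) _ ⟨
    arity l ℕ.+ suc (arity (graft r j t))    ≡⟨ ≡.cong (arity l ℕ.+_) (arity-graft r j t (ℕ.+-cancelˡ-< (arity l) _ _ p)) ⟩
    arity l ℕ.+ (arity r ℕ.+ arity t)        ≡⟨ ℕ.+-assoc (arity l) _ _ ⟨
    arity l ℕ.+ arity r ℕ.+ arity t          ∎
    where open ≡.≡-Reasoning

  pos<arity-graft : ∀ (s : BT g) i t j → i < arity s → suc j < arity s ℕ.+ arity t → j < arity (graft s i t)
  pos<arity-graft s i t j p q = ℕ.≤-pred (≡.subst (suc j <_) (≡.sym (arity-graft s i t p)) q)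

  -- The sequential axiom of partial composition.
  graft-assoc : ∀ (s : BT g) i t j u → i < arity s → j < arity t →
    graft s i (graft t j u) ≡ graft (graft s i t) (i ℕ.+ j) u
  graft-assoc leaf zero t j u _ _ = ≡.refl
  graft-assoc leaf (suc i) t j u (s≤s ()) _
  graft-assoc (node x l r) i t j u p q with position (arity l) i
  ... | left i<l = begin
    graft (node x l r) i (graft t j u)             ≡⟨ graft-left l _ i<l ⟩
    node x (graft l i (graft t j u)) r             ≡⟨ ≡.cong (λ z → node x z r) (graft-assoc l i t j u i<l q) ⟩
    node x (graft (graft l i t) (i ℕ.+ j) u) r     ≡⟨ graft-left (graft l i t) u (pos<arity-graft l i t _ i<l bound) ⟨
    graft (node x (graft l i t) r) (i ℕ.+ j) u     ≡⟨ ≡.cong (λ z → graft z (i ℕ.+ j) u) (graft-left l t i<l) ⟨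
    graft (graft (node x l r) i t) (i ℕ.+ j) u     ∎
    where
    open ≡.≡-Reasoning
    bound : suc (i ℕ.+ j) < arity l ℕ.+ arity t
    bound = ℕ.+-mono-≤-< i<l q
  ... | right k = begin
    graft (node x l r) (arity l ℕ.+ k) (graft t j u)          ≡⟨ graft-right l k _ ⟩
    node x l (graft r k (graft t j u))                        ≡⟨ ≡.cong (node x l) (graft-assoc r k t j u (ℕ.+-cancelˡ-< (arity l) _ _ p) q) ⟩
    node x l (graft (graft r k t) (k ℕ.+ j) u)                ≡⟨ graft-right l (k ℕ.+ j) u ⟨
    graft (node x l (graft r k t)) (arity l ℕ.+ (k ℕ.+ j)) u  ≡⟨ ≡.cong₂ (λ z m → graft z m u) (≡.sym (graft-right l k t)) (≡.sym (ℕ.+-assoc (arity l) k j)) ⟩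
    graft (graft (node x l r) (arity l ℕ.+ k) t) (arity l ℕ.+ k ℕ.+ j) u ∎
    where open ≡.≡-Reasoning

  -- The parallel axiom when one of the two leaves is the first. Replacing leaf 0 by `t` moves leaf
  -- `suc j` to position `arity t + j`.
  graft-parallel₀ : ∀ (s : BT g) j u t → suc j < arity s →
    graft (graft s (suc j) u) 0 t ≡ graft (graft s 0 t) (arity t ℕ.+ j) u
  graft-parallel₀ leaf j u t (s≤s ())
  -- `suc j` is abstracted because it does not unify with the index `arity l + k` of `right`; `eq`
  -- keeps the connection.
  graft-parallel₀ (node x l r) j u t p with suc j in eq | position (arity l) (suc j)
  ... | _ | left q rewrite ≡.sym eq = begin
    graft (graft (node x l r) (suc j) u) 0 t              ≡⟨ ≡.cong (λ z → graft z 0 t) (graft-left l u q) ⟩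
    graft (node x (graft l (suc j) u) r) 0 t              ≡⟨ graft-left (graft l (suc j) u) t (arity>0 (graft l (suc j) u)) ⟩
    node x (graft (graft l (suc j) u) 0 t) r              ≡⟨ ≡.cong (λ z → node x z r) (graft-parallel₀ l j u t q) ⟩
    node x (graft (graft l 0 t) (arity t ℕ.+ j) u) r      ≡⟨ graft-left (graft l 0 t) u (pos<arity-graft l 0 t _ (arity>0 l) bound) ⟨
    graft (node x (graft l 0 t) r) (arity t ℕ.+ j) u      ≡⟨ ≡.cong (λ z → graft z (arity t ℕ.+ j) u) (graft-left l t (arity>0 l)) ⟨
    graft (graft (node x l r) 0 t) (arity t ℕ.+ j) u      ∎
    where
    open ≡.≡-Reasoning
    bound : suc (arity t ℕ.+ j) < arity l ℕ.+ arity t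
    bound = ≡.subst₂ _<_ (ℕ.+-suc (arity t) j) (ℕ.+-comm (arity t) (arity l)) (ℕ.+-monoʳ-< (arity t) q)
  ... | _ | right k = begin
    graft (graft (node x l r) (arity l ℕ.+ k) u) 0 t              ≡⟨ ≡.cong (λ z → graft z 0 t) (graft-right l k u) ⟩
    graft (node x l (graft r k u)) 0 t                            ≡⟨ graft-left l t (arity>0 l) ⟩
    node x (graft l 0 t) (graft r k u)                            ≡⟨ graft-right (graft l 0 t) k u ⟨
    graft (node x (graft l 0 t) r) (arity (graft l 0 t) ℕ.+ k) u  ≡⟨ ≡.cong₂ (λ z m → graft z m u) (≡.sym (graft-left l t (arity>0 l))) index ⟩
    graft (graft (node x l r) 0 t) (arity t ℕ.+ j) u              ∎
    where
    open ≡.≡-Reasoning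
    index : arity (graft l 0 t) ℕ.+ k ≡ arity t ℕ.+ j
    index = ℕ.suc-injective (begin
      suc (arity (graft l 0 t)) ℕ.+ k     ≡⟨ ≡.cong (ℕ._+ k) (arity-graft l 0 t (arity>0 l)) ⟩
      arity l ℕ.+ arity t ℕ.+ k           ≡⟨ ≡.cong (ℕ._+ k) (ℕ.+-comm (arity l) _) ⟩
      arity t ℕ.+ arity l ℕ.+ k           ≡⟨ ℕ.+-assoc (arity t) _ _ ⟩
      arity t ℕ.+ (arity l ℕ.+ k)         ≡⟨ ≡.cong (arity t ℕ.+_) eq ⟨
      arity t ℕ.+ suc j                   ≡⟨ ℕ.+-suc (arity t) j ⟩
      suc (arity t ℕ.+ j)                 ∎)

-- Ideals of relations and congruence modulo an ideal.

module Ideals {c ℓ} (K : CharZeroField c ℓ) where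
  open WithField K
  open CommutativeRing (CharZeroField.cring K) hiding (zero)
  open Matrices (CharZeroField.cring K)
  open Integration K
  open import Relation.Binary.Reasoning.Setoid setoid

  private variable
    g g' : ℕ

  infix 4 _∈⟨_⟩ _≃_[mod_]

  record _∈⟨_⟩ {g} (v : FS g) (R : Relations g) : Set (c ⊔ ℓ) where
    constructor ideal
    field
      terms     : List (IdealTerm R)
      expansion : v ≋ concatMap evalTerm terms

  ∈⇒InIdeal : ∀ {v : FS g} {R} → v ∈⟨ R ⟩ → InIdeal R v
  ∈⇒InIdeal (ideal τs p) = τs , ≋⇒≈FS p

  InIdeal⇒∈ : ∀ {v : FS g} {R} → InIdeal R v → v ∈⟨ R ⟩
  InIdeal⇒∈ {v = v} (τs , p) = ideal τs (≈FS⇒≋ v _ p)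

  record _≃_[mod_] {g} (v w : FS g) (R : Relations g) : Set (c ⊔ ℓ) where
    constructor modulo
    field difference : v -FS w ∈⟨ R ⟩
  open _≃_[mod_] public

  module _ {R : Relations g} where
    ∈-resp-≋ : ∀ {v w} → v ≋ w → w ∈⟨ R ⟩ → v ∈⟨ R ⟩
    ∈-resp-≋ p (ideal τs q) = ideal τs (functionals λ h → trans (at p h) (at q h))

    []∈ : [] ∈⟨ R ⟩
    []∈ = ideal [] (functionals λ h → refl)

    ++-∈ : ∀ {v w} → v ∈⟨ R ⟩ → w ∈⟨ R ⟩ → v ++ w ∈⟨ R ⟩
    ++-∈ {v} {w} (ideal τs p) (ideal σs q) = ideal (τs ++ σs) (functionals λ h → begin
      ⟪ v ++ w ∣ h ⟫                                                  ≈⟨ ⟪⟫-++ v w h ⟩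
      ⟪ v ∣ h ⟫ + ⟪ w ∣ h ⟫                                           ≈⟨ +-cong (at p h) (at q h) ⟩
      ⟪ concatMap evalTerm τs ∣ h ⟫ + ⟪ concatMap evalTerm σs ∣ h ⟫   ≈⟨ ⟪⟫-++ (concatMap evalTerm τs) _ h ⟨
      ⟪ concatMap evalTerm τs ++ concatMap evalTerm σs ∣ h ⟫          ≡⟨ ≡.cong ⟪_∣ h ⟫ (concatMap-++ evalTerm τs σs) ⟨
      ⟪ concatMap evalTerm (τs ++ σs) ∣ h ⟫                           ∎)

    scale-∈ : ∀ k {v} → v ∈⟨ R ⟩ → scale k v ∈⟨ R ⟩
    scale-∈ k {v} (ideal τs p) = ideal (map k·_ τs) (functionals λ h → begin
      ⟪ scale k v ∣ h ⟫                       ≈⟨ ⟪⟫-scale k v h ⟩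
      k * ⟪ v ∣ h ⟫                           ≈⟨ *-congˡ (at p h) ⟩
      k * ⟪ concatMap evalTerm τs ∣ h ⟫       ≈⟨ eval-k· h τs ⟨
      ⟪ concatMap evalTerm (map k·_ τs) ∣ h ⟫ ∎)
      where
      k·_ : IdealTerm R → IdealTerm R
      k· τ = record { IdealTerm τ ; coef = k * IdealTerm.coef τ }
      eval-k· : ∀ h τs → ⟪ concatMap evalTerm (map k·_ τs) ∣ h ⟫ ≈ k * ⟪ concatMap evalTerm τs ∣ h ⟫
      eval-k· h [] = sym (zeroʳ k)
      eval-k· h (τ ∷ τs) = begin
        ⟪ evalTerm (k· τ) ++ _ ∣ h ⟫                                 ≈⟨ ⟪⟫-++ (evalTerm (k· τ)) _ h ⟩
        ⟪ evalTerm (k· τ) ∣ h ⟫ + _                                  ≈⟨ +-cong (⟪⟫-scale (k * coef) F h) (eval-k· h τs) ⟩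
        k * coef * ⟪ F ∣ h ⟫ + k * ⟪ concatMap evalTerm τs ∣ h ⟫     ≈⟨ +-congʳ (trans (*-assoc _ _ _) (*-congˡ (sym (⟪⟫-scale coef F h)))) ⟩
        k * ⟪ evalTerm τ ∣ h ⟫ + k * ⟪ concatMap evalTerm τs ∣ h ⟫   ≈⟨ distribˡ k _ _ ⟨
        k * (⟪ evalTerm τ ∣ h ⟫ + ⟪ concatMap evalTerm τs ∣ h ⟫)     ≈⟨ *-congˡ (⟪⟫-++ (evalTerm τ) _ h) ⟨
        k * ⟪ concatMap evalTerm (τ ∷ τs) ∣ h ⟫                      ∎
        where
        open IdealTerm τ
        F = fill ctx pos rel u₀ u₁ u₂

    ext-∈ : ∀ (Θ : BT g' → FS g) v → All (λ e → Θ (proj₂ e) ∈⟨ R ⟩) v → ext Θ v ∈⟨ R ⟩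
    ext-∈ Θ [] [] = []∈
    ext-∈ Θ ((a , s) ∷ v) (p ∷ ps) = ++-∈ (scale-∈ a p) (ext-∈ Θ v ps)

    fill-∈ : ∀ {r} T pos u₀ u₁ u₂ → R r → pos < arity T → fill T pos r u₀ u₁ u₂ ∈⟨ R ⟩
    fill-∈ {r} T i u₀ u₁ u₂ Rr i< = ideal (τ ∷ []) (functionals λ h → begin
      ⟪ F ∣ h ⟫                    ≈⟨ *-identityˡ _ ⟨
      1# * ⟪ F ∣ h ⟫               ≈⟨ ⟪⟫-scale 1# F h ⟨
      ⟪ scale 1# F ∣ h ⟫           ≈⟨ +-identityʳ _ ⟨
      ⟪ scale 1# F ∣ h ⟫ + 0#      ≈⟨ ⟪⟫-++ (scale 1# F) [] h ⟨
      ⟪ scale 1# F ++ [] ∣ h ⟫     ∎)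
      where
      F = fill T i r u₀ u₁ u₂
      τ : IdealTerm R
      τ = record { coef = 1# ; ctx = T ; pos = i ; pos< = i< ; rel = r ; relR = Rr ; u₀ = u₀ ; u₁ = u₁ ; u₂ = u₂ }

    ≋⇒≃ : ∀ {v w} → v ≋ w → v ≃ w [mod R ]
    ≋⇒≃ {v} {w} p = modulo (∈-resp-≋ (functionals λ h → trans (⟪⟫--FS v w h) (x≈y⇒x-y≈0 (at p h))) []∈)

    ≃-trans : ∀ {v w u} → v ≃ w [mod R ] → w ≃ u [mod R ] → v ≃ u [mod R ]
    ≃-trans {v} {w} {u} (modulo p) (modulo q) = modulo (∈-resp-≋ (functionals split) (++-∈ p q))
      where
      split : ∀ h → ⟪ v -FS u ∣ h ⟫ ≈ ⟪ (v -FS w) ++ (w -FS u) ∣ h ⟫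
      split h = begin
        ⟪ v -FS u ∣ h ⟫                                     ≈⟨ ⟪⟫--FS v u h ⟩
        ⟪ v ∣ h ⟫ - ⟪ u ∣ h ⟫                               ≈⟨ +-congˡ (+-identityˡ _) ⟨
        ⟪ v ∣ h ⟫ + (0# - ⟪ u ∣ h ⟫)                        ≈⟨ +-congˡ (+-congʳ (-‿inverseˡ _)) ⟨
        ⟪ v ∣ h ⟫ + (- ⟪ w ∣ h ⟫ + ⟪ w ∣ h ⟫ - ⟪ u ∣ h ⟫)   ≈⟨ +-congˡ (+-assoc _ _ _) ⟩
        ⟪ v ∣ h ⟫ + (- ⟪ w ∣ h ⟫ + (⟪ w ∣ h ⟫ - ⟪ u ∣ h ⟫)) ≈⟨ +-assoc _ _ _ ⟨
        (⟪ v ∣ h ⟫ - ⟪ w ∣ h ⟫) + (⟪ w ∣ h ⟫ - ⟪ u ∣ h ⟫)   ≈⟨ +-cong (⟪⟫--FS v w h) (⟪⟫--FS w u h) ⟨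
        ⟪ v -FS w ∣ h ⟫ + ⟪ w -FS u ∣ h ⟫                   ≈⟨ ⟪⟫-++ (v -FS w) (w -FS u) h ⟨
        ⟪ (v -FS w) ++ (w -FS u) ∣ h ⟫                      ∎

    ≃-sym : ∀ {v w} → v ≃ w [mod R ] → w ≃ v [mod R ]
    ≃-sym {v} {w} (modulo p) = modulo (∈-resp-≋ (functionals flip) (scale-∈ (- 1#) p))
      where
      flip : ∀ h → ⟪ w -FS v ∣ h ⟫ ≈ ⟪ scale (- 1#) (v -FS w) ∣ h ⟫
      flip h = begin
        ⟪ w -FS v ∣ h ⟫                          ≈⟨ ⟪⟫--FS w v h ⟩
        ⟪ w ∣ h ⟫ - ⟪ v ∣ h ⟫                    ≈⟨ +-comm _ _ ⟩
        - ⟪ v ∣ h ⟫ + ⟪ w ∣ h ⟫                  ≈⟨ +-congˡ (-‿involutive _) ⟨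
        - ⟪ v ∣ h ⟫ - (- ⟪ w ∣ h ⟫)              ≈⟨ -‿+-comm _ _ ⟩
        - (⟪ v ∣ h ⟫ - ⟪ w ∣ h ⟫)                ≈⟨ -‿cong (⟪⟫--FS v w h) ⟨
        - ⟪ v -FS w ∣ h ⟫                        ≈⟨ -1*x≈-x _ ⟨
        - 1# * ⟪ v -FS w ∣ h ⟫                   ≈⟨ ⟪⟫-scale (- 1#) (v -FS w) h ⟨
        ⟪ scale (- 1#) (v -FS w) ∣ h ⟫           ∎

  -- By linearity the scalars `coef` split off, and only the filled relations themselves have to be
  -- mapped into the target ideal.
  lift-∈ : ∀ {R : Relations g} {R' : Relations g'} (Θ : BT g → FS g') →
    (∀ (τ : IdealTerm R) → let open IdealTerm τ in ext Θ (fill ctx pos rel u₀ u₁ u₂) ∈⟨ R' ⟩) →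
    ∀ {v} → v ∈⟨ R ⟩ → ext Θ v ∈⟨ R' ⟩
  lift-∈ {R = R} {R'} Θ onTerm {v} (ideal τs p) = ∈-resp-≋ (functionals ext-cong) (onTerms τs)
    where
    ext-cong : ∀ h → ⟪ ext Θ v ∣ h ⟫ ≈ ⟪ ext Θ (concatMap evalTerm τs) ∣ h ⟫
    ext-cong h = begin
      ⟪ ext Θ v ∣ h ⟫                                   ≈⟨ ⟪⟫-ext Θ v h ⟩
      ⟪ v ∣ (λ s → ⟪ Θ s ∣ h ⟫) ⟫                       ≈⟨ at p _ ⟩
      ⟪ concatMap evalTerm τs ∣ (λ s → ⟪ Θ s ∣ h ⟫) ⟫   ≈⟨ ⟪⟫-ext Θ (concatMap evalTerm τs) h ⟨
      ⟪ ext Θ (concatMap evalTerm τs) ∣ h ⟫             ∎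
    onTerms : ∀ τs → ext Θ (concatMap evalTerm τs) ∈⟨ R' ⟩
    onTerms [] = []∈
    onTerms (τ ∷ τs) = ∈-resp-≋ (functionals split) (++-∈ (scale-∈ coef (onTerm τ)) (onTerms τs))
      where
      open IdealTerm τ
      F = fill ctx pos rel u₀ u₁ u₂
      rest = concatMap evalTerm τs
      split : ∀ h → ⟪ ext Θ (evalTerm τ ++ rest) ∣ h ⟫ ≈ ⟪ scale coef (ext Θ F) ++ ext Θ rest ∣ h ⟫
      split h = begin
        ⟪ ext Θ (evalTerm τ ++ rest) ∣ h ⟫             ≈⟨ ⟪⟫-ext Θ (evalTerm τ ++ rest) h ⟩
        ⟪ evalTerm τ ++ rest ∣ h' ⟫                    ≈⟨ ⟪⟫-++ (evalTerm τ) rest h' ⟩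
        ⟪ evalTerm τ ∣ h' ⟫ + ⟪ rest ∣ h' ⟫            ≈⟨ +-cong (⟪⟫-scale coef F h') (sym (⟪⟫-ext Θ rest h)) ⟩
        coef * ⟪ F ∣ h' ⟫ + ⟪ ext Θ rest ∣ h ⟫         ≈⟨ +-congʳ (*-congˡ (⟪⟫-ext Θ F h)) ⟨
        coef * ⟪ ext Θ F ∣ h ⟫ + ⟪ ext Θ rest ∣ h ⟫    ≈⟨ +-congʳ (⟪⟫-scale coef (ext Θ F) h) ⟨
        ⟪ scale coef (ext Θ F) ∣ h ⟫ + ⟪ ext Θ rest ∣ h ⟫ ≈⟨ ⟪⟫-++ (scale coef (ext Θ F)) (ext Θ rest) h ⟨
        ⟪ scale coef (ext Θ F) ++ ext Θ rest ∣ h ⟫     ∎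
        where h' = λ s → ⟪ Θ s ∣ h ⟫

-- The map of free operads induced by a linear change of generators.

module Substitution {c ℓ} (K : CharZeroField c ℓ) where
  open WithField K
  open CommutativeRing (CharZeroField.cring K) hiding (zero)
  open Matrices (CharZeroField.cring K)
  open Integration K
  open Ideals K
  open import Relation.Binary.Reasoning.Setoid setoid

  private variable
    g g' : ℕ

  -- The action of `fill` on one monomial. Filling leaves 2, 1, 0 in this order leaves the indices
  -- still to be used unchanged.
  plug : BT g → ℕ → BT g → BT g → BT g → BT g → BT g
  plug T i u₀ u₁ u₂ e = graft T i (graft (graft (graft e 2 u₂) 1 u₁) 0 u₀)

  ⟪⟫-fill : ∀ (T : BT g) i r u₀ u₁ u₂ h →
    ⟪ fill T i r u₀ u₁ u₂ ∣ h ⟫ ≈ ⟪ r ∣ (λ e → h (plug T i u₀ u₁ u₂ e)) ⟫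
  ⟪⟫-fill T i r u₀ u₁ u₂ h = reflexive (⟪⟫-map (plug T i u₀ u₁ u₂) r h)

  -- A presentation may list only spanning relations, so the image of a relation is asked to lie in
  -- the linear span; `fill-Span-∈` shows that this generates no larger ideal.
  data Span {g} (R : Relations g) : FS g → Set (c ⊔ ℓ) where
    generator : ∀ {r} → R r → Span R r
    []        : Span R []
    _++ˢ_     : ∀ {v w} → Span R v → Span R w → Span R (v ++ w)
    scaleˢ    : ∀ k {v} → Span R v → Span R (scale k v)
    respˢ     : ∀ {v w} → v ≋ w → Span R w → Span R v

  concatMapˢ : ∀ {R : Relations g} {A : Set} (f : A → FS g) → (∀ a → Span R (f a)) → ∀ as → Span R (concatMap f as)
  concatMapˢ f p [] = []
  concatMapˢ f p (a ∷ as) = p a ++ˢ concatMapˢ f p as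

  fill-Span-∈ : ∀ {R : Relations g} {r} T i u₀ u₁ u₂ → Span R r → i < arity T →
    fill T i r u₀ u₁ u₂ ∈⟨ R ⟩
  fill-Span-∈ T i u₀ u₁ u₂ (generator Rr) i< = fill-∈ T i u₀ u₁ u₂ Rr i<
  fill-Span-∈ T i u₀ u₁ u₂ [] i< = []∈
  fill-Span-∈ T i u₀ u₁ u₂ (_++ˢ_ {v} {w} p q) i< =
    ∈-resp-≋ (functionals λ h → trans (⟪⟫-fill T i (v ++ w) u₀ u₁ u₂ h) (trans (⟪⟫-++ v w _)
        (sym (trans (⟪⟫-++ (fill T i v u₀ u₁ u₂) _ h)
          (+-cong (⟪⟫-fill T i v u₀ u₁ u₂ h) (⟪⟫-fill T i w u₀ u₁ u₂ h))))))
      (++-∈ (fill-Span-∈ T i u₀ u₁ u₂ p i<) (fill-Span-∈ T i u₀ u₁ u₂ q i<))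
  fill-Span-∈ T i u₀ u₁ u₂ (scaleˢ k {v} p) i< =
    ∈-resp-≋ (functionals λ h → trans (⟪⟫-fill T i (scale k v) u₀ u₁ u₂ h) (trans (⟪⟫-scale k v _)
        (sym (trans (⟪⟫-scale k (fill T i v u₀ u₁ u₂) h) (*-congˡ (⟪⟫-fill T i v u₀ u₁ u₂ h))))))
      (scale-∈ k (fill-Span-∈ T i u₀ u₁ u₂ p i<))
  fill-Span-∈ T i u₀ u₁ u₂ (respˢ {v} {w} e p) i< =
    ∈-resp-≋ (functionals λ h → trans (⟪⟫-fill T i v u₀ u₁ u₂ h) (trans (at e _)
        (sym (⟪⟫-fill T i w u₀ u₁ u₂ h))))
      (fill-Span-∈ T i u₀ u₁ u₂ p i<)

  nodes : Fin g → FS g → FS g → FS g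
  nodes y v w = concatMap (λ e → map (λ f → proj₁ e * proj₁ f , node y (proj₂ e) (proj₂ f)) w) v

  GenMap : ℕ → ℕ → Set c
  GenMap g g' = Fin g → Fin g' → Carrier

  -- Row `x` of `M` holds the coefficients of the image of generator `x`. With this convention
  -- `sub M` followed by `sub N` belongs to the product `M ⊗ N`.
  sub : GenMap g g' → BT g → FS g'
  sub M leaf = (1# , leaf) ∷ []
  sub M (node x l r) = concatMap (λ y → scale (M x y) (nodes y (sub M l) (sub M r))) (allFin _)

  ⟪⟫-sub-leaf : ∀ (M : GenMap g g') h → ⟪ sub M leaf ∣ h ⟫ ≈ h leaf
  ⟪⟫-sub-leaf M h = trans (+-identityʳ _) (*-identityˡ _)

  ⟪⟫-sub-node : ∀ (M : GenMap g g') x l r h →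
    ⟪ sub M (node x l r) ∣ h ⟫
      ≈ ∑[ y < g' ] (M x y * ⟪ sub M l ∣ (λ l' → ⟪ sub M r ∣ (λ r' → h (node y l' r')) ⟫) ⟫)
  ⟪⟫-sub-node M x l r h =
    trans (⟪⟫-allFin (λ y → scale (M x y) (nodes y (sub M l) (sub M r))) h)
      (∑-cong λ y → trans (⟪⟫-scale (M x y) (nodes y (sub M l) (sub M r)) h)
        (*-congˡ (⟪⟫-pair (node y) (sub M l) (sub M r) h)))

  Homogeneous : ℕ → FS g → Set c
  Homogeneous m = All (λ e → arity (proj₂ e) ≡ m)

  scale-homogeneous : ∀ k {m} {v : FS g} → Homogeneous m v → Homogeneous m (scale k v)
  scale-homogeneous k p = All.map⁺ p

  sub-homogeneous : ∀ (M : GenMap g g') t → Homogeneous (arity t) (sub M t)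
  sub-homogeneous M leaf = ≡.refl ∷ []
  sub-homogeneous M (node x l r) =
    All.concat⁺ (All.map⁺ (All.universal (λ y → scale-homogeneous (M x y)
      (All.concat⁺ (All.map⁺ (All.map (λ p → All.map⁺ (All.map (λ q → ≡.cong₂ ℕ._+_ p q)
        (sub-homogeneous M r))) (sub-homogeneous M l))))) (allFin _)))

  -- Compatibility with composition holds in the free operad, before any quotient. Every tree in
  -- `sub M l` has the arity of `l`, so leaf `i` falls into the same subtree before and after
  -- substitution.
  sub-graft : ∀ (M : GenMap g g') s i t h → i < arity s →
    ⟪ sub M (graft s i t) ∣ h ⟫ ≈ ⟪ sub M s ∣ (λ s' → ⟪ sub M t ∣ (λ t' → h (graft s' i t')) ⟫) ⟫
  sub-graft M leaf zero t h _ = sym (⟪⟫-sub-leaf M (λ s' → ⟪ sub M t ∣ (λ t' → h (graft s' 0 t')) ⟫))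
  sub-graft M leaf (suc i) t h (s≤s ())
  sub-graft {g' = g'} M (node x l r) i t h p with position (arity l) i
  ... | left i<l = begin
    ⟪ sub M (graft (node x l r) i t) ∣ h ⟫
      ≡⟨ ≡.cong (λ z → ⟪ sub M z ∣ h ⟫) (graft-left l t i<l) ⟩
    ⟪ sub M (node x (graft l i t) r) ∣ h ⟫
      ≈⟨ ⟪⟫-sub-node M x (graft l i t) r h ⟩
    sum (λ y → M x y * ⟪ sub M (graft l i t) ∣ (λ l' → ⟪ sub M r ∣ (λ r' → h (node y l' r')) ⟫) ⟫)
      ≈⟨ ∑-cong (λ y → *-congˡ (trans (sub-graft M l i t _ i<l) (⟪⟫-congAll (sub M l) (All.map (λ {e} → inner y {e}) (sub-homogeneous M l))))) ⟩
    sum (λ y → M x y * ⟪ sub M l ∣ (λ l' → ⟪ sub M r ∣ (λ r' → H (node y l' r')) ⟫) ⟫)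
      ≈⟨ ⟪⟫-sub-node M x l r H ⟨
    ⟪ sub M (node x l r) ∣ H ⟫ ∎
    where
    H : BT g' → Carrier
    H s' = ⟪ sub M t ∣ (λ t' → h (graft s' i t')) ⟫
    inner : ∀ y {e : Carrier × BT g'} → arity (proj₂ e) ≡ arity l →
      ⟪ sub M t ∣ (λ t' → ⟪ sub M r ∣ (λ r' → h (node y (graft (proj₂ e) i t') r')) ⟫) ⟫
        ≈ ⟪ sub M r ∣ (λ r' → H (node y (proj₂ e) r')) ⟫
    inner y {_ , l'} q = trans (⟪⟫-comm (sub M t) (sub M r) _)
      (⟪⟫-cong (sub M r) λ r' → ⟪⟫-cong (sub M t) λ t' →
        reflexive (≡.cong h (≡.sym (graft-left l' t' (≡.subst (i <_) (≡.sym q) i<l)))))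
  ... | right j = begin
    ⟪ sub M (graft (node x l r) (arity l ℕ.+ j) t) ∣ h ⟫
      ≡⟨ ≡.cong (λ z → ⟪ sub M z ∣ h ⟫) (graft-right l j t) ⟩
    ⟪ sub M (node x l (graft r j t)) ∣ h ⟫
      ≈⟨ ⟪⟫-sub-node M x l (graft r j t) h ⟩
    sum (λ y → M x y * ⟪ sub M l ∣ (λ l' → ⟪ sub M (graft r j t) ∣ (λ r' → h (node y l' r')) ⟫) ⟫)
      ≈⟨ ∑-cong (λ y → *-congˡ (⟪⟫-congAll (sub M l) (All.map (λ {e} → inner y {e}) (sub-homogeneous M l)))) ⟩
    sum (λ y → M x y * ⟪ sub M l ∣ (λ l' → ⟪ sub M r ∣ (λ r' → H (node y l' r')) ⟫) ⟫)
      ≈⟨ ⟪⟫-sub-node M x l r H ⟨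
    ⟪ sub M (node x l r) ∣ H ⟫ ∎
    where
    H : BT g' → Carrier
    H s' = ⟪ sub M t ∣ (λ t' → h (graft s' (arity l ℕ.+ j) t')) ⟫
    inner : ∀ y {e : Carrier × BT g'} → arity (proj₂ e) ≡ arity l →
      ⟪ sub M (graft r j t) ∣ (λ r' → h (node y (proj₂ e) r')) ⟫
        ≈ ⟪ sub M r ∣ (λ r' → H (node y (proj₂ e) r')) ⟫
    inner y {_ , l'} q = trans (sub-graft M r j t _ (ℕ.+-cancelˡ-< (arity l) _ _ p))
      (⟪⟫-cong (sub M r) λ r' → ⟪⟫-cong (sub M t) λ t' → reflexive (≡.cong h (≡.sym
        (≡.trans (≡.cong (λ m → graft (node y l' r') (m ℕ.+ j) t') (≡.sym q)) (graft-right l' j t')))))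

  ⟪⟫-reverse₃ : ∀ (v w x : FS g) (h : BT g → BT g → BT g → Carrier) →
    ⟪ v ∣ (λ a → ⟪ w ∣ (λ b → ⟪ x ∣ (λ c → h a b c) ⟫) ⟫) ⟫
      ≈ ⟪ x ∣ (λ c → ⟪ w ∣ (λ b → ⟪ v ∣ (λ a → h a b c) ⟫) ⟫) ⟫
  ⟪⟫-reverse₃ v w x h =
    trans (⟪⟫-cong v λ a → ⟪⟫-comm w x (h a))
      (trans (⟪⟫-comm v x _) (⟪⟫-cong x λ c → ⟪⟫-comm v w (λ a b → h a b c)))

  ⟪⟫-reverse₄ : ∀ (v w x y : FS g) (h : BT g → BT g → BT g → BT g → Carrier) →
    ⟪ v ∣ (λ a → ⟪ w ∣ (λ b → ⟪ x ∣ (λ c → ⟪ y ∣ (λ d → h a b c d) ⟫) ⟫) ⟫) ⟫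
      ≈ ⟪ y ∣ (λ d → ⟪ x ∣ (λ c → ⟪ w ∣ (λ b → ⟪ v ∣ (λ a → h a b c d) ⟫) ⟫) ⟫) ⟫
  ⟪⟫-reverse₄ v w x y h =
    trans (⟪⟫-cong v λ a → ⟪⟫-reverse₃ w x y (h a))
      (trans (⟪⟫-comm v y _)
        (⟪⟫-cong y λ d → trans (⟪⟫-comm v x _) (⟪⟫-cong x λ c → ⟪⟫-comm v w (λ a b → h a b c d))))

  -- Multilinear expansion: the image of a filled relation is a combination, over the trees in the
  -- images of the context and of the three fillings, of fillings of the single element
  -- `ext (sub M) rel`. That element lies in the span of `R'`, so each summand lies in the ideal.
  sub-∈ : ∀ {R : Relations g} {R' : Relations g'} (M : GenMap g g') →
    (∀ {r} → R r → Homogeneous 3 r) → (∀ {r} → R r → Span R' (ext (sub M) r)) →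
    ∀ {v} → v ∈⟨ R ⟩ → ext (sub M) v ∈⟨ R' ⟩
  sub-∈ {g} {g'} {R} {R'} M R-arity image = lift-∈ (sub M) onTerm
    where
    onTerm : (τ : IdealTerm R) → let open IdealTerm τ in ext (sub M) (fill ctx pos rel u₀ u₁ u₂) ∈⟨ R' ⟩
    onTerm τ = ∈-resp-≋ (functionals expand) (ext-∈ A (sub M ctx) (All.map
      (λ {e} q → ext-∈ _ (sub M u₀) (All.universal (λ e₀ → ext-∈ _ (sub M u₁) (All.universal (λ e₁ →
        ext-∈ _ (sub M u₂) (All.universal (λ e₂ → fill-Span-∈ (proj₂ e) pos (proj₂ e₀) (proj₂ e₁) (proj₂ e₂) (image relR)
          (≡.subst (pos <_) (≡.sym q) pos<)) _)) _)) _))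
      (sub-homogeneous M ctx)))
      where
      open IdealTerm τ
      ρ = ext (sub M) rel
      A : BT g' → FS g'
      A T' = ext (λ u₀' → ext (λ u₁' → ext (λ u₂' → fill T' pos ρ u₀' u₁' u₂') (sub M u₂)) (sub M u₁)) (sub M u₀)
      X : BT g → BT g
      X e = graft (graft (graft e 2 u₂) 1 u₁) 0 u₀
      sub-X : ∀ e k → arity e ≡ 3 → ⟪ sub M (X e) ∣ k ⟫
        ≈ ⟪ sub M e ∣ (λ e' → ⟪ sub M u₂ ∣ (λ u₂' → ⟪ sub M u₁ ∣ (λ u₁' → ⟪ sub M u₀ ∣ (λ u₀' →
              k (graft (graft (graft e' 2 u₂') 1 u₁') 0 u₀')) ⟫) ⟫) ⟫) ⟫
      sub-X e k q =
        trans (sub-graft M Y₁ 0 u₀ k (arity>0 Y₁))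
          (trans (sub-graft M Y₂ 1 u₁ _ 1<Y₂) (sub-graft M e 2 u₂ _ (≡.subst (2 <_) (≡.sym q) ℕ.≤-refl)))
        where
        Y₂ = graft e 2 u₂
        Y₁ = graft Y₂ 1 u₁
        1<Y₂ : 1 < arity Y₂
        1<Y₂ = pos<arity-graft e 2 u₂ 1 (≡.subst (2 <_) (≡.sym q) ℕ.≤-refl)
          (≡.subst (λ m → 2 < m ℕ.+ arity u₂) (≡.sym q) (ℕ.m≤m+n 3 _))
      expand : ∀ h → ⟪ ext (sub M) (fill ctx pos rel u₀ u₁ u₂) ∣ h ⟫ ≈ ⟪ ext A (sub M ctx) ∣ h ⟫
      expand h = begin
        ⟪ ext (sub M) (fill ctx pos rel u₀ u₁ u₂) ∣ h ⟫
          ≈⟨ ⟪⟫-ext (sub M) (fill ctx pos rel u₀ u₁ u₂) h ⟩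
        ⟪ fill ctx pos rel u₀ u₁ u₂ ∣ (λ s → ⟪ sub M s ∣ h ⟫) ⟫
          ≈⟨ ⟪⟫-fill ctx pos rel u₀ u₁ u₂ _ ⟩
        ⟪ rel ∣ (λ e → ⟪ sub M (graft ctx pos (X e)) ∣ h ⟫) ⟫
          ≈⟨ ⟪⟫-congAll rel (All.map (λ {(_ , e)} q → trans (sub-graft M ctx pos (X e) h pos<)
               (⟪⟫-cong (sub M ctx) λ T' → sub-X e (λ X' → h (graft T' pos X')) q)) (R-arity relR)) ⟩
        ⟪ rel ∣ (λ e → ⟪ sub M ctx ∣ (λ T' → ⟪ sub M e ∣ G T' ⟫) ⟫) ⟫
          ≈⟨ ⟪⟫-comm rel (sub M ctx) _ ⟩
        ⟪ sub M ctx ∣ (λ T' → ⟪ rel ∣ (λ e → ⟪ sub M e ∣ G T' ⟫) ⟫) ⟫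
          -- Expanding `plug` puts the relation outermost, followed by `u₂`, `u₁`, `u₀`; in `A` it
          -- is innermost, so the order of the four sums is reversed.
          ≈⟨ ⟪⟫-cong (sub M ctx) (λ T' → trans (sym (⟪⟫-ext (sub M) rel (G T')))
               (trans (⟪⟫-reverse₄ ρ (sub M u₂) (sub M u₁) (sub M u₀) _) (collect T'))) ⟩
        ⟪ sub M ctx ∣ (λ T' → ⟪ A T' ∣ h ⟫) ⟫
          ≈⟨ ⟪⟫-ext A (sub M ctx) h ⟨
        ⟪ ext A (sub M ctx) ∣ h ⟫ ∎
        where
        G : BT g' → BT g' → Carrier
        G T' e' = ⟪ sub M u₂ ∣ (λ u₂' → ⟪ sub M u₁ ∣ (λ u₁' → ⟪ sub M u₀ ∣ (λ u₀' →
              h (plug T' pos u₀' u₁' u₂' e')) ⟫) ⟫) ⟫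
        collect : ∀ T' → ⟪ sub M u₀ ∣ (λ u₀' → ⟪ sub M u₁ ∣ (λ u₁' → ⟪ sub M u₂ ∣ (λ u₂' →
              ⟪ ρ ∣ (λ e' → h (plug T' pos u₀' u₁' u₂' e')) ⟫) ⟫) ⟫) ⟫ ≈ ⟪ A T' ∣ h ⟫
        collect T' = sym (trans (⟪⟫-ext _ (sub M u₀) h) (⟪⟫-cong (sub M u₀) λ u₀' →
          trans (⟪⟫-ext _ (sub M u₁) h) (⟪⟫-cong (sub M u₁) λ u₁' →
          trans (⟪⟫-ext _ (sub M u₂) h) (⟪⟫-cong (sub M u₂) λ u₂' →
          ⟪⟫-fill T' pos ρ u₀' u₁' u₂' h))))

  sub-inverse : ∀ {M N : GenMap g g} → (M ⊗ N) ≈M δ → ∀ t h →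
    ⟪ sub M t ∣ (λ s → ⟪ sub N s ∣ h ⟫) ⟫ ≈ h t
  sub-inverse {M = M} {N} p leaf h = trans (⟪⟫-sub-leaf M (λ s → ⟪ sub N s ∣ h ⟫)) (⟪⟫-sub-leaf N h)
  sub-inverse {g} {M} {N} p (node x l r) h = begin
    ⟪ sub M (node x l r) ∣ (λ s → ⟪ sub N s ∣ h ⟫) ⟫
      ≈⟨ ⟪⟫-sub-node M x l r _ ⟩
    sum (λ y → M x y * ⟪ sub M l ∣ (λ l' → ⟪ sub M r ∣ (λ r' → ⟪ sub N (node y l' r') ∣ h ⟫) ⟫) ⟫)
      ≈⟨ ∑-cong (λ y → *-congˡ (inner y)) ⟩
    sum (λ y → M x y * sum (λ z → N y z * h (node z l r)))
      ≈⟨ ∑-cong (λ y → *-distribˡ-sum (M x y) (λ z → N y z * h (node z l r))) ⟩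
    sum (λ y → sum (λ z → M x y * (N y z * h (node z l r))))
      ≈⟨ ∑-comm (λ y z → M x y * (N y z * h (node z l r))) ⟩
    sum (λ z → sum (λ y → M x y * (N y z * h (node z l r))))
      ≈⟨ ∑-cong (λ z → trans (∑-cong λ y → sym (*-assoc (M x y) (N y z) _))
           (trans (sym (*-distribʳ-sum (h (node z l r)) (λ y → M x y * N y z))) (*-congʳ (p x z)))) ⟩
    sum (λ z → δ x z * h (node z l r))
      ≈⟨ ∑-δˡ x (λ z → h (node z l r)) ⟩
    h (node x l r) ∎
    where
    inner : ∀ y → ⟪ sub M l ∣ (λ l' → ⟪ sub M r ∣ (λ r' → ⟪ sub N (node y l' r') ∣ h ⟫) ⟫) ⟫
      ≈ ∑[ z < g ] (N y z * h (node z l r))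
    inner y = begin
      ⟪ sub M l ∣ (λ l' → ⟪ sub M r ∣ (λ r' → ⟪ sub N (node y l' r') ∣ h ⟫) ⟫) ⟫
        ≈⟨ ⟪⟫-cong (sub M l) (λ l' → ⟪⟫-cong (sub M r) (λ r' → ⟪⟫-sub-node N y l' r' h)) ⟩
      ⟪ sub M l ∣ (λ l' → ⟪ sub M r ∣ (λ r' → sum (λ z → N y z * B z l' r')) ⟫) ⟫
        ≈⟨ ⟪⟫-cong (sub M l) (λ l' → trans (⟪⟫-sum (sub M r) (λ z r' → N y z * B z l' r'))
             (∑-cong λ z → ⟪⟫-* (sub M r) (N y z) (B z l'))) ⟩
      ⟪ sub M l ∣ (λ l' → sum (λ z → N y z * ⟪ sub M r ∣ B z l' ⟫)) ⟫
        ≈⟨ trans (⟪⟫-sum (sub M l) (λ z l' → N y z * ⟪ sub M r ∣ B z l' ⟫))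
             (∑-cong λ z → ⟪⟫-* (sub M l) (N y z) _) ⟩
      sum (λ z → N y z * ⟪ sub M l ∣ (λ l' → ⟪ sub M r ∣ B z l' ⟫) ⟫)
        ≈⟨ ∑-cong (λ z → *-congˡ (begin
             ⟪ sub M l ∣ (λ l' → ⟪ sub M r ∣ (λ r' → ⟪ sub N l' ∣ (λ l'' → ⟪ sub N r' ∣ (λ r'' → h (node z l'' r'')) ⟫) ⟫) ⟫) ⟫
               ≈⟨ ⟪⟫-cong (sub M l) (λ l' → ⟪⟫-comm (sub M r) (sub N l') _) ⟩
             ⟪ sub M l ∣ (λ l' → ⟪ sub N l' ∣ (λ l'' → ⟪ sub M r ∣ (λ r' → ⟪ sub N r' ∣ (λ r'' → h (node z l'' r'')) ⟫) ⟫) ⟫) ⟫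
               ≈⟨ sub-inverse p l _ ⟩
             ⟪ sub M r ∣ (λ r' → ⟪ sub N r' ∣ (λ r'' → h (node z l r'')) ⟫) ⟫
               ≈⟨ sub-inverse p r _ ⟩
             h (node z l r) ∎)) ⟩
      sum (λ z → N y z * h (node z l r)) ∎
      where
      B : Fin g → BT g → BT g → Carrier
      B z l' r' = ⟪ sub N l' ∣ (λ l'' → ⟪ sub N r' ∣ (λ r'' → h (node z l'' r'')) ⟫) ⟫

  ext-sub-inverse : ∀ {M N : GenMap g g} → (M ⊗ N) ≈M δ → ∀ v → ext (sub N) (ext (sub M) v) ≋ v
  ext-sub-inverse {M = M} {N} p v = functionals λ h →
    trans (⟪⟫-ext (sub N) (ext (sub M) v) h)
      (trans (⟪⟫-ext (sub M) v _) (⟪⟫-cong v λ t → sub-inverse p t h))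

  -- `sub M` and `sub N` are mutually inverse already on the free operads. Injectivity modulo
  -- relations thus amounts to `sub N` carrying the ideal of `R'` into that of `R`, and preimages
  -- are given by `sub N`.
  sub-isIsomorphism : ∀ {R R' : Relations g} (M N : GenMap g g) →
    (M ⊗ N) ≈M δ → (N ⊗ M) ≈M δ →
    (∀ {r} → R r → Homogeneous 3 r) → (∀ {r} → R' r → Homogeneous 3 r) →
    (∀ {r} → R r → Span R' (ext (sub M) r)) → (∀ {r} → R' r → Span R (ext (sub N) r)) →
    IsIsomorphism R R' (sub M)
  sub-isIsomorphism {g} {R} {R'} M N MN NM R-arity R'-arity M-image N-image = record
    { morphism = record
      { homogeneous = sub-homogeneous M
      ; wellDefined = λ v p → ∈⇒InIdeal (sub-∈ M R-arity M-image {v} (InIdeal⇒∈ p))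
      ; unit = ∈⇒InIdeal (difference (≋⇒≃ {v = sub M leaf} {(1# , leaf) ∷ []} (functionals λ h → refl)))
      ; composition = λ s i t i< → ∈⇒InIdeal (difference (≋⇒≃ {v = sub M (graft s i t)} {composeFS (sub M s) i (sub M t)}
          (functionals λ h → trans (sub-graft M s i t h i<) (sym (⟪⟫-composeFS (sub M s) i (sub M t) h)))))
      }
    ; injective = λ v p → ∈⇒InIdeal (∈-resp-≋ {v = v}
        (functionals λ h → sym (at (ext-sub-inverse MN v) h)) (sub-∈ N R'-arity N-image {ext (sub M) v} (InIdeal⇒∈ p)))
    ; surjective = λ w → ext (sub N) w , ∈⇒InIdeal (difference (≋⇒≃ (ext-sub-inverse NM w)))
    }

-- Morphisms are determined by their values on the generators.

module Uniqueness {c ℓ} (K : CharZeroField c ℓ) where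
  open WithField K
  open CommutativeRing (CharZeroField.cring K) hiding (zero)
  open Matrices (CharZeroField.cring K)
  open Integration K
  open Ideals K
  open Substitution K
  open import Relation.Binary.Reasoning.Setoid setoid

  private variable
    g g' : ℕ

  arity-graft-≥ˡ : ∀ (s : BT g) i t → i < arity s → arity s ≤ arity (graft s i t)
  arity-graft-≥ˡ s i t p = ℕ.≤-pred (≡.subst₂ _≤_ (ℕ.+-comm (arity s) 1) (≡.sym (arity-graft s i t p))
    (ℕ.+-monoʳ-≤ (arity s) (arity>0 t)))

  arity-graft-≥ʳ : ∀ (s : BT g) i t → i < arity s → arity t ≤ arity (graft s i t)
  arity-graft-≥ʳ s i t p = ℕ.≤-pred (≡.subst (suc (arity t) ≤_) (≡.sym (arity-graft s i t p))
    (ℕ.+-monoˡ-≤ (arity t) (ℕ.≤-trans (s≤s z≤n) p)))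

  3≤arity-plug : ∀ (T : BT g) i u₀ u₁ u₂ e → i < arity T → arity e ≡ 3 → 3 ≤ arity (plug T i u₀ u₁ u₂ e)
  3≤arity-plug T i u₀ u₁ u₂ e i< q =
    ℕ.≤-trans Y₀≥3 (arity-graft-≥ʳ T i (graft (graft (graft e 2 u₂) 1 u₁) 0 u₀) i<)
    where
    e≥3 : 3 ≤ arity e
    e≥3 = ℕ.≤-reflexive (≡.sym q)
    Y₂≥3 = ℕ.≤-trans e≥3 (arity-graft-≥ˡ e 2 u₂ e≥3)
    Y₁≥3 = ℕ.≤-trans Y₂≥3 (arity-graft-≥ˡ (graft e 2 u₂) 1 u₁ (ℕ.≤-trans (ℕ.n≤1+n 2) Y₂≥3))
    Y₀≥3 = ℕ.≤-trans Y₁≥3 (arity-graft-≥ˡ (graft (graft e 2 u₂) 1 u₁) 0 u₀ (ℕ.≤-trans (s≤s z≤n) Y₁≥3))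

  -- The functional `cut h` agrees with `h` in arity 2 and is zero in other arities; every tree in
  -- an ideal term contains a relation and has arity at least 3.
  arity₂-∈⇒0 : ∀ {R : Relations g} → (∀ {r} → R r → Homogeneous 3 r) →
    ∀ {v} → v ∈⟨ R ⟩ → Homogeneous 2 v → v ≋ []
  arity₂-∈⇒0 {g} {R} R-arity {v} (ideal τs p) v-arity = functionals λ h → begin
    ⟪ v ∣ h ⟫                             ≈⟨ ⟪⟫-congAll v (All.map (λ {(_ , s)} q → here h s q) v-arity) ⟩
    ⟪ v ∣ cut h ⟫                         ≈⟨ at p (cut h) ⟩
    ⟪ concatMap evalTerm τs ∣ cut h ⟫     ≈⟨ terms-vanish h τs ⟩
    0#                                    ∎
    where
    cut : (BT g → Carrier) → BT g → Carrier
    cut h t = if arity t ℕ.≡ᵇ 2 then h t else 0#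
    here : ∀ h s → arity s ≡ 2 → h s ≈ cut h s
    here h s q rewrite q = refl
    elsewhere : ∀ h s → 3 ≤ arity s → cut h s ≈ 0#
    elsewhere h s q with arity s | q
    ... | suc (suc (suc _)) | s≤s (s≤s (s≤s _)) = refl
    terms-vanish : ∀ h (τs : List (IdealTerm R)) → ⟪ concatMap evalTerm τs ∣ cut h ⟫ ≈ 0#
    terms-vanish h [] = refl
    terms-vanish h (τ ∷ τs) = begin
      ⟪ evalTerm τ ++ concatMap evalTerm τs ∣ cut h ⟫
        ≈⟨ ⟪⟫-++ (evalTerm τ) (concatMap evalTerm τs) _ ⟩
      ⟪ evalTerm τ ∣ cut h ⟫ + ⟪ concatMap evalTerm τs ∣ cut h ⟫
        ≈⟨ +-cong (⟪⟫-scale coef (fill ctx pos rel u₀ u₁ u₂) _) (terms-vanish h τs) ⟩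
      coef * ⟪ fill ctx pos rel u₀ u₁ u₂ ∣ cut h ⟫ + 0#
        ≈⟨ +-identityʳ _ ⟩
      coef * ⟪ fill ctx pos rel u₀ u₁ u₂ ∣ cut h ⟫
        ≈⟨ *-congˡ (trans (⟪⟫-fill ctx pos rel u₀ u₁ u₂ _) (⟪⟫-congAll rel (All.map
             (λ {(_ , e)} q → elsewhere h (plug ctx pos u₀ u₁ u₂ e) (3≤arity-plug ctx pos u₀ u₁ u₂ e pos< q)) (R-arity relR)))) ⟩
      coef * ⟪ rel ∣ (λ _ → 0#) ⟫
        ≈⟨ *-congˡ (⟪⟫-0 rel) ⟩
      coef * 0#
        ≈⟨ zeroʳ coef ⟩
      0# ∎
      where open IdealTerm τ

  single : (BT g → BT g') → BT g → FS g'
  single k s = (1# , k s) ∷ []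

  ⟪⟫-ext-single : ∀ (k : BT g → BT g') v h → ⟪ ext (single k) v ∣ h ⟫ ≈ ⟪ v ∣ (λ s → h (k s)) ⟫
  ⟪⟫-ext-single k v h = trans (⟪⟫-ext (single k) v h)
    (⟪⟫-cong v λ s → trans (+-identityʳ _) (*-identityˡ _))

  -- Made for the composition of a filled relation with a further tree: the result is again a
  -- filling of the same relation, in which only the context, the position and `u₀` may differ.
  ext-single-fill-∈ : ∀ {R : Relations g} {r} (k : BT g → BT g) T i u₀ u₁ u₂ T' i' u₀' →
    R r → i' < arity T' → (∀ e → k (plug T i u₀ u₁ u₂ e) ≡ plug T' i' u₀' u₁ u₂ e) →
    ext (single k) (fill T i r u₀ u₁ u₂) ∈⟨ R ⟩
  ext-single-fill-∈ {r = r} k T i u₀ u₁ u₂ T' i' u₀' Rr i'< p =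
    ∈-resp-≋ (functionals λ h → trans (⟪⟫-ext-single k (fill T i r u₀ u₁ u₂) h)
        (trans (⟪⟫-fill T i r u₀ u₁ u₂ _) (trans (⟪⟫-cong r λ e → reflexive (≡.cong h (p e)))
          (sym (⟪⟫-fill T' i' r u₀' u₁ u₂ h)))))
      (fill-∈ T' i' u₀' u₁ u₂ Rr i'<)

  composeFS-∈ʳ : ∀ {R : Relations g} v i {w} → All (λ e → i < arity (proj₂ e)) v →
    w ∈⟨ R ⟩ → composeFS v i w ∈⟨ R ⟩
  composeFS-∈ʳ {g} {R} v i {w} v-arity p = ∈-resp-≋
    (functionals λ h → trans (⟪⟫-composeFS v i w h)
      (sym (trans (⟪⟫-ext (λ s → ext (single (graft s i)) w) v h)
        (⟪⟫-cong v λ s → ⟪⟫-ext-single (graft s i) w h))))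
    (ext-∈ (λ s → ext (single (graft s i)) w) v (All.map (λ {(_ , s)} i<s → lift-∈ (single (graft s i)) (onTerm s i<s) p) v-arity))
    where
    onTerm : ∀ s → i < arity s → (τ : IdealTerm R) → let open IdealTerm τ in
      ext (single (graft s i)) (fill ctx pos rel u₀ u₁ u₂) ∈⟨ R ⟩
    onTerm s i<s τ = ext-single-fill-∈ (graft s i) ctx pos u₀ u₁ u₂ (graft s i ctx) (i ℕ.+ pos) u₀ relR
      (pos<arity-graft s i ctx (i ℕ.+ pos) i<s (ℕ.+-mono-≤-< i<s pos<))
      (λ e → graft-assoc s i ctx pos _ i<s pos<)
      where open IdealTerm τ

  -- The first leaf of a filled relation is the first leaf of `u₀` if the relation sits at position
  -- 0 of the context, and the first leaf of the context otherwise.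
  composeFS₀-∈ˡ : ∀ {R : Relations g} {v} w → v ∈⟨ R ⟩ → composeFS v 0 w ∈⟨ R ⟩
  composeFS₀-∈ˡ {g} {R} {v} w p = ∈-resp-≋
    (functionals λ h → trans (⟪⟫-composeFS v 0 w h) (trans (⟪⟫-comm v w _)
      (sym (trans (⟪⟫-ext (λ t → ext (single (λ s → graft s 0 t)) v) w h)
        (⟪⟫-cong w λ t → ⟪⟫-ext-single (λ s → graft s 0 t) v h)))))
    (ext-∈ (λ t → ext (single (λ s → graft s 0 t)) v) w (All.universal (λ (_ , t) → lift-∈ (single (λ s → graft s 0 t)) (onTerm t) p) w))
    where
    onTerm : ∀ t (τ : IdealTerm R) → let open IdealTerm τ in
      ext (single (λ s → graft s 0 t)) (fill ctx pos rel u₀ u₁ u₂) ∈⟨ R ⟩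
    onTerm t record { ctx = T ; pos = zero ; relR = Rr ; u₀ = u₀ ; u₁ = u₁ ; u₂ = u₂ } =
      ext-single-fill-∈ (λ s → graft s 0 t) T 0 u₀ u₁ u₂ T 0 (graft u₀ 0 t) Rr (arity>0 T)
        (λ e → let Y = graft (graft e 2 u₂) 1 u₁ in
          ≡.trans (≡.sym (graft-assoc T 0 (graft Y 0 u₀) 0 t (arity>0 T) (arity>0 (graft Y 0 u₀))))
            (≡.cong (graft T 0) (≡.sym (graft-assoc Y 0 u₀ 0 t (arity>0 Y) (arity>0 u₀)))))
    onTerm t record { ctx = T ; pos = suc i ; pos< = i< ; relR = Rr ; u₀ = u₀ ; u₁ = u₁ ; u₂ = u₂ } =
      ext-single-fill-∈ (λ s → graft s 0 t) T (suc i) u₀ u₁ u₂ (graft T 0 t) (arity t ℕ.+ i) u₀ Rr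
        (pos<arity-graft T 0 t (arity t ℕ.+ i) (arity>0 T)
          (≡.subst₂ _<_ (ℕ.+-suc (arity t) i) (ℕ.+-comm (arity t) (arity T)) (ℕ.+-monoʳ-< (arity t) i<)))
        (λ e → graft-parallel₀ T i _ t i<)

  composeFS-congʳ : ∀ {R : Relations g} v i {w w'} → All (λ e → i < arity (proj₂ e)) v →
    w ≃ w' [mod R ] → composeFS v i w ≃ composeFS v i w' [mod R ]
  composeFS-congʳ v i {w} {w'} v-arity (modulo p) = modulo (∈-resp-≋ (functionals λ h → begin
    ⟪ composeFS v i w -FS composeFS v i w' ∣ h ⟫
      ≈⟨ ⟪⟫--FS (composeFS v i w) (composeFS v i w') h ⟩
    ⟪ composeFS v i w ∣ h ⟫ - ⟪ composeFS v i w' ∣ h ⟫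
      ≈⟨ +-cong (⟪⟫-swap w h) (-‿cong (⟪⟫-swap w' h)) ⟩
    ⟪ w ∣ H h ⟫ - ⟪ w' ∣ H h ⟫
      ≈⟨ ⟪⟫--FS w w' (H h) ⟨
    ⟪ w -FS w' ∣ H h ⟫
      ≈⟨ ⟪⟫-swap (w -FS w') h ⟨
    ⟪ composeFS v i (w -FS w') ∣ h ⟫ ∎) (composeFS-∈ʳ v i v-arity p))
    where
    H : (BT _ → Carrier) → BT _ → Carrier
    H h t = ⟪ v ∣ (λ s → h (graft s i t)) ⟫
    ⟪⟫-swap : ∀ w h → ⟪ composeFS v i w ∣ h ⟫ ≈ ⟪ w ∣ H h ⟫
    ⟪⟫-swap w h = trans (⟪⟫-composeFS v i w h) (⟪⟫-comm v w (λ s t → h (graft s i t)))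

  composeFS₀-congˡ : ∀ {R : Relations g} {v v'} w →
    v ≃ v' [mod R ] → composeFS v 0 w ≃ composeFS v' 0 w [mod R ]
  composeFS₀-congˡ {v = v} {v'} w (modulo p) = modulo (∈-resp-≋ (functionals λ h → begin
    ⟪ composeFS v 0 w -FS composeFS v' 0 w ∣ h ⟫
      ≈⟨ ⟪⟫--FS (composeFS v 0 w) (composeFS v' 0 w) h ⟩
    ⟪ composeFS v 0 w ∣ h ⟫ - ⟪ composeFS v' 0 w ∣ h ⟫
      ≈⟨ +-cong (⟪⟫-composeFS v 0 w h) (-‿cong (⟪⟫-composeFS v' 0 w h)) ⟩
    _ ≈⟨ ⟪⟫--FS v v' _ ⟨
    _ ≈⟨ ⟪⟫-composeFS (v -FS v') 0 w h ⟨
    ⟪ composeFS (v -FS v') 0 w ∣ h ⟫ ∎) (composeFS₀-∈ˡ w p))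

  composeFS-≋ : ∀ {v v' : FS g} i w → v ≋ v' → composeFS v i w ≋ composeFS v' i w
  composeFS-≋ {v = v} {v'} i w p = functionals λ h →
    trans (⟪⟫-composeFS v i w h) (trans (at p _) (sym (⟪⟫-composeFS v' i w h)))

  -- A tree with root b, subtrees l and r is (b ∘₂ r) ∘₁ l, so only left factors in the first
  -- position have to be replaced modulo the ideal.
  morphism-unique : ∀ {R : Relations g} {R' : Relations g'} {Ψ Φ : BT g → FS g'} →
    IsMorphism R R' Ψ → IsMorphism R R' Φ →
    (∀ b → Ψ (gen b) ≋ Φ (gen b)) → ∀ t → Ψ t ≃ Φ t [mod R' ]
  morphism-unique {g} {g'} {R' = R'} {Ψ} {Φ} Ψ-mor Φ-mor p = go
    where
    module Ψ = IsMorphism Ψ-mor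
    module Φ = IsMorphism Φ-mor
    ≃-from : ∀ {v w} → Eq R' v w → v ≃ w [mod R' ]
    ≃-from {v} {w} q = modulo (InIdeal⇒∈ {v = v -FS w} q)
    positions : ∀ i s → i < arity s → All (λ e → i < arity (proj₂ e)) (Φ s)
    positions i s i< = All.map (λ q → ≡.subst (i <_) (≡.sym q) i<) (Φ.homogeneous s)
    go : ∀ t → Ψ t ≃ Φ t [mod R' ]
    go leaf = ≃-trans {v = Ψ leaf} {w = (1# , leaf) ∷ []} (≃-from Ψ.unit) (≃-sym {v = Φ leaf} (≃-from Φ.unit))
    go (node b l r) =
      ≃-trans (≃-from (Ψ.composition s 0 l (s≤s z≤n)))
      (≃-trans (composeFS₀-congˡ {v = Ψ s} {Φ s} (Ψ l) s-step)
      (≃-trans (composeFS-congʳ (Φ s) 0 {Ψ l} {Φ l} (positions 0 s (s≤s z≤n)) (go l))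
      (≃-sym (≃-from (Φ.composition s 0 l (s≤s z≤n))))))
      where
      s = node b leaf r
      s-step : Ψ s ≃ Φ s [mod R' ]
      s-step =
        ≃-trans (≃-from (Ψ.composition (gen b) 1 r (s≤s (s≤s z≤n))))
        -- The values on `gen b` are equal in the free operad, not merely congruent, so replacing a
        -- left factor composed at leaf 1 asks nothing of the ideal.
        (≃-trans (≋⇒≃ (composeFS-≋ {v = Ψ (gen b)} {Φ (gen b)} 1 (Ψ r) (p b)))
        (≃-trans (composeFS-congʳ (Φ (gen b)) 1 {Ψ r} {Φ r} (positions 1 (gen b) (s≤s (s≤s z≤n))) (go r))
        (≃-sym (≃-from (Φ.composition (gen b) 1 r (s≤s (s≤s z≤n)))))))

-- Ancestors in forests labelled in preorder.

mutual
  -- Inductive counterpart of the Boolean `ancT`. In `there` the shifted labels are given by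
  -- equations, so that matching on two derivations with a common label never has to unify sums.
  data AncT : RTree → ℕ → ℕ → Set where
    root  : ∀ {ts j} → j < sizeF ts → AncT (rnode ts) 0 (suc j)
    child : ∀ {ts i j} → AncF ts i j → AncT (rnode ts) (suc i) (suc j)

  data AncF : Forest → ℕ → ℕ → Set where
    here  : ∀ {t ts i j} → AncT t i j → AncF (t ∷ ts) i j
    there : ∀ {t ts i j i' j'} → i ≡ sizeT t ℕ.+ i' → j ≡ sizeT t ℕ.+ j' → AncF ts i' j' → AncF (t ∷ ts) i j

private
  ∧-true : ∀ {x y} → x ∧ y ≡ true → (x ≡ true) × (y ≡ true)
  ∧-true {true} {true} _ = ≡.refl , ≡.refl

  ∨-true : ∀ {x y} → x ∨ y ≡ true → (x ≡ true) ⊎ (y ≡ true)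
  ∨-true {true} _ = inj₁ ≡.refl
  ∨-true {false} p = inj₂ p

  ∨-falseˡ : ∀ {x y} → x ∨ y ≡ false → x ≡ false
  ∨-falseˡ {false} _ = ≡.refl

  ∨-trueˡ : ∀ {x} y → x ≡ true → x ∨ y ≡ true
  ∨-trueˡ y ≡.refl = ≡.refl

  ∨-trueʳ : ∀ x {y} → y ≡ true → x ∨ y ≡ true
  ∨-trueʳ true _ = ≡.refl
  ∨-trueʳ false p = p

  true≢false : ∀ {x} → x ≡ true → x ≡ false → ⊥
  true≢false ≡.refl ()

  <ᵇ-true : ∀ {m n} → (m ℕ.<ᵇ n) ≡ true → m < n
  <ᵇ-true {m} {n} p = ℕ.<ᵇ⇒< m n (≡.subst T (≡.sym p) tt)

  ≤ᵇ-true : ∀ {m n} → (m ℕ.≤ᵇ n) ≡ true → m ≤ n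
  ≤ᵇ-true {m} {n} p = ℕ.≤ᵇ⇒≤ m n (≡.subst T (≡.sym p) tt)

  ≡ᵇ-true : ∀ {m n} → (m ℕ.≡ᵇ n) ≡ true → m ≡ n
  ≡ᵇ-true {m} {n} p = ℕ.≡ᵇ⇒≡ m n (≡.subst T (≡.sym p) tt)

  T-true : ∀ {x} → T x → x ≡ true
  T-true {true} _ = ≡.refl

  <-true : ∀ {m n} → m < n → (m ℕ.<ᵇ n) ≡ true
  <-true p = T-true (ℕ.<⇒<ᵇ p)

  ≤-true : ∀ {m n} → m ≤ n → (m ℕ.≤ᵇ n) ≡ true
  ≤-true p = T-true (ℕ.≤⇒≤ᵇ p)

  ≥-false : ∀ {m n} → n ≤ m → (m ℕ.<ᵇ n) ≡ false
  ≥-false {m} {n} p with m ℕ.<ᵇ n in eq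
  ... | true = ⊥-elim (ℕ.<⇒≱ (<ᵇ-true {m} {n} eq) p)
  ... | false = ≡.refl

mutual
  AncT-bounds : ∀ {t i j} → AncT t i j → (i < j) × (j < sizeT t)
  AncT-bounds (root p) = s≤s z≤n , s≤s p
  AncT-bounds (child p) = let i<j , j< = AncF-bounds p in s≤s i<j , s≤s j<

  AncF-bounds : ∀ {F i j} → AncF F i j → (i < j) × (j < sizeF F)
  AncF-bounds (here p) = let i<j , j< = AncT-bounds p in i<j , ℕ.≤-trans j< (ℕ.m≤m+n _ _)
  AncF-bounds (there {t} ≡.refl ≡.refl p) = let i<j , j< = AncF-bounds p in
    ℕ.+-monoʳ-< (sizeT t) i<j , ℕ.+-monoʳ-< (sizeT t) j<

mutual
  ancT-sound : ∀ t i j → ancT t i j ≡ true → AncT t i j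
  ancT-sound (rnode ts) zero (suc j) p = root (<ᵇ-true {j} {sizeF ts} p)
  ancT-sound (rnode ts) (suc i) (suc j) p = child (ancF-sound ts i j p)

  ancF-sound : ∀ F i j → ancF F i j ≡ true → AncF F i j
  ancF-sound (t ∷ ts) i j p with (i ℕ.<ᵇ sizeT t) ∧ (j ℕ.<ᵇ sizeT t)
  ... | true = here (ancT-sound t i j p)
  ... | false with (sizeT t ℕ.≤ᵇ i) ∧ (sizeT t ℕ.≤ᵇ j) in eq
  ...   | true = let p₁ , p₂ = ∧-true eq in
    there (≡.sym (ℕ.m+[n∸m]≡n (≤ᵇ-true {sizeT t} p₁))) (≡.sym (ℕ.m+[n∸m]≡n (≤ᵇ-true {sizeT t} p₂)))
      (ancF-sound ts (i ℕ.∸ sizeT t) (j ℕ.∸ sizeT t) p)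

mutual
  ancT-complete : ∀ {t i j} → AncT t i j → ancT t i j ≡ true
  ancT-complete (root p) = <-true p
  ancT-complete (child p) = ancF-complete p

  ancF-complete : ∀ {F i j} → AncF F i j → ancF F i j ≡ true
  ancF-complete (here {t} {ts} {i} {j} p)
    rewrite <-true (ℕ.<-trans (proj₁ (AncT-bounds p)) (proj₂ (AncT-bounds p)))
          | <-true (proj₂ (AncT-bounds p)) = ancT-complete p
  ancF-complete (there {t} {ts} {i' = i} {j} ≡.refl ≡.refl p)
    rewrite ≥-false (ℕ.m≤m+n (sizeT t) i) | ≤-true (ℕ.m≤m+n (sizeT t) i) | ≤-true (ℕ.m≤m+n (sizeT t) j)
          | ℕ.m+n∸m≡n (sizeT t) i | ℕ.m+n∸m≡n (sizeT t) j = ancF-complete p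

private
  <-+-absurd : ∀ {i m n} → i ≡ m ℕ.+ n → i < m → ⊥
  <-+-absurd {m = m} {n} ≡.refl p = ℕ.<⇒≱ p (ℕ.m≤m+n m n)

mutual
  AncT-trans : ∀ {t i j k} → AncT t i j → AncT t j k → AncT t i k
  AncT-trans (root _) (child q) = root (proj₂ (AncF-bounds q))
  AncT-trans (child p) (child q) = child (AncF-trans p q)

  AncF-trans : ∀ {F i j k} → AncF F i j → AncF F j k → AncF F i k
  AncF-trans (here p) (here q) = here (AncT-trans p q)
  AncF-trans (here p) (there e _ q) = ⊥-elim (<-+-absurd e (proj₂ (AncT-bounds p)))
  AncF-trans (there _ e p) (here q) =
    ⊥-elim (<-+-absurd e (ℕ.<-trans (proj₁ (AncT-bounds q)) (proj₂ (AncT-bounds q))))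
  AncF-trans (there {t} e₁ e₂ p) (there e₃ e₄ q)
    with ≡.refl ← ℕ.+-cancelˡ-≡ (sizeT t) _ _ (≡.trans (≡.sym e₂) e₃) = there e₁ e₄ (AncF-trans p q)

mutual
  -- In preorder the labels of a subtree form an interval that begins with its root.
  AncT-interval : ∀ {t i j k} → AncT t i k → i < j → j ≤ k → AncT t i j
  AncT-interval (root p) (s≤s _) (s≤s j≤k) = root (ℕ.≤-<-trans j≤k p)
  AncT-interval (child p) (s≤s i<j) (s≤s j≤k) = child (AncF-interval p i<j j≤k)

  AncF-interval : ∀ {F i j k} → AncF F i k → i < j → j ≤ k → AncF F i j
  AncF-interval (here p) i<j j≤k = here (AncT-interval p i<j j≤k)
  AncF-interval {j = j} (there {t} {i' = i} ≡.refl ≡.refl p) i<j j≤k =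
    there ≡.refl (≡.sym eq) (AncF-interval p (ℕ.+-cancelˡ-< (sizeT t) _ _ (≡.subst (_ <_) (≡.sym eq) i<j))
      (ℕ.+-cancelˡ-≤ (sizeT t) _ _ (≡.subst (_≤ _) (≡.sym eq) j≤k)))
    where
    eq : sizeT t ℕ.+ (j ℕ.∸ sizeT t) ≡ j
    eq = ℕ.m+[n∸m]≡n (ℕ.≤-trans (ℕ.m≤m+n (sizeT t) i) (ℕ.<⇒≤ i<j))

Incomparable : (ℕ → ℕ → Set) → ℕ → ℕ → Set
Incomparable _≺_ i j = (i ≢ j) × ¬ (i ≺ j) × ¬ (j ≺ i)

ThinAnc : (ℕ → ℕ → Set) → Set
ThinAnc _≺_ = ∀ {a b c d} → a ≺ b → c ≺ d →
  Incomparable _≺_ a c → Incomparable _≺_ a d → Incomparable _≺_ b c → Incomparable _≺_ b d → ⊥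

-- Thinness is inherited along an embedding `f`. The order needs to be reflected only on `P`, which
-- contains the ends of all edges: for the first tree of a forest `f` is the identity, and larger
-- labels belong to other trees.
ThinAnc-restrict : ∀ {_≺_ _≺'_} (P : ℕ → Set) (f : ℕ → ℕ) → (∀ {i j} → f i ≡ f j → i ≡ j) →
  (∀ {i j} → i ≺ j → f i ≺' f j) → (∀ {i j} → i ≺ j → P i × P j) →
  (∀ {i j} → P i → P j → f i ≺' f j → i ≺ j) → ThinAnc _≺'_ → ThinAnc _≺_
ThinAnc-restrict {_≺_} {_≺'_} P f inj mono bounded refl thin ab cd ac ad bc bd =
  thin (mono ab) (mono cd) (lift-inc (proj₁ (bounded ab)) (proj₁ (bounded cd)) ac)
    (lift-inc (proj₁ (bounded ab)) (proj₂ (bounded cd)) ad)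
    (lift-inc (proj₂ (bounded ab)) (proj₁ (bounded cd)) bc)
    (lift-inc (proj₂ (bounded ab)) (proj₂ (bounded cd)) bd)
  where
  lift-inc : ∀ {i j} → P i → P j → Incomparable _≺_ i j → Incomparable _≺'_ (f i) (f j)
  lift-inc pi pj (i≢j , i⊀j , j⊀i) = (λ e → i≢j (inj e)) , (λ p → i⊀j (refl pi pj p)) , (λ p → j⊀i (refl pj pi p))

ThinAnc-children : ∀ {ts} → ThinAnc (AncT (rnode ts)) → ThinAnc (AncF ts)
ThinAnc-children = ThinAnc-restrict (λ _ → ⊤) suc ℕ.suc-injective child (λ _ → tt , tt)
  λ { _ _ (child p) → p }

ThinAnc-head : ∀ {t ts} → ThinAnc (AncF (t ∷ ts)) → ThinAnc (AncT t)
ThinAnc-head {t} = ThinAnc-restrict (_< sizeT t) (λ i → i) (λ e → e) here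
  (λ p → ℕ.<-trans (proj₁ (AncT-bounds p)) (proj₂ (AncT-bounds p)) , proj₂ (AncT-bounds p))
  λ { _ _ (here p) → p ; i< _ (there e _ _) → ⊥-elim (<-+-absurd e i<) }

ThinAnc-tail : ∀ {t ts} → ThinAnc (AncF (t ∷ ts)) → ThinAnc (AncF ts)
ThinAnc-tail {t} {ts} = ThinAnc-restrict (λ _ → ⊤) (sizeT t ℕ.+_) (ℕ.+-cancelˡ-≡ (sizeT t) _ _)
  (there ≡.refl ≡.refl) (λ _ → tt , tt) λ _ _ → λ
    { (here p) → ⊥-elim (<-+-absurd ≡.refl (ℕ.<-trans (proj₁ (AncT-bounds p)) (proj₂ (AncT-bounds p))))
    ; (there e₁ e₂ p) → ≡.subst₂ (AncF ts) (≡.sym (ℕ.+-cancelˡ-≡ (sizeT t) _ _ e₁))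
        (≡.sym (ℕ.+-cancelˡ-≡ (sizeT t) _ _ e₂)) p }

-- The edge joins the root of the last tree to its first child: labels 0 and 1, shifted by the sizes
-- of the earlier trees.
edge-in-last : ∀ F → 2 ≤ lastSize F → ∃ λ c → ∃ λ d → AncF F c d
edge-in-last (rnode [] ∷ []) (s≤s ())
edge-in-last (rnode (rnode us ∷ ts) ∷ []) _ = 0 , 1 , here (root (s≤s z≤n))
edge-in-last (t ∷ u ∷ ts) p = let c , d , q = edge-in-last (u ∷ ts) p in
  sizeT t ℕ.+ c , sizeT t ℕ.+ d , there ≡.refl ≡.refl q

-- If j came after an edge i ≺ i' of another branch, then the last subtree, which is at least as
-- large as the one containing that edge, would contain an edge as well, contradicting thinness.
mutual
  no-edge-before-T : ∀ {t i i' j} → StdT t → ThinAnc (AncT t) → AncT t i i' → i' < j → j < sizeT t → AncT t i j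
  no-edge-before-T std thin (root _) (s≤s _) (s≤s j<) = root j<
  no-edge-before-T {rnode ts} (std , last) thin (child p) (s≤s i'<j) (s≤s j<) =
    child (no-edge-before-F {ts} std last (ThinAnc-children thin) p i'<j j<)

  no-edge-before-F : ∀ {F i i' j} → StdL F → LastMax F → ThinAnc (AncF F) → AncF F i i' →
    i' < j → j < sizeF F → AncF F i j
  no-edge-before-F {t ∷ ts} {j = j} (std , _) last thin (here p) i'<j j< with j ℕ.<? sizeT t
  ... | yes j<t = here (no-edge-before-T std (ThinAnc-head thin) p i'<j j<t)
  no-edge-before-F {t ∷ []} {j = j} _ _ _ (here p) _ j< | no j≮t =
    ⊥-elim (j≮t (≡.subst (j <_) (ℕ.+-identityʳ _) j<))
  no-edge-before-F {t ∷ u ∷ us} {i} {i'} _ (t≤last ∷ _) thin (here p) _ _ | no _ =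
    ⊥-elim (thin (here p) (there ≡.refl ≡.refl cd) (inc i<) (inc i<) (inc i'<) (inc i'<))
    where
    i<i' = proj₁ (AncT-bounds p)
    i'< = proj₂ (AncT-bounds p)
    i< = ℕ.<-trans i<i' i'<
    edge = edge-in-last (u ∷ us) (ℕ.≤-trans (ℕ.≤-trans (s≤s (ℕ.≤-trans (s≤s z≤n) i<i')) i'<) t≤last)
    cd = proj₂ (proj₂ edge)
    inc : ∀ {a c} → a < sizeT t → Incomparable (AncF (t ∷ u ∷ us)) a (sizeT t ℕ.+ c)
    inc a< = (λ e → <-+-absurd e a<)
      , (λ { (here q) → <-+-absurd ≡.refl (proj₂ (AncT-bounds q))
           ; (there e _ _) → <-+-absurd e a< })
      , (λ { (here q) → <-+-absurd ≡.refl (ℕ.<-trans (proj₁ (AncT-bounds q)) (proj₂ (AncT-bounds q)))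
           ; (there _ e _) → <-+-absurd e a< })
  no-edge-before-F {t ∷ u ∷ us} {j = j} (_ , std) (_ ∷ last) thin (there {i' = i} {i'} ≡.refl ≡.refl p) i'<j j< =
    there ≡.refl (≡.sym eq) (no-edge-before-F std last (ThinAnc-tail thin) p
      (ℕ.+-cancelˡ-< (sizeT t) _ _ (≡.subst (_ <_) (≡.sym eq) i'<j))
      (ℕ.+-cancelˡ-< (sizeT t) _ _ (≡.subst (_< _) (≡.sym eq) j<)))
    where
    eq : sizeT t ℕ.+ (j ℕ.∸ sizeT t) ≡ j
    eq = ℕ.m+[n∸m]≡n (ℕ.≤-trans (ℕ.m≤m+n (sizeT t) i') (ℕ.<⇒≤ i'<j))

-- The orders of Q and Q^⊥: lower sets are chains, and comparabilities are complementary.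

record IsForestOrder {n} (le : Rel n) : Set where
  field
    le-refl  : ∀ i → le i i ≡ true
    le-trans : ∀ i j k → le i j ≡ true → le j k ≡ true → le i k ≡ true
    le-mono  : ∀ i j → le i j ≡ true → toℕ i ≤ toℕ j
    le-chain : ∀ i j k → le i k ≡ true → le j k ≡ true → comp le i j ≡ true

  comp-cases : ∀ {i j} → comp le i j ≡ true → (le i j ≡ true) ⊎ (le j i ≡ true)
  comp-cases = ∨-true

  -- Both elements lie below the larger of `c` and `d`, so `le-chain` applies.
  comp-below : ∀ {a b c d} → le a c ≡ true → le b d ≡ true → comp le c d ≡ true → comp le a b ≡ true
  comp-below {a} {b} {c} {d} p q r with comp-cases {c} r
  ... | inj₁ c≤d = le-chain a b d (le-trans a c d p c≤d) q
  ... | inj₂ d≤c = le-chain a b c p (le-trans b d c q d≤c)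

record Complementary {n} (le ld : Rel n) : Set where
  field
    both-comp : ∀ {i j} → comp le i j ≡ true → comp ld i j ≡ true → i ≡ j
    inc⇒comp  : ∀ {i j} → comp le i j ≡ false → comp ld i j ≡ true

module StandardForest (F : Forest) (std : Standard F) (thin : Thin (leQ F)) where
  le = leQ F
  ld = leD F

  leQ-sound : ∀ i j → le i j ≡ true → (i ≡ j) ⊎ AncF F (toℕ i) (toℕ j)
  leQ-sound i j p with ∨-true p
  ... | inj₁ e = inj₁ (toℕ-injective (≡ᵇ-true e))
  ... | inj₂ q = inj₂ (ancF-sound F (toℕ i) (toℕ j) q)

  leQ-anc : ∀ i j → AncF F (toℕ i) (toℕ j) → le i j ≡ true
  leQ-anc i j p = ∨-trueʳ (toℕ i ℕ.≡ᵇ toℕ j) (ancF-complete p)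

  leQ-refl : ∀ i → le i i ≡ true
  leQ-refl i = ∨-trueˡ _ (T-true (ℕ.≡⇒≡ᵇ (toℕ i) (toℕ i) ≡.refl))

  leQ-trans : ∀ i j k → le i j ≡ true → le j k ≡ true → le i k ≡ true
  leQ-trans i j k p q with leQ-sound i j p | leQ-sound j k q
  ... | inj₁ ≡.refl | _ = q
  ... | inj₂ _ | inj₁ ≡.refl = p
  ... | inj₂ a | inj₂ b = leQ-anc i k (AncF-trans a b)

  leQ-mono : ∀ i j → le i j ≡ true → toℕ i ≤ toℕ j
  leQ-mono i j p with leQ-sound i j p
  ... | inj₁ ≡.refl = ℕ.≤-refl
  ... | inj₂ a = ℕ.<⇒≤ (proj₁ (AncF-bounds a))

  leQ-interval : ∀ i j k → le i k ≡ true → toℕ i ≤ toℕ j → toℕ j ≤ toℕ k → le i j ≡ true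
  leQ-interval i j k p i≤j j≤k with ℕ.m≤n⇒m<n∨m≡n i≤j | leQ-sound i k p
  ... | inj₂ e | _ with ≡.refl ← toℕ-injective e = leQ-refl i
  ... | inj₁ i<j | inj₁ ≡.refl = ⊥-elim (ℕ.<⇒≱ i<j j≤k)
  ... | inj₁ i<j | inj₂ a = leQ-anc i j (AncF-interval a i<j j≤k)

  leQ-isForestOrder : IsForestOrder le
  leQ-isForestOrder = record
    { le-refl = leQ-refl ; le-trans = leQ-trans ; le-mono = leQ-mono ; le-chain = chain }
    where
    chain : ∀ i j k → le i k ≡ true → le j k ≡ true → comp le i j ≡ true
    -- Of two elements below `k`, the one with the larger label lies in the label interval from the
    -- other one to `k`.
    chain i j k p q with ℕ.≤-total (toℕ i) (toℕ j)
    ... | inj₁ i≤j = ∨-trueˡ _ (leQ-interval i j k p i≤j (leQ-mono j k q))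
    ... | inj₂ j≤i = ∨-trueʳ (le i j) (leQ-interval j i k q j≤i (leQ-mono i k p))

  thinAnc : ThinAnc (AncF F)
  thinAnc {a} {b} {c} {d} ab cd ac ad bc bd =
    thin (fin a<) (fin b<) (fin c<) (fin d<) (strict a< b< ab) (strict c< d< cd)
      (inc a< c< ac) (inc a< d< ad) (inc b< c< bc) (inc b< d< bd)
    where
    b< = proj₂ (AncF-bounds ab)
    a< = ℕ.<-trans (proj₁ (AncF-bounds ab)) b<
    d< = proj₂ (AncF-bounds cd)
    c< = ℕ.<-trans (proj₁ (AncF-bounds cd)) d<
    fin : ∀ {i} → i < sizeF F → Fin (sizeF F)
    fin i< = fromℕ< i<
    strict : ∀ {i j} (i< : i < sizeF F) (j< : j < sizeF F) → AncF F i j → Strict le (fin i<) (fin j<)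
    strict i< j< p = leQ-anc _ _ (≡.subst₂ (AncF F) (≡.sym (toℕ-fromℕ< i<)) (≡.sym (toℕ-fromℕ< j<)) p)
      , λ e → ℕ.<⇒≢ (proj₁ (AncF-bounds p)) (≡.trans (≡.sym (toℕ-fromℕ< i<)) (≡.trans (≡.cong toℕ e) (toℕ-fromℕ< j<)))
    not-le : ∀ {i j} (i< : i < sizeF F) (j< : j < sizeF F) → i ≢ j → ¬ AncF F i j → le (fin i<) (fin j<) ≡ false
    not-le i< j< i≢j ¬p with le (fin i<) (fin j<) in eq
    ... | false = ≡.refl
    ... | true with leQ-sound (fin i<) (fin j<) eq
    ...   | inj₁ e = ⊥-elim (i≢j (≡.trans (≡.sym (toℕ-fromℕ< i<)) (≡.trans (≡.cong toℕ e) (toℕ-fromℕ< j<))))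
    ...   | inj₂ p = ⊥-elim (¬p (≡.subst₂ (AncF F) (toℕ-fromℕ< i<) (toℕ-fromℕ< j<) p))
    inc : ∀ {i j} (i< : i < sizeF F) (j< : j < sizeF F) → Incomparable (AncF F) i j → Inc le (fin i<) (fin j<)
    inc i< j< (i≢j , i⊀j , j⊀i)
      rewrite not-le i< j< i≢j i⊀j | not-le j< i< (λ e → i≢j (≡.sym e)) j⊀i = ≡.refl

  leD-sound : ∀ i j → ld i j ≡ true → (i ≡ j) ⊎ ((comp le i j ≡ false) × (toℕ i < toℕ j))
  leD-sound i j p with ∨-true p
  ... | inj₁ e = inj₁ (toℕ-injective (≡ᵇ-true e))
  ... | inj₂ q with comp le i j | ∧-true {not (comp le i j)} q
  ...   | false | _ , r = inj₂ (≡.refl , <ᵇ-true r)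

  leD-inc : ∀ i j → comp le i j ≡ false → toℕ i < toℕ j → ld i j ≡ true
  leD-inc i j p q = ∨-trueʳ (toℕ i ℕ.≡ᵇ toℕ j) (≡.cong₂ (λ x y → not x ∧ y) p (<-true q))

  leD-refl : ∀ i → ld i i ≡ true
  leD-refl i = ∨-trueˡ _ (T-true (ℕ.≡⇒≡ᵇ (toℕ i) (toℕ i) ≡.refl))

  comp≤ : ∀ i j → comp le i j ≡ true → toℕ i < toℕ j → le i j ≡ true
  comp≤ i j p i<j with ∨-true {le i j} p
  ... | inj₁ q = q
  ... | inj₂ q = ⊥-elim (ℕ.<⇒≱ i<j (leQ-mono j i q))

  -- If `i` and `k` were comparable in Q, then `i` would be an ancestor of `k`, hence also of `j`,
  -- whose label lies between theirs.
  leD-trans : ∀ i j k → ld i j ≡ true → ld j k ≡ true → ld i k ≡ true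
  leD-trans i j k p q with leD-sound i j p | leD-sound j k q
  ... | inj₁ ≡.refl | _ = q
  ... | inj₂ _ | inj₁ ≡.refl = p
  ... | inj₂ (ij , i<j) | inj₂ (jk , j<k) with comp le i k in eq
  ...   | false = ∨-trueʳ (toℕ i ℕ.≡ᵇ toℕ k) (<-true (ℕ.<-trans i<j j<k))
  ...   | true = ⊥-elim (true≢false
    (leQ-interval i j k (comp≤ i k eq (ℕ.<-trans i<j j<k)) (ℕ.<⇒≤ i<j) (ℕ.<⇒≤ j<k)) (∨-falseˡ ij))

  leD-mono : ∀ i j → ld i j ≡ true → toℕ i ≤ toℕ j
  leD-mono i j p with leD-sound i j p
  ... | inj₁ ≡.refl = ℕ.≤-refl
  ... | inj₂ (_ , i<j) = ℕ.<⇒≤ i<j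

  -- The chain condition is where thinness and the order of siblings are used. For labels i < j < k
  -- with `i` an ancestor of `j`, `no-edge-before-F` makes `i` an ancestor of `k` as well, so `i` is
  -- not below `k` in Q^⊥.
  leD-isForestOrder : IsForestOrder ld
  leD-isForestOrder = record
    { le-refl = leD-refl ; le-trans = leD-trans ; le-mono = leD-mono ; le-chain = chain }
    where
    below : ∀ i j k → toℕ i < toℕ j → comp le i k ≡ false → toℕ j < toℕ k → comp ld i j ≡ true
    below i j k i<j ik j<k with comp le i j in eq
    ... | false = ∨-trueˡ _ (∨-trueʳ (toℕ i ℕ.≡ᵇ toℕ j) (<-true i<j))
    ... | true with leQ-sound i j (comp≤ i j eq i<j)
    ...   | inj₁ ≡.refl = ⊥-elim (ℕ.<-irrefl ≡.refl i<j)
    ...   | inj₂ a = ⊥-elim (true≢false (leQ-anc i k (no-edge-before-F (proj₁ std) (proj₂ std) thinAnc a j<k (toℕ<n k))) (∨-falseˡ ik))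
    chain : ∀ i j k → ld i k ≡ true → ld j k ≡ true → comp ld i j ≡ true
    chain i j k p q with leD-sound i k p | leD-sound j k q
    ... | inj₁ ≡.refl | _ = ∨-trueʳ (ld i j) q
    ... | inj₂ _ | inj₁ ≡.refl = ∨-trueˡ _ p
    ... | inj₂ (ik , i<k) | inj₂ (jk , j<k) with ℕ.<-cmp (toℕ i) (toℕ j)
    ...   | tri< i<j _ _ = below i j k i<j ik j<k
    ...   | tri> _ _ j<i = ≡.trans (∨-comm (ld i j) (ld j i)) (below j i k j<i jk i<k)
    ...   | tri≈ _ e _ with ≡.refl ← toℕ-injective e = ∨-trueˡ _ (leD-refl i)

  comp-sym : ∀ i j → comp le i j ≡ comp le j i
  comp-sym i j = ∨-comm (le i j) (le j i)

  complementary : Complementary le ld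
  complementary = record { both-comp = λ {i} {j} → both i j ; inc⇒comp = λ {i} {j} → inc i j }
    where
    both : ∀ i j → comp le i j ≡ true → comp ld i j ≡ true → i ≡ j
    both i j p q with ∨-true {ld i j} q
    ... | inj₁ r with leD-sound i j r
    ...   | inj₁ e = e
    ...   | inj₂ (s , _) = ⊥-elim (true≢false p s)
    both i j p q | inj₂ r with leD-sound j i r
    ...   | inj₁ e = ≡.sym e
    ...   | inj₂ (s , _) = ⊥-elim (true≢false (≡.trans (comp-sym j i) p) s)
    inc : ∀ i j → comp le i j ≡ false → comp ld i j ≡ true
    inc i j p with ℕ.<-cmp (toℕ i) (toℕ j)
    ... | tri< i<j _ _ = ∨-trueˡ _ (leD-inc i j p i<j)
    ... | tri> _ _ j<i = ∨-trueʳ (ld i j) (leD-inc j i (≡.trans (comp-sym j i) p) j<i)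
    ... | tri≈ _ e _ with ≡.refl ← toℕ-injective e = ∨-trueˡ _ (leD-refl i)

-- Möbius inversion of functions of the minimum.

module MöbiusInversion {c ℓ} (R : CommutativeRing c ℓ) {n} {le : Rel n} (order : IsForestOrder le) where
  open CommutativeRing R hiding (zero)
  open Matrices R
  open IsForestOrder order
  open import Relation.Binary.Reasoning.Setoid setoid

  open MöbiusInverse (möbiusInverse le le-refl le-trans le-mono) public
  Z = ζ le

  up-idem : ∀ p → up le p p ≡ p
  up-idem p rewrite le-refl p = ≡.refl

  comp-refl : ∀ p → comp le p p ≡ true
  comp-refl p rewrite le-refl p = ≡.refl

  ζ-up : ∀ e c d → comp le c d ≡ true → Z e c * Z e d ≈ Z e (up le c d)
  ζ-up e c d p with le c d in c≤d
  ... | true with le e c in e≤c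
  ...   | false = zeroˡ _
  ...   | true rewrite le-trans e c d e≤c c≤d = *-identityˡ _
  ζ-up e c d p | false with le e d in e≤d
  ...   | false = zeroʳ _
  ...   | true rewrite le-trans e d c e≤d p = *-identityˡ _

  -- The Möbius transform: `z p` is the sum of `hat z m` over all `m` below `p`.
  hat : (Fin n → Carrier) → Fin n → Carrier
  hat z m = ∑[ k < n ] (z k * μ k m)

  -- The diagonal matrix of `hat z` times `Z`. Thus `spread z` is `Z` transposed, times that
  -- diagonal matrix, times `Z`: the usual factorisation of a meet matrix.
  weighted : (Fin n → Carrier) → Matrix n
  weighted z m d = hat z m * Z m d

  weighted-μ : ∀ z e f → (weighted z ⊗ μ) e f ≈ hat z e * δ e f
  weighted-μ z e f = begin
    sum (λ d → hat z e * Z e d * μ d f)      ≈⟨ ∑-cong (λ d → *-assoc (hat z e) (Z e d) (μ d f)) ⟩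
    sum (λ d → hat z e * (Z e d * μ d f))    ≈⟨ *-distribˡ-sum (hat z e) (λ d → Z e d * μ d f) ⟨
    hat z e * sum (λ d → Z e d * μ d f)      ≈⟨ *-congˡ (ζμ≈δ e f) ⟩
    hat z e * δ e f ∎

  -- The matrix with entries z (min c d), extended from comparable pairs to all pairs.
  spread : (Fin n → Carrier) → Matrix n
  spread z = Z ᵀ ⊗ weighted z

  -- Below both `c` and `d` means below their minimum, so the entry is the sum of `hat z` below the
  -- minimum, and Möbius inversion gives `z` there.
  spread-up : ∀ z c d → comp le c d ≡ true → spread z c d ≈ z (up le c d)
  spread-up z c d p = begin
    sum (λ m → Z m c * (hat z m * Z m d))    ≈⟨ ∑-cong (λ m → rearrange m) ⟩
    sum (λ m → hat z m * Z m (up le c d))    ≈⟨ ⊗-assoc row μ Z c (up le c d) ⟩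
    (row ⊗ (μ ⊗ Z)) c (up le c d)            ≈⟨ ⊗-cong {A = row} (λ _ _ → refl) μζ≈δ c (up le c d) ⟩
    (row ⊗ δ) c (up le c d)                  ≈⟨ ⊗-identityʳ row c (up le c d) ⟩
    z (up le c d) ∎
    where
    row : Matrix n
    row _ = z
    rearrange : ∀ m → Z m c * (hat z m * Z m d) ≈ hat z m * Z m (up le c d)
    rearrange m = begin
      Z m c * (hat z m * Z m d)   ≈⟨ *-assoc _ _ _ ⟨
      Z m c * hat z m * Z m d     ≈⟨ *-congʳ (*-comm _ _) ⟩
      hat z m * Z m c * Z m d     ≈⟨ *-assoc _ _ _ ⟩
      hat z m * (Z m c * Z m d)   ≈⟨ *-congˡ (ζ-up m c d p) ⟩
      hat z m * Z m (up le c d)   ∎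

  conj-μ : Matrix n → Matrix n
  conj-μ x = μ ᵀ ⊗ (x ⊗ μ)

  -- The entry at `e`, `f` involves `x c d` only for `c` below `e` and `d` below `f`; when `e` and
  -- `f` are comparable, so are all such `c` and `d`.
  conj-μ-local : ∀ {x x'} → (∀ c d → comp le c d ≡ true → x c d ≈ x' c d) →
    ∀ e f → comp le e f ≡ true → conj-μ x e f ≈ conj-μ x' e f
  conj-μ-local {x} {x'} p e f ef = ∑-cong term
    where
    term : ∀ c → μ c e * (x ⊗ μ) c f ≈ μ c e * (x' ⊗ μ) c f
    term c with le c e in c≤e
    ... | false = trans (trans (*-congʳ (support c e c≤e)) (zeroˡ _))
                    (sym (trans (*-congʳ (support c e c≤e)) (zeroˡ _)))
    ... | true = *-congˡ (∑-cong inner)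
      where
      inner : ∀ d → x c d * μ d f ≈ x' c d * μ d f
      inner d with le d f in d≤f
      ... | false = trans (trans (*-congˡ (support d f d≤f)) (zeroʳ _))
                      (sym (trans (*-congˡ (support d f d≤f)) (zeroʳ _)))
      ... | true = *-congʳ (p c d (comp-below c≤e d≤f ef))

  conj-μ-spread : ∀ z e f → conj-μ (spread z) e f ≈ hat z e * δ e f
  conj-μ-spread z e f = begin
    (μ ᵀ ⊗ ((Z ᵀ ⊗ weighted z) ⊗ μ)) e f
      ≈⟨ ⊗-cong {A = μ ᵀ} (λ _ _ → refl) (⊗-assoc (Z ᵀ) (weighted z) μ) e f ⟩
    (μ ᵀ ⊗ (Z ᵀ ⊗ (weighted z ⊗ μ))) e f
      ≈⟨ ⊗-assoc (μ ᵀ) (Z ᵀ) (weighted z ⊗ μ) e f ⟨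
    ((μ ᵀ ⊗ Z ᵀ) ⊗ (weighted z ⊗ μ)) e f
      ≈⟨ ⊗-cong {B = weighted z ⊗ μ} (λ i j → trans (sym (⊗-ᵀ Z μ i j)) (trans (ζμ≈δ j i) (δ-sym j i))) (λ _ _ → refl) e f ⟩
    (δ ⊗ (weighted z ⊗ μ)) e f
      ≈⟨ ⊗-identityˡ (weighted z ⊗ μ) e f ⟩
    (weighted z ⊗ μ) e f
      ≈⟨ weighted-μ z e f ⟩
    hat z e * δ e f ∎

  -- Nothing is known of `x` at incomparable pairs. By locality it may be replaced by `spread z`,
  -- whose congruence by `μ` is exactly diagonal.
  conj-μ-comparable : ∀ {x} z → (∀ c d → comp le c d ≡ true → x c d ≈ z (up le c d)) →
    ∀ e f → comp le e f ≡ true → conj-μ x e f ≈ hat z e * δ e f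
  conj-μ-comparable {x} z p e f ef =
    trans (conj-μ-local {x} (λ c d cd → trans (p c d cd) (sym (spread-up z c d cd))) e f ef) (conj-μ-spread z e f)

-- Arity-3 elements as pairs of coefficient matrices, and the bilinear form.

module Pairing {c ℓ} (K : CharZeroField c ℓ) where
  open WithField K
  open CommutativeRing (CharZeroField.cring K) hiding (zero)
  open Matrices (CharZeroField.cring K)
  open Integration K
  open Substitution K
  open import Relation.Binary.Reasoning.Setoid setoid

  private variable
    g : ℕ

  private
    -- The elided left-hand side is the function local to the definition of pairing, called on p and
    -- applied to the sublist w; abstracting the whole list to p in pairing-∷ lets it be inferred.
    pairing-inner : ∀ a s (v p w : FS g) → _ ≈ a * ⟪ w ∣ pairT s ⟫

    pairing-∷ : ∀ a s (v w : FS g) → pairing ((a , s) ∷ v) w ≈ a * ⟪ w ∣ pairT s ⟫ + pairing v w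
    pairing-∷ a s v [] = +-congʳ (sym (zeroʳ a))
    pairing-∷ a s v ((b , t) ∷ w) with (b , t) ∷ w
    ... | p = +-congʳ (trans (+-cong (*-assoc a b _) (pairing-inner a s v p w)) (sym (distribˡ a _ _)))

    pairing-inner a s v p [] = sym (zeroʳ a)
    pairing-inner a s v p ((b , t) ∷ w) =
      trans (+-cong (*-assoc a b _) (pairing-inner a s v p w)) (sym (distribˡ a _ _))

  pairing-⟪⟫ : ∀ (v w : FS g) → pairing v w ≈ ⟪ v ∣ (λ s → ⟪ w ∣ pairT s ⟫) ⟫
  pairing-⟪⟫ [] w = refl
  pairing-⟪⟫ ((a , s) ∷ v) w = trans (pairing-∷ a s v w) (+-congˡ (pairing-⟪⟫ v w))

  ⟪⟫-binomial : ∀ (s t : BT g) h → ⟪ (1# , s) ∷ (- 1# , t) ∷ [] ∣ h ⟫ ≈ h s - h t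
  ⟪⟫-binomial s t h = +-cong (*-identityˡ _) (trans (+-identityʳ _) (-1*x≈-x _))

  private
    pairT-sign : ∀ (s t : BT g) → pairT s t ≈ sign t * [ t ] s
    pairT-sign s t with s ≟T t
    ... | yes ≡.refl = sym (*-identityʳ _)
    ... | no _ = sym (zeroʳ _)

  pairing-coeff : ∀ (v r : FS g) → pairing v r ≈ ⟪ r ∣ (λ t → sign t * ⟪ v ∣ [ t ] ⟫) ⟫
  pairing-coeff v r = begin
    pairing v r                                        ≈⟨ pairing-⟪⟫ v r ⟩
    ⟪ v ∣ (λ s → ⟪ r ∣ pairT s ⟫) ⟫                    ≈⟨ ⟪⟫-comm v r pairT ⟩
    ⟪ r ∣ (λ t → ⟪ v ∣ (λ s → pairT s t) ⟫) ⟫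
      ≈⟨ ⟪⟫-cong r (λ t → trans (⟪⟫-cong v λ s → pairT-sign s t) (⟪⟫-* v (sign t) [ t ])) ⟩
    ⟪ r ∣ (λ t → sign t * ⟪ v ∣ [ t ] ⟫) ⟫ ∎

  x₁ x₂ : FS g → Matrix g
  x₁ v a b = ⟪ v ∣ [ c1 a b ] ⟫
  x₂ v a b = ⟪ v ∣ [ c2 a b ] ⟫

  [c1]-c1 : ∀ (a b c d : Fin g) → [ c1 c d ] (c1 a b) ≈ δ a c * δ b d
  [c1]-c1 a b c d with a ≟F c | b ≟F d
  ... | yes ≡.refl | yes ≡.refl = sym (*-identityˡ _)
  ... | yes ≡.refl | no _ = sym (zeroʳ _)
  ... | no _ | yes _ = sym (zeroˡ _)
  ... | no _ | no _ = sym (zeroˡ _)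

  [c2]-c2 : ∀ (a b c d : Fin g) → [ c2 c d ] (c2 a b) ≈ δ a c * δ b d
  [c2]-c2 a b c d with a ≟F c | b ≟F d
  ... | yes ≡.refl | yes ≡.refl = sym (*-identityˡ _)
  ... | yes ≡.refl | no _ = sym (zeroʳ _)
  ... | no _ | yes _ = sym (zeroˡ _)
  ... | no _ | no _ = sym (zeroˡ _)

  [c2]-c1 : ∀ (a b c d : Fin g) → [ c2 c d ] (c1 a b) ≈ 0#
  [c2]-c1 a b c d with a ≟F c
  ... | yes ≡.refl = refl
  ... | no _ = refl

  [c1]-c2 : ∀ (a b c d : Fin g) → [ c1 c d ] (c2 a b) ≈ 0#
  [c1]-c2 a b c d with a ≟F c
  ... | yes ≡.refl = refl
  ... | no _ = refl

  arity₁-leaf : ∀ (t : BT g) → arity t ≡ 1 → t ≡ leaf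
  arity₁-leaf leaf _ = ≡.refl
  arity₁-leaf (node x l r) p with ℕ.≤-trans (ℕ.+-mono-≤ (arity>0 l) (arity>0 r)) (ℕ.≤-reflexive p)
  ... | s≤s ()

  arity₂-gen : ∀ (t : BT g) → arity t ≡ 2 → ∃ λ x → t ≡ gen x
  arity₂-gen (node x l r) p with arity l in el | arity>0 l
  ... | 1 | _ with ≡.refl ← arity₁-leaf l el | ≡.refl ← arity₁-leaf r (ℕ.suc-injective p) = x , ≡.refl
  ... | suc (suc m) | _ = ⊥-elim (ℕ.<⇒≢ (ℕ.≤-trans (arity>0 r) (ℕ.m≤n+m (arity r) m)) (≡.sym (ℕ.suc-injective (ℕ.suc-injective p))))

  arity₃-cases : ∀ (t : BT g) → arity t ≡ 3 → ∃ λ a → ∃ λ b → (t ≡ c1 a b) ⊎ (t ≡ c2 a b)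
  arity₃-cases (node x l r) p with arity l in el | arity>0 l
  ... | 1 | _ with ≡.refl ← arity₁-leaf l el | y , ≡.refl ← arity₂-gen r (ℕ.suc-injective p) = x , y , inj₂ ≡.refl
  ... | 2 | _ with y , ≡.refl ← arity₂-gen l el | ≡.refl ← arity₁-leaf r (ℕ.suc-injective (ℕ.suc-injective p)) =
    x , y , inj₁ ≡.refl
  ... | suc (suc (suc m)) | _ = ⊥-elim (ℕ.<⇒≢ (ℕ.≤-trans (arity>0 r) (ℕ.m≤n+m (arity r) m))
    (≡.sym (ℕ.suc-injective (ℕ.suc-injective (ℕ.suc-injective p)))))

  ∑∑-δ : ∀ (A B : Fin g → Carrier) c d →
    (∑[ c' < g ] (A c' * (∑[ d' < g ] (B d' * (δ c' c * δ d' d))))) ≈ A c * B d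
  ∑∑-δ {g} A B c d = trans (∑-cong outer) (∑-δʳ c (λ c' → A c' * B d))
    where
    inner : ∀ c' → (∑[ d' < g ] (B d' * (δ c' c * δ d' d))) ≈ B d * δ c' c
    inner c' = trans (∑-cong λ d' → sym (*-assoc (B d') (δ c' c) (δ d' d))) (∑-δʳ d (λ d' → B d' * δ c' c))
    outer : ∀ c' → A c' * (∑[ d' < g ] (B d' * (δ c' c * δ d' d))) ≈ A c' * B d * δ c' c
    outer c' = trans (*-congˡ (inner c')) (sym (*-assoc _ _ _))

  ∑∑-δδ : ∀ (H : Matrix g) a b → (∑[ c < g ] (∑[ d < g ] (δ a c * δ b d * H c d))) ≈ H a b
  ∑∑-δδ {g} H a b = begin
    sum (λ c → sum (λ d → δ a c * δ b d * H c d))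
      ≈⟨ ∑-cong (λ c → trans (∑-cong λ d → *-assoc (δ a c) (δ b d) (H c d))
           (sym (*-distribˡ-sum (δ a c) (λ d → δ b d * H c d)))) ⟩
    sum (λ c → δ a c * sum (λ d → δ b d * H c d))
      ≈⟨ ∑-δˡ a (λ c → sum (λ d → δ b d * H c d)) ⟩
    sum (λ d → δ b d * H a d)
      ≈⟨ ∑-δˡ b (H a) ⟩
    H a b ∎

  at-c1 at-c2 : (BT g → Carrier) → Matrix g
  at-c1 h a b = h (c1 a b)
  at-c2 h a b = h (c2 a b)

  -- There are two shapes of binary trees with three leaves, so the matrices `x₁ v` and `x₂ v` hold
  -- all coefficients of `v`.
  ⟪⟫-arity₃ : ∀ (v : FS g) → Homogeneous 3 v → ∀ h →
    ⟪ v ∣ h ⟫ ≈ ⟨ x₁ v , at-c1 h ⟩ + ⟨ x₂ v , at-c2 h ⟩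
  ⟪⟫-arity₃ {g} v v-arity h = begin
    ⟪ v ∣ h ⟫
      ≈⟨ ⟪⟫-congAll v (All.map (λ {(_ , s)} q → split s (arity₃-cases s q)) v-arity) ⟩
    ⟪ v ∣ (λ s → ⟨ (λ a b → [ c1 a b ] s) , at-c1 h ⟩ + ⟨ (λ a b → [ c2 a b ] s) , at-c2 h ⟩) ⟫
      ≈⟨ ⟪⟫-+ v (λ s → ⟨ (λ a b → [ c1 a b ] s) , at-c1 h ⟩) _ ⟩
    ⟪ v ∣ (λ s → ⟨ (λ a b → [ c1 a b ] s) , at-c1 h ⟩) ⟫ + ⟪ v ∣ (λ s → ⟨ (λ a b → [ c2 a b ] s) , at-c2 h ⟩) ⟫
      ≈⟨ +-cong (exchange c1 (at-c1 h)) (exchange c2 (at-c2 h)) ⟩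
    ⟨ x₁ v , at-c1 h ⟩ + ⟨ x₂ v , at-c2 h ⟩ ∎
    where
    exchange : ∀ (t : Fin g → Fin g → BT g) (H : Matrix g) →
      ⟪ v ∣ (λ s → ⟨ (λ a b → [ t a b ] s) , H ⟩) ⟫ ≈ ⟨ (λ a b → ⟪ v ∣ [ t a b ] ⟫) , H ⟩
    exchange t H = trans (⟪⟫-sum v (λ a s → ∑[ b < g ] ([ t a b ] s * H a b)))
      (∑-cong λ a → trans (⟪⟫-sum v (λ b s → [ t a b ] s * H a b))
        (∑-cong λ b → trans (⟪⟫-cong v λ s → *-comm ([ t a b ] s) (H a b))
          (trans (⟪⟫-* v (H a b) [ t a b ]) (*-comm _ _))))
    vanish : ∀ (A H : Matrix g) → (∀ a b → A a b ≈ 0#) → ⟨ A , H ⟩ ≈ 0#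
    vanish A H p = ∑-zero λ a → ∑-zero λ b → trans (*-congʳ (p a b)) (zeroˡ (H a b))
    pick : ∀ (A H : Matrix g) a b → (∀ c d → A c d ≈ δ a c * δ b d) → ⟨ A , H ⟩ ≈ H a b
    pick A H a b p = trans (⟨⟩-cong {B = H} p (λ _ _ → refl)) (∑∑-δδ H a b)
    split : ∀ s → (∃ λ a → ∃ λ b → (s ≡ c1 a b) ⊎ (s ≡ c2 a b)) →
      h s ≈ ⟨ (λ a b → [ c1 a b ] s) , at-c1 h ⟩ + ⟨ (λ a b → [ c2 a b ] s) , at-c2 h ⟩
    split _ (a , b , inj₁ ≡.refl) = sym (trans (+-cong (pick _ (at-c1 h) a b ([c1]-c1 a b)) (vanish _ (at-c2 h) ([c2]-c1 a b))) (+-identityʳ _))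
    split _ (a , b , inj₂ ≡.refl) = sym (trans (+-cong (vanish _ (at-c1 h) ([c1]-c2 a b)) (pick _ (at-c2 h) a b ([c2]-c2 a b))) (+-identityˡ _))

  module _ (M : GenMap g g) where
    ⟪⟫-sub-gen : ∀ b h → ⟪ sub M (gen b) ∣ h ⟫ ≈ ∑[ c < g ] (M b c * h (gen c))
    ⟪⟫-sub-gen b h = trans (⟪⟫-sub-node M b leaf leaf h) (∑-cong λ c → *-congˡ
      (trans (⟪⟫-sub-leaf M (λ l' → ⟪ sub M leaf ∣ (λ r' → h (node c l' r')) ⟫)) (⟪⟫-sub-leaf M (λ r' → h (node c leaf r')))))

    ⟪⟫-sub-c1 : ∀ a b h → ⟪ sub M (c1 a b) ∣ h ⟫
      ≈ ∑[ c < g ] (M a c * (∑[ d < g ] (M b d * h (c1 c d))))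
    ⟪⟫-sub-c1 a b h = trans (⟪⟫-sub-node M a (gen b) leaf h) (∑-cong λ c → *-congˡ
      (trans (⟪⟫-cong (sub M (gen b)) λ l' → ⟪⟫-sub-leaf M (λ r' → h (node c l' r')))
        (⟪⟫-sub-gen b (λ l' → h (node c l' leaf)))))

    ⟪⟫-sub-c2 : ∀ a b h → ⟪ sub M (c2 a b) ∣ h ⟫
      ≈ ∑[ c < g ] (M a c * (∑[ d < g ] (M b d * h (c2 c d))))
    ⟪⟫-sub-c2 a b h = trans (⟪⟫-sub-node M a leaf (gen b) h) (∑-cong λ c → *-congˡ
      (trans (⟪⟫-sub-leaf M (λ l' → ⟪ sub M (gen b) ∣ (λ r' → h (node c l' r')) ⟫))
        (⟪⟫-sub-gen b (λ r' → h (node c leaf r')))))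

    x₁-sub-c1 : ∀ a b c d → x₁ (sub M (c1 a b)) c d ≈ M a c * M b d
    x₁-sub-c1 a b c d = trans (⟪⟫-sub-c1 a b [ c1 c d ])
      (trans (∑-cong λ c' → *-congˡ (∑-cong λ d' → *-congˡ ([c1]-c1 c' d' c d))) (∑∑-δ (M a) (M b) c d))

    x₂-sub-c2 : ∀ a b c d → x₂ (sub M (c2 a b)) c d ≈ M a c * M b d
    x₂-sub-c2 a b c d = trans (⟪⟫-sub-c2 a b [ c2 c d ])
      (trans (∑-cong λ c' → *-congˡ (∑-cong λ d' → *-congˡ ([c2]-c2 c' d' c d))) (∑∑-δ (M a) (M b) c d))

    x₂-sub-c1 : ∀ a b c d → x₂ (sub M (c1 a b)) c d ≈ 0#
    x₂-sub-c1 a b c d = trans (⟪⟫-sub-c1 a b [ c2 c d ]) (∑-zero λ c' → trans (*-congˡ {M a c'}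
      (∑-zero λ d' → trans (*-congˡ ([c2]-c1 c' d' c d)) (zeroʳ (M b d')))) (zeroʳ _))

    x₁-sub-c2 : ∀ a b c d → x₁ (sub M (c2 a b)) c d ≈ 0#
    x₁-sub-c2 a b c d = trans (⟪⟫-sub-c2 a b [ c1 c d ]) (∑-zero λ c' → trans (*-congˡ {M a c'}
      (∑-zero λ d' → trans (*-congˡ ([c1]-c2 c' d' c d)) (zeroʳ (M b d')))) (zeroʳ _))

  ext-sub-homogeneous : ∀ (M : GenMap g g) m v → Homogeneous m v → Homogeneous m (ext (sub M) v)
  ext-sub-homogeneous M m v p = All.concat⁺ (All.map⁺ (All.map (λ {(a , s)} q →
    scale-homogeneous a (All.map (λ r → ≡.trans r q) (sub-homogeneous M s))) p))

-- Coefficients of the elements annihilating the relations.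

module DualRelations {c ℓ} (K : CharZeroField c ℓ) {n} {le : Rel n} (order : IsForestOrder le) where
  open WithField K
  open CommutativeRing (CharZeroField.cring K) hiding (zero)
  open Matrices (CharZeroField.cring K)
  open Integration K
  open Substitution K
  open Pairing K
  open MöbiusInversion (CharZeroField.cring K) order using (up-idem; comp-refl)
  open import Relation.Binary.Reasoning.Setoid setoid

  private
    -- The sign of the second monomial cancels the sign of the bilinear form at right combs, whence
    -- the plus.
    pairing-binomial : ∀ (v : FS n) a b c d →
      (pairing v ((1# , c1 a b) ∷ (- 1# , c2 c d) ∷ []) ≈ x₁ v a b + x₂ v c d)
    pairing-binomial v a b c d = trans (pairing-coeff v _) (trans (⟪⟫-binomial (c1 a b) (c2 c d) (λ t → sign t * ⟪ v ∣ [ t ] ⟫))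
      (+-cong (*-identityˡ _) (trans (-‿cong (-1*x≈-x _)) (-‿involutive _))))

  dual-intro : ∀ v → Homogeneous 3 v → (κ : Fin n → Carrier) →
    (∀ c d → comp le c d ≡ true → x₁ v c d ≈ κ (up le c d)) →
    (∀ c d → comp le c d ≡ true → x₂ v c d ≈ - κ (up le c d)) → Dual (AsRel le) v
  dual-intro v v-arity κ p₁ p₂ = v-arity , annihilates
    where
    at-min : ∀ m → (x₁ v m m ≈ κ m) × (x₂ v m m ≈ - κ m)
    at-min m = trans (p₁ m m (comp-refl m)) (reflexive (≡.cong κ (up-idem m)))
             , trans (p₂ m m (comp-refl m)) (-‿cong (reflexive (≡.cong κ (up-idem m))))
    annihilates : ∀ r → AsRel le r → pairing v r ≈ 0#
    annihilates _ (lift (a , b , ab , inj₁ ≡.refl)) =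
      trans (pairing-binomial v a b _ _) (trans (+-cong (p₁ a b ab) (proj₂ (at-min _))) (-‿inverseʳ _))
    annihilates _ (lift (a , b , ab , inj₂ ≡.refl)) =
      trans (pairing-binomial v _ _ a b) (trans (+-cong (proj₁ (at-min _)) (p₂ a b ab)) (-‿inverseʳ _))

  x+y≈0⇒y≈-x : ∀ {x y} → x + y ≈ 0# → y ≈ - x
  x+y≈0⇒y≈-x {x} {y} p = begin
    y               ≈⟨ +-identityˡ y ⟨
    0# + y          ≈⟨ +-congʳ (-‿inverseˡ x) ⟨
    - x + x + y     ≈⟨ +-assoc _ _ _ ⟩
    - x + (x + y)   ≈⟨ +-congˡ p ⟩
    - x + 0#        ≈⟨ +-identityʳ _ ⟩
    - x             ∎

  -- Recovers the function `κ` of `dual-intro`, because the minimum of `m` and `m` is `m`.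
  diagonal : FS n → Fin n → Carrier
  diagonal v m = x₁ v m m

  dual-elim₂ : ∀ {v} → Dual (AsRel le) v → ∀ c d → comp le c d ≡ true →
    x₂ v c d ≈ - diagonal v (up le c d)
  dual-elim₂ {v} (_ , ann) c d cd =
    x+y≈0⇒y≈-x (trans (sym (pairing-binomial v _ _ c d)) (ann _ (lift (c , d , cd , inj₂ ≡.refl))))

  -- The first family of relations leads from `x₁` at the pair to minus `x₂` at the minimum `m`, the
  -- second family at `m`, `m` back to `x₁`.
  dual-elim₁ : ∀ {v} → Dual (AsRel le) v → ∀ c d → comp le c d ≡ true →
    x₁ v c d ≈ diagonal v (up le c d)
  dual-elim₁ {v} dual@(_ , ann) c d cd = begin
    x₁ v c d                          ≈⟨ x+y≈0⇒y≈-x (trans (+-comm _ _) (trans (sym (pairing-binomial v c d _ _)) (ann _ (lift (c , d , cd , inj₁ ≡.refl))))) ⟩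
    - x₂ v m m                        ≈⟨ -‿cong (dual-elim₂ dual m m (comp-refl m)) ⟩
    - (- diagonal v (up le m m))      ≈⟨ -‿involutive _ ⟩
    diagonal v (up le m m)            ≡⟨ ≡.cong (diagonal v) (up-idem m) ⟩
    diagonal v m                      ∎
    where m = up le c d

-- The change of generators carries each relation space into the other.

module KoszulDuality {c ℓ} (K : CharZeroField c ℓ) {n} {le ld : Rel n}
  (Q-order : IsForestOrder le) (D-order : IsForestOrder ld) (compl : Complementary le ld) where
  open WithField K
  private R = CharZeroField.cring K
  open CommutativeRing R hiding (zero)
  open Matrices R
  open Integration K
  open Substitution K
  open Pairing K
  open DualRelations K Q-order
  open Complementary compl
  open import Relation.Binary.Reasoning.Setoid setoid
  open import Algebra.Properties.CommutativeSemigroup +-commutativeSemigroup using ()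
    renaming (interchange to +-interchange)
  open import Algebra.Properties.CommutativeSemigroup *-commutativeSemigroup using ()
    renaming (interchange to *-interchange)

  private
    module Qo = IsForestOrder Q-order
    module Do = IsForestOrder D-order
    module Q = MöbiusInversion R Q-order
    module D = MöbiusInversion R D-order

  M N V : Matrix n
  M = D.Z ᵀ ⊗ Q.Z
  V = D.μ ᵀ
  N = Q.μ ⊗ V

  MN≈δ : M ⊗ N ≈M δ
  MN≈δ = ⊗-cancel {A = D.Z ᵀ} {Q.Z} {Q.μ} {V} Q.ζμ≈δ
    (λ i j → trans (sym (⊗-ᵀ D.μ D.Z i j)) (trans (D.μζ≈δ j i) (δ-sym j i)))

  VZᵀ≈δ : V ⊗ D.Z ᵀ ≈M δ
  VZᵀ≈δ i j = trans (sym (⊗-ᵀ D.Z D.μ i j)) (trans (D.ζμ≈δ j i) (δ-sym j i))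

  NM≈δ : N ⊗ M ≈M δ
  NM≈δ = ⊗-cancel {A = Q.μ} {V} {D.Z ᵀ} {Q.Z} VZᵀ≈δ Q.μζ≈δ

  -- A product of two summands of M a c and M b d, indexed by e and f, is nonzero only if e and f are
  -- comparable in both orders, hence equal.
  M-min : ∀ a b c d → comp ld a b ≡ true → comp le c d ≡ true →
    M a c * M b d ≈ M (up ld a b) (up le c d)
  M-min a b c d ab cd = begin
    M a c * M b d
      ≈⟨ *-distribʳ-sum (M b d) (λ e → D.Z e a * Q.Z e c) ⟩
    sum (λ e → D.Z e a * Q.Z e c * M b d)
      ≈⟨ ∑-cong (λ e → *-distribˡ-sum (D.Z e a * Q.Z e c) (λ f → D.Z f b * Q.Z f d)) ⟩
    sum (λ e → sum (λ f → term e f))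
      ≈⟨ ∑-cong (λ e → trans (∑-cong (diagonal-only e)) (∑-δˡ e (term e))) ⟩
    sum (λ e → term e e)
      ≈⟨ ∑-cong (λ e → trans (*-interchange _ _ _ _) (*-cong (D.ζ-up e a b ab) (Q.ζ-up e c d cd))) ⟩
    M (up ld a b) (up le c d) ∎
    where
    term : Matrix n
    term e f = (D.Z e a * Q.Z e c) * (D.Z f b * Q.Z f d)
    diagonal-only : ∀ e f → term e f ≈ δ e f * term e f
    diagonal-only e f with e ≟F f
    ... | yes _ = sym (*-identityˡ _)
    ... | no e≢f = trans off (sym (zeroˡ _))
      where
      off : term e f ≈ 0#
      off with ld e a in ea | le e c in ec
      ... | false | _ = trans (*-congʳ (zeroˡ _)) (zeroˡ _)
      ... | true | false = trans (*-congʳ (zeroʳ _)) (zeroˡ _)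
      ... | true | true with ld f b in fb | le f d in fd
      ...   | false | _ = trans (*-congˡ (zeroˡ _)) (zeroʳ _)
      ...   | true | false = trans (*-congˡ (zeroʳ _)) (zeroʳ _)
      ...   | true | true = ⊥-elim (e≢f (both-comp (Qo.comp-below ec fd cd) (Do.comp-below ea fb ab)))

  AsRel-homogeneous : ∀ {m} {r : Rel m} {v} → AsRel r v → Homogeneous 3 v
  AsRel-homogeneous (lift (_ , _ , _ , inj₁ ≡.refl)) = ≡.refl ∷ ≡.refl ∷ []
  AsRel-homogeneous (lift (_ , _ , _ , inj₂ ≡.refl)) = ≡.refl ∷ ≡.refl ∷ []

  private
    module _ (a b a' b' : Fin n) where
      ρ : FS n
      ρ = (1# , c1 a b) ∷ (- 1# , c2 a' b') ∷ []

      x₁-image : ∀ c d → x₁ (ext (sub M) ρ) c d ≈ M a c * M b d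
      x₁-image c d = begin
        ⟪ ext (sub M) ρ ∣ [ c1 c d ] ⟫                            ≈⟨ ⟪⟫-ext (sub M) ρ [ c1 c d ] ⟩
        ⟪ ρ ∣ (λ s → x₁ (sub M s) c d) ⟫                          ≈⟨ ⟪⟫-binomial (c1 a b) (c2 a' b') (λ s → x₁ (sub M s) c d) ⟩
        x₁ (sub M (c1 a b)) c d - x₁ (sub M (c2 a' b')) c d       ≈⟨ +-cong (x₁-sub-c1 M a b c d) (trans (-‿cong (x₁-sub-c2 M a' b' c d)) -0#≈0#) ⟩
        M a c * M b d + 0#                                        ≈⟨ +-identityʳ _ ⟩
        M a c * M b d                                             ∎

      x₂-image : ∀ c d → x₂ (ext (sub M) ρ) c d ≈ - (M a' c * M b' d)
      x₂-image c d = begin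
        ⟪ ext (sub M) ρ ∣ [ c2 c d ] ⟫                            ≈⟨ ⟪⟫-ext (sub M) ρ [ c2 c d ] ⟩
        ⟪ ρ ∣ (λ s → x₂ (sub M s) c d) ⟫                          ≈⟨ ⟪⟫-binomial (c1 a b) (c2 a' b') (λ s → x₂ (sub M s) c d) ⟩
        x₂ (sub M (c1 a b)) c d - x₂ (sub M (c2 a' b')) c d       ≈⟨ +-cong (x₂-sub-c1 M a b c d) (-‿cong (x₂-sub-c2 M a' b' c d)) ⟩
        0# - M a' c * M b' d                                      ≈⟨ +-identityˡ _ ⟩
        - (M a' c * M b' d)                                       ∎

      -- Treats both families at once: one of the two pairs will be `p`, `p`. By `M-min` the
      -- coefficient function of the image is row `p` of `M`.
      dual-image : ∀ p → comp ld a b ≡ true → comp ld a' b' ≡ true → up ld a b ≡ p → up ld a' b' ≡ p →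
        Dual (AsRel le) (ext (sub M) ρ)
      dual-image p ab a'b' e e' = dual-intro (ext (sub M) ρ)
        (ext-sub-homogeneous M 3 ρ (≡.refl ∷ ≡.refl ∷ [])) (M p)
        (λ c d cd → trans (x₁-image c d) (trans (M-min a b c d ab cd) (reflexive (≡.cong (λ q → M q (up le c d)) e))))
        (λ c d cd → trans (x₂-image c d) (-‿cong (trans (M-min a' b' c d a'b' cd) (reflexive (≡.cong (λ q → M q (up le c d)) e')))))

  M-image : ∀ {r} → AsRel ld r → Span (Dual (AsRel le)) (ext (sub M) r)
  M-image (lift (a , b , ab , inj₁ ≡.refl)) =
    generator (dual-image a b _ _ (up ld a b) ab (D.comp-refl _) ≡.refl (D.up-idem _))
  M-image (lift (a , b , ab , inj₂ ≡.refl)) =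
    generator (dual-image _ _ a b (up ld a b) (D.comp-refl _) ab (D.up-idem _) ≡.refl)

  conj-N : Matrix n → Matrix n
  conj-N x = V ᵀ ⊗ (Q.conj-μ x ⊗ V)

  -- Substitution along `N` acts on test matrices by `H ↦ N H Nᵀ`. Its adjoint acts on coefficients
  -- by `x ↦ Nᵀ x N`, written here in two stages, the inner one being the Möbius congruence of Q.
  ⟨⟩-conj-N : ∀ x H → ⟨ x , N ⊗ (H ⊗ N ᵀ) ⟩ ≈ ⟨ conj-N x , H ⟩
  ⟨⟩-conj-N x H = begin
    ⟨ x , N ⊗ (H ⊗ N ᵀ) ⟩             ≈⟨ ⟨⟩-adjointˡ (N ᵀ) x (H ⊗ N ᵀ) ⟨
    ⟨ N ᵀ ⊗ x , H ⊗ N ᵀ ⟩             ≈⟨ ⟨⟩-adjointʳ (N ᵀ ⊗ x) N H ⟨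
    ⟨ (N ᵀ ⊗ x) ⊗ N , H ⟩             ≈⟨ ⟨⟩-cong {B = H} regroup (λ _ _ → refl) ⟩
    ⟨ conj-N x , H ⟩                  ∎
    where
    U = Q.μ
    regroup : (N ᵀ ⊗ x) ⊗ N ≈M conj-N x
    regroup i j = begin
      ((N ᵀ ⊗ x) ⊗ N) i j                         ≈⟨ ⊗-assoc (N ᵀ) x N i j ⟩
      (N ᵀ ⊗ (x ⊗ N)) i j                         ≈⟨ ⊗-cong {A = N ᵀ} {V ᵀ ⊗ U ᵀ} (⊗-ᵀ U V) (≈M-sym (⊗-assoc x U V)) i j ⟩
      ((V ᵀ ⊗ U ᵀ) ⊗ ((x ⊗ U) ⊗ V)) i j           ≈⟨ ⊗-assoc (V ᵀ) (U ᵀ) ((x ⊗ U) ⊗ V) i j ⟩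
      (V ᵀ ⊗ (U ᵀ ⊗ ((x ⊗ U) ⊗ V))) i j           ≈⟨ ⊗-cong {A = V ᵀ} (λ _ _ → refl) (⊗-assoc (U ᵀ) (x ⊗ U) V) i j ⟨
      (V ᵀ ⊗ ((U ᵀ ⊗ (x ⊗ U)) ⊗ V)) i j           ∎

  -- X and Y are the coefficients, at the tree monomials ⋆_a ∘₁ ⋆_b and ⋆_a ∘₂ ⋆_b of As(Q^⊥), of the
  -- image of v. The coefficients in the intermediate basis B are μᵀ x₁ μ and μᵀ x₂ μ; on comparable
  -- pairs they are diagonal and opposite to each other.
  module Pullback (v : FS n) (dual : Dual (AsRel le) v) where
    z : Fin n → Carrier
    z = diagonal v

    X Y : Matrix n
    X = conj-N (x₁ v)
    Y = conj-N (x₂ v)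

    x̂ : ∀ e f → comp le e f ≡ true → Q.conj-μ (x₁ v) e f ≈ Q.hat z e * δ e f
    x̂ = Q.conj-μ-comparable z (dual-elim₁ dual)

    ŷ : ∀ e f → comp le e f ≡ true → Q.conj-μ (x₂ v) e f ≈ - (Q.hat z e * δ e f)
    ŷ e f ef = trans (Q.conj-μ-comparable (λ m → - z m) (dual-elim₂ dual) e f ef)
      (trans (*-congʳ (trans (∑-cong λ k → sym (-‿distribˡ-* (z k) (Q.μ k e))) (∑-neg (λ k → z k * Q.μ k e))))
        (sym (-‿distribˡ-* _ _)))

    -- Only `e` above `a` and `f` above `b` in Q^⊥ contribute. If `e` equals `f`, or if they are
    -- incomparable in Q and hence comparable in Q^⊥, then `a` and `b` would be comparable in Q^⊥.
    -- At the remaining pairs `w` is zero.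
    vanish : ∀ w → (∀ e f → e ≢ f → comp le e f ≡ true → w e f ≈ 0#) →
      ∀ a b → comp ld a b ≡ false → (V ᵀ ⊗ (w ⊗ V)) a b ≈ 0#
    vanish w off a b ab = ∑-zero outer
      where
      outer : ∀ e → V e a * (w ⊗ V) e b ≈ 0#
      outer e with ld a e in ae
      ... | false = trans (*-congʳ (D.support a e ae)) (zeroˡ _)
      ... | true = trans (*-congˡ (∑-zero inner)) (zeroʳ _)
        where
        inner : ∀ f → w e f * V f b ≈ 0#
        inner f with ld b f in bf
        ... | false = trans (*-congˡ (D.support b f bf)) (zeroʳ _)
        ... | true with comp le e f in ef
        ...   | false = ⊥-elim (true≢false (Do.comp-below ae bf (inc⇒comp ef)) ab)
        ...   | true with e ≟F f
        ...     | yes ≡.refl = ⊥-elim (true≢false (Do.le-chain a b e ae bf) ab)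
        ...     | no e≢f = trans (*-congʳ (off e f e≢f ef)) (zeroˡ _)

    δ-≢ : ∀ {e f : Fin n} → e ≢ f → δ e f ≈ 0#
    δ-≢ {e} {f} e≢f with e ≟F f
    ... | yes e≡f = ⊥-elim (e≢f e≡f)
    ... | no _ = refl

    X-vanish : ∀ a b → comp ld a b ≡ false → X a b ≈ 0#
    X-vanish = vanish (Q.conj-μ (x₁ v)) λ e f e≢f ef →
      trans (x̂ e f ef) (trans (*-congˡ (δ-≢ e≢f)) (zeroʳ _))

    Y-vanish : ∀ a b → comp ld a b ≡ false → Y a b ≈ 0#
    Y-vanish = vanish (Q.conj-μ (x₂ v)) λ e f e≢f ef →
      trans (ŷ e f ef) (trans (-‿cong (trans (*-congˡ (δ-≢ e≢f)) (zeroʳ _))) -0#≈0#)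

    ŵ : Matrix n
    ŵ e f = Q.conj-μ (x₁ v) e f + Q.conj-μ (x₂ v) e f

    X+Y : ∀ a b → X a b + Y a b ≈ (V ᵀ ⊗ (ŵ ⊗ V)) a b
    X+Y a b = sym (trans
      (∑-cong λ e → trans (*-congˡ (trans (∑-cong λ f → distribʳ (V f b) _ _)
          (∑-distrib-+ (λ f → Q.conj-μ (x₁ v) e f * V f b) (λ f → Q.conj-μ (x₂ v) e f * V f b))))
        (distribˡ (V e a) _ _))
      (∑-distrib-+ (λ e → V e a * (Q.conj-μ (x₁ v) ⊗ V) e b) (λ e → V e a * (Q.conj-μ (x₂ v) ⊗ V) e b)))

    -- A test function `γ` handles all values of the minimum together. As `X` and `Y` vanish at
    -- incomparable pairs, `γ` of the minimum may be replaced by `D.spread γ`. Moving the factors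
    -- `V` across the pairing makes that matrix diagonal, and on the diagonal `x̂` and `ŷ` cancel.
    sum-over-min : ∀ (γ : Fin n → Carrier) →
      (∑[ a < n ] (∑[ b < n ] ((X a b + Y a b) * γ (up ld a b)))) ≈ 0#
    sum-over-min γ = begin
      sum (λ a → sum (λ b → (X a b + Y a b) * γ (up ld a b)))
        ≈⟨ ∑-cong (λ a → ∑-cong λ b → entry a b) ⟩
      ⟨ V ᵀ ⊗ (ŵ ⊗ V) , D.Z ᵀ ⊗ D.weighted γ ⟩
        ≈⟨ ⟨⟩-adjointˡ (V ᵀ) (ŵ ⊗ V) (D.Z ᵀ ⊗ D.weighted γ) ⟩
      ⟨ ŵ ⊗ V , V ⊗ (D.Z ᵀ ⊗ D.weighted γ) ⟩
        ≈⟨ ⟨⟩-cong {A = ŵ ⊗ V} (λ _ _ → refl) (≈M-trans (≈M-sym (⊗-assoc V (D.Z ᵀ) (D.weighted γ)))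
             (≈M-trans (⊗-cong {B = D.weighted γ} VZᵀ≈δ (λ _ _ → refl)) (⊗-identityˡ (D.weighted γ)))) ⟩
      ⟨ ŵ ⊗ V , D.weighted γ ⟩
        ≈⟨ ⟨⟩-adjointʳ ŵ V (D.weighted γ) ⟩
      ⟨ ŵ , D.weighted γ ⊗ D.μ ⟩
        ≈⟨ ⟨⟩-cong {A = ŵ} (λ _ _ → refl) (D.weighted-μ γ) ⟩
      ⟨ ŵ , (λ e f → D.hat γ e * δ e f) ⟩
        ≈⟨ ∑-zero (λ e → ∑-zero (diagonal-vanish e)) ⟩
      0# ∎
      where
      entry : ∀ a b → (X a b + Y a b) * γ (up ld a b) ≈ (V ᵀ ⊗ (ŵ ⊗ V)) a b * D.spread γ a b
      -- On an incomparable pair `up` takes the default value `b`, which has no meaning as a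
      -- minimum; both sides are zero there.
      entry a b with comp ld a b in ab
      ... | true = *-cong (X+Y a b) (sym (D.spread-up γ a b ab))
      ... | false = trans (trans (*-congʳ zero-sum) (zeroˡ _))
        (sym (trans (*-congʳ (trans (sym (X+Y a b)) zero-sum)) (zeroˡ _)))
        where
        zero-sum : X a b + Y a b ≈ 0#
        zero-sum = trans (+-cong (X-vanish a b ab) (Y-vanish a b ab)) (+-identityˡ _)
      diagonal-vanish : ∀ e f → ŵ e f * (D.hat γ e * δ e f) ≈ 0#
      diagonal-vanish e f with e ≟F f
      ... | no _ = trans (*-congˡ (zeroʳ _)) (zeroʳ _)
      ... | yes ≡.refl = trans (*-congʳ (trans (+-cong (x̂ e e (Q.comp-refl e)) (ŷ e e (Q.comp-refl e))) (-‿inverseʳ _))) (zeroˡ _)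

    -- Modulo the relations of As(Q^⊥) both monomials at a comparable pair equal `c2 p p`. A piece
    -- is the part of the image at `a`, `b` minus this normal form; the subtracted terms cancel over
    -- all pairs by `sum-over-min`.
    record Piece (a b : Fin n) : Set (c ⊔ ℓ) where
      field
        vector : FS n
        inSpan : Span (AsRel ld) vector
        value  : ∀ h → let p = up ld a b in
          ⟪ vector ∣ h ⟫ ≈ X a b * (h (c1 a b) - h (c2 p p)) + Y a b * (h (c2 a b) - h (c2 p p))

    piece : ∀ a b → Piece a b
    piece a b with comp ld a b in ab
    ... | false = record
      { vector = []
      ; inSpan = []
      ; value = λ h → sym (trans (+-cong (trans (*-congʳ (X-vanish a b ab)) (zeroˡ _))
                                         (trans (*-congʳ (Y-vanish a b ab)) (zeroˡ _))) (+-identityˡ _))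
      }
    ... | true = record
      { vector = v₁ ++ (v₂ ++ v₃)
      ; inSpan = scaleˢ (X a b) (generator (lift (a , b , ab , inj₁ ≡.refl)))
          ++ˢ (scaleˢ (- Y a b) (generator (lift (a , b , ab , inj₂ ≡.refl)))
          ++ˢ scaleˢ (Y a b) (generator (lift (p , p , D.comp-refl p , inj₁ ≡.refl))))
      ; value = λ h → begin
          _ ≈⟨ ⟪⟫-++ v₁ (v₂ ++ v₃) h ⟩
          _ ≈⟨ +-cong (trans (⟪⟫-scale (X a b) (rel₁ ld a b) h) (*-congˡ (⟪⟫-binomial (c1 a b) (c2 p p) h)))
                 (trans (⟪⟫-++ v₂ v₃ h)
                   (+-cong (trans (⟪⟫-scale (- Y a b) (rel₂ ld a b) h) (*-congˡ (⟪⟫-binomial (c1 p p) (c2 a b) h)))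
                     (trans (⟪⟫-scale (Y a b) (rel₁ ld p p) h) (*-congˡ (trans (⟪⟫-binomial (c1 p p) _ h)
                       (+-congˡ (-‿cong (reflexive (≡.cong (λ q → h (c2 q q)) (D.up-idem p)))))))))) ⟩
          X a b * (h (c1 a b) - h (c2 p p)) + (- Y a b * (h (c1 p p) - h (c2 a b)) + Y a b * (h (c1 p p) - h (c2 p p)))
            ≈⟨ +-congˡ (telescope (Y a b) (h (c1 p p)) (h (c2 a b)) (h (c2 p p))) ⟩
          X a b * (h (c1 a b) - h (c2 p p)) + Y a b * (h (c2 a b) - h (c2 p p)) ∎
      }
      where
      p = up ld a b
      v₁ = scale (X a b) (rel₁ ld a b)
      -- The monomial `c2 a b` is brought to `c2 p p` by way of `c1 p p`: `v₂` makes the first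
      -- exchange and `v₃` the second.
      v₂ = scale (- Y a b) (rel₂ ld a b)
      v₃ = scale (Y a b) (rel₁ ld p p)
      telescope : ∀ y r s t → - y * (r - s) + y * (r - t) ≈ y * (s - t)
      telescope y r s t = begin
        - y * (r - s) + y * (r - t)       ≈⟨ +-congʳ (trans (sym (-‿distribˡ-* y (r - s))) (-‿distribʳ-* y (r - s))) ⟩
        y * - (r - s) + y * (r - t)       ≈⟨ distribˡ y _ _ ⟨
        y * (- (r - s) + (r - t))         ≈⟨ *-congˡ (begin
          - (r - s) + (r - t)               ≈⟨ +-congʳ (-‿+-comm r (- s)) ⟨
          - r - (- s) + (r - t)             ≈⟨ +-congʳ (+-congˡ (-‿involutive s)) ⟩
          - r + s + (r - t)                 ≈⟨ +-interchange (- r) s r (- t) ⟩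
          - r + r + (s - t)                 ≈⟨ +-congʳ (-‿inverseˡ r) ⟩
          0# + (s - t)                      ≈⟨ +-identityˡ _ ⟩
          s - t                             ∎) ⟩
        y * (s - t)                       ∎

    pieces : FS n
    pieces = concatMap (λ a → concatMap (λ b → Piece.vector (piece a b)) (allFin n)) (allFin n)

    pieces-inSpan : Span (AsRel ld) pieces
    pieces-inSpan = concatMapˢ _ (λ a → concatMapˢ _ (λ b → Piece.inSpan (piece a b)) (allFin n)) (allFin n)

    image≋pieces : ext (sub N) v ≋ pieces
    image≋pieces = functionals λ h → begin
      ⟪ ext (sub N) v ∣ h ⟫
        ≈⟨ ⟪⟫-ext (sub N) v h ⟩
      ⟪ v ∣ (λ s → ⟪ sub N s ∣ h ⟫) ⟫
        ≈⟨ ⟪⟫-arity₃ v (proj₁ dual) _ ⟩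
      ⟨ x₁ v , (λ a b → ⟪ sub N (c1 a b) ∣ h ⟫) ⟩ + ⟨ x₂ v , (λ a b → ⟪ sub N (c2 a b) ∣ h ⟫) ⟩
        ≈⟨ +-cong (⟨⟩-cong {A = x₁ v} (λ _ _ → refl) (λ a b → trans (⟪⟫-sub-c1 N a b h) (sandwich (at-c1 h) a b)))
                  (⟨⟩-cong {A = x₂ v} (λ _ _ → refl) (λ a b → trans (⟪⟫-sub-c2 N a b h) (sandwich (at-c2 h) a b))) ⟩
      ⟨ x₁ v , N ⊗ (at-c1 h ⊗ N ᵀ) ⟩ + ⟨ x₂ v , N ⊗ (at-c2 h ⊗ N ᵀ) ⟩
        ≈⟨ +-cong (⟨⟩-conj-N (x₁ v) (at-c1 h)) (⟨⟩-conj-N (x₂ v) (at-c2 h)) ⟩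
      ⟨ X , at-c1 h ⟩ + ⟨ Y , at-c2 h ⟩
        ≈⟨ join (λ a b → X a b * h (c1 a b)) (λ a b → Y a b * h (c2 a b)) ⟨
      ∑∑ (λ a b → X a b * h (c1 a b) + Y a b * h (c2 a b))
        ≈⟨ +-identityʳ _ ⟨
      ∑∑ (λ a b → X a b * h (c1 a b) + Y a b * h (c2 a b)) + 0#
        -- With this test function the zero total consists of exactly the normal forms subtracted in
        -- the pieces.
        ≈⟨ +-congˡ (sum-over-min (λ p → - h (c2 p p))) ⟨
      ∑∑ (λ a b → X a b * h (c1 a b) + Y a b * h (c2 a b)) + ∑∑ (λ a b → (X a b + Y a b) * - h (c2 (up ld a b) (up ld a b)))
        ≈⟨ join (λ a b → X a b * h (c1 a b) + Y a b * h (c2 a b)) (λ a b → (X a b + Y a b) * - h (c2 (up ld a b) (up ld a b))) ⟨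
      ∑∑ (λ a b → (X a b * h (c1 a b) + Y a b * h (c2 a b)) + (X a b + Y a b) * - h (c2 (up ld a b) (up ld a b)))
        ≈⟨ ∑-cong (λ a → ∑-cong λ b → trans (+-congˡ (distribʳ _ (X a b) (Y a b)))
             (trans (+-interchange _ _ _ _) (sym (+-cong (distribˡ (X a b) _ _) (distribˡ (Y a b) _ _))))) ⟩
      ∑∑ (λ a b → X a b * (h (c1 a b) - h (c2 (up ld a b) (up ld a b))) + Y a b * (h (c2 a b) - h (c2 (up ld a b) (up ld a b))))
        ≈⟨ ∑-cong (λ a → trans (⟪⟫-allFin (λ b → Piece.vector (piece a b)) h) (∑-cong λ b → Piece.value (piece a b) h)) ⟨
      sum (λ a → ⟪ concatMap (λ b → Piece.vector (piece a b)) (allFin n) ∣ h ⟫)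
        ≈⟨ ⟪⟫-allFin (λ a → concatMap (λ b → Piece.vector (piece a b)) (allFin n)) h ⟨
      ⟪ pieces ∣ h ⟫ ∎
      where
      ∑∑ : Matrix n → Carrier
      ∑∑ A = ∑[ a < n ] (∑[ b < n ] (A a b))
      join : ∀ A B → ∑∑ (λ a b → A a b + B a b) ≈ ∑∑ A + ∑∑ B
      join A B = trans (∑-cong λ a → ∑-distrib-+ (A a) (B a)) (∑-distrib-+ (λ a → sum (A a)) (λ a → sum (B a)))
      sandwich : ∀ (H : Matrix n) a b →
        (∑[ c < n ] (N a c * (∑[ d < n ] (N b d * H c d)))) ≈ (N ⊗ (H ⊗ N ᵀ)) a b
      sandwich H a b = ∑-cong λ c → *-congˡ (∑-cong λ d → *-comm (N b d) (H c d))

  N-image : ∀ {r} → Dual (AsRel le) r → Span (AsRel ld) (ext (sub N) r)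
  N-image {r} dual = respˢ image≋pieces pieces-inSpan
    where open Pullback r dual

  isIsomorphism : IsIsomorphism (AsRel ld) (Dual (AsRel le)) (sub M)
  isIsomorphism = sub-isIsomorphism M N MN≈δ NM≈δ AsRel-homogeneous proj₁ M-image N-image

-- The map on generators and the uniqueness of its extension.

theorem4p4 : ∀ {c ℓ : Level} (K : CharZeroField c ℓ) (F : Forest) →
    Standard F → Thin (leQ F) →
    Σ (BT (sizeF F) → WithField.FS K (sizeF F)) λ Φ →
    (WithField.IsIsomorphism K (WithField.AsRel K (leD F))
    (WithField.Dual K (WithField.AsRel K (leQ F))) Φ
    × WithField.Extends K F Φ)
    × (∀ Ψ → WithField.IsIsomorphism K (WithField.AsRel K (leD F))
    (WithField.Dual K (WithField.AsRel K (leQ F))) Ψ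
    → WithField.Extends K F Ψ
    → ∀ t → WithField.Eq K (WithField.Dual K (WithField.AsRel K (leQ F))) (Ψ t) (Φ t))
theorem4p4 K F std thin = sub M , (isIsomorphism , extends) , unique
  where
  open WithField K
  open CommutativeRing (CharZeroField.cring K) hiding (zero)
  open Matrices (CharZeroField.cring K)
  open Integration K
  open Ideals K
  open Substitution K
  open Pairing K
  open Uniqueness K
  open StandardForest F std thin
  open KoszulDuality K leQ-isForestOrder leD-isForestOrder complementary
  open import Relation.Binary.Reasoning.Setoid setoid

  n = sizeF F
  R' = Dual (AsRel le)

  if-⟪⟫ : ∀ (β : Bool) (v : FS n) h → ⟪ if β then v else [] ∣ h ⟫ ≈ ⟦ β ⟧ * ⟪ v ∣ h ⟫
  if-⟪⟫ true v h = sym (*-identityˡ _)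
  if-⟪⟫ false v h = sym (zeroˡ _)

  sub-gen≋Abar : ∀ b → sub M (gen b) ≋ Abar F b
  sub-gen≋Abar b = functionals λ h → begin
    ⟪ sub M (gen b) ∣ h ⟫
      ≈⟨ ⟪⟫-sub-gen M b h ⟩
    sum (λ c → sum (λ a → ζ ld a b * ζ le a c) * h (gen c))
      ≈⟨ ∑-cong (λ c → *-distribʳ-sum (h (gen c)) (λ a → ζ ld a b * ζ le a c)) ⟩
    sum (λ c → sum (λ a → ζ ld a b * ζ le a c * h (gen c)))
      ≈⟨ ∑-comm (λ c a → ζ ld a b * ζ le a c * h (gen c)) ⟩
    sum (λ a → sum (λ c → ζ ld a b * ζ le a c * h (gen c)))
      ≈⟨ ∑-cong (λ a → trans (∑-cong λ c → *-assoc (ζ ld a b) (ζ le a c) (h (gen c)))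
           (sym (*-distribˡ-sum (ζ ld a b) (λ c → ζ le a c * h (gen c))))) ⟩
    sum (λ a → ζ ld a b * sum (λ c → ζ le a c * h (gen c)))
      ≈⟨ ∑-cong (λ a → trans (if-⟪⟫ (ld a b) (above a) h) (*-congˡ (trans
           (⟪⟫-allFin (λ c → if le a c then (1# , gen c) ∷ [] else []) h)
           (∑-cong λ c → trans (if-⟪⟫ (le a c) ((1# , gen c) ∷ []) h) (*-congˡ (trans (+-identityʳ _) (*-identityˡ _))))))) ⟨
    sum (λ a → ⟪ if ld a b then above a else [] ∣ h ⟫)
      ≈⟨ ⟪⟫-allFin (λ a → if ld a b then above a else []) h ⟨
    ⟪ Abar F b ∣ h ⟫ ∎
    where
    above : Fin n → FS n
    above a = concatMap (λ c → if le a c then (1# , gen c) ∷ [] else []) (allFin n)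

  extends : Extends F (sub M)
  extends b = ∈⇒InIdeal (difference (≋⇒≃ (sub-gen≋Abar b)))

  unique : ∀ Ψ → IsIsomorphism (AsRel ld) R' Ψ → Extends F Ψ → ∀ t → Eq R' (Ψ t) (sub M t)
  unique Ψ Ψ-iso Ψ-extends t = ∈⇒InIdeal (difference (morphism-unique
    (IsIsomorphism.morphism Ψ-iso) (IsIsomorphism.morphism isIsomorphism) on-generators t))
    where
    on-generators : ∀ b → Ψ (gen b) ≋ sub M (gen b)
    on-generators b = functionals λ h → x-y≈0⇒x≈y (trans (sym (⟪⟫--FS (Ψ (gen b)) (sub M (gen b)) h))
      (at (arity₂-∈⇒0 {R = R'} proj₁ same homogeneous₂) h))
      where
      same : Ψ (gen b) -FS sub M (gen b) ∈⟨ R' ⟩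
      -- `Extends` yields a congruence only; homogeneity of arity 2 upgrades it to the equality in
      -- the free operad that `morphism-unique` asks for.
      same = difference (≃-trans (modulo (InIdeal⇒∈ (Ψ-extends b))) (≃-sym (≋⇒≃ (sub-gen≋Abar b))))
      homogeneous₂ : Homogeneous 2 (Ψ (gen b) -FS sub M (gen b))
      homogeneous₂ = All.++⁺ (IsMorphism.homogeneous (IsIsomorphism.morphism Ψ-iso) (gen b))
        (scale-homogeneous (- 1#) (sub-homogeneous M (gen b)))
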